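{- Let $(T_n(x))_{n\ge0}$ be real polynomials with $\deg(T_n(x))=m_n$, $m_{n+1}=m_n+1$, satisfying for $n\ge 0$ $$T_{n+1}(x)=\bigl(-m_n\mu_n x^2+\beta_n x+\beta_n+m_n\nu_n\bigr)T_n(x)+\bigl(\mu_n x^3+\nu_n x^2-\nu_n x-\mu_n\bigr)\frac{d}{dx}T_n(x),$$ where $\beta_n,\mu_n,\nu_n$ are real sequences with $\mu_n\le 0\le\nu_n$. Assume that $T_0(x)$ is symmetric with positive leading coefficient and is Hurwitz stable. If $\mu_n+\nu_n\le 0$ and $2\beta_n+m_n(\mu_n+\nu_n)\ge 0$ for all $n$, then $T_n(x)$ is Hurwitz stable and semi-$\gamma$-positive for all $n$.
   Context: A polynomial $f\in\mathbb{C}[x]$ is Hurwitz stable if it is identically zero or $f(x)\ne0$ whenever $\Re(x)>0$. A polynomial $f$ of degree $d$ is symmetric if $f(x)=x^df(1/x)$. A symmetric polynomial $f$ of degree $d=2N+\nu$, $\nu\in\{0,1\}$, can be written as $f(x)=(1+x)^{\nu}\sum_{k=0}^{N}g_kx^k(1+x^2)^{N-k}$; it is semi-$\gamma$-positive if all $g_k\ge0$. -}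

module Defs where

open import Level using (Level; _⊔_; suc)
open import Algebra.Bundles using (CommutativeRing; RawRing)
open import Algebra.Structures using (IsCommutativeRing)
import Algebra.Definitions.RawMonoid as RawMonoidDefs
import Algebra.Definitions.RawSemiring as RawSemiringDefs
open import Data.Fin.Base using (Fin; toℕ)
open import Data.List.Base using (List; []; _∷_; map; foldr)
open import Data.Nat.Base as ℕ using (ℕ; zero)
open import Data.Product.Base using (∃; ∃-syntax; _×_; _,_)
open import Data.Sum.Base using (_⊎_)
open import Relation.Binary.Core using (Rel)
open import Relation.Binary.Structures using (IsStrictTotalOrder)
import Relation.Binary.Construct.StrictToNonStrict as ToNonStrict
open import Relation.Binary.PropositionalEquality using (_≡_)
open import Relation.Nullary.Negation using (¬_)
open import Relation.Unary using (Pred)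

-- The library has no real numbers.  They are given by their categorical
-- (classical) axiomatisation: a Dedekind-complete totally ordered field, which
-- is unique up to unique isomorphism.
record CompleteOrderedField (c ℓ₁ ℓ₂ : Level) : Set (suc (c ⊔ ℓ₁ ⊔ ℓ₂)) where
  infix  8 -_
  infixl 7 _*_
  infixl 6 _+_
  infix  4 _≈_ _<_
  field
    Carrier            : Set c
    _≈_                : Rel Carrier ℓ₁
    _<_                : Rel Carrier ℓ₂
    _+_ _*_            : Carrier → Carrier → Carrier
    -_                 : Carrier → Carrier
    0# 1#              : Carrier
    isCommutativeRing  : IsCommutativeRing _≈_ _+_ _*_ -_ 0# 1#
    isStrictTotalOrder : IsStrictTotalOrder _≈_ _<_

  open ToNonStrict _≈_ _<_ public using (_≤_)

  IsUpperBound : ∀ {p} → Pred Carrier p → Carrier → Set (c ⊔ ℓ₁ ⊔ ℓ₂ ⊔ p)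
  IsUpperBound P u = ∀ x → P x → x ≤ u

  field
    0<1      : 0# < 1#
    inverse  : ∀ x → ¬ x ≈ 0# → ∃[ y ] x * y ≈ 1#
    +-mono-< : ∀ x y z → x < y → x + z < y + z
    *-pos    : ∀ x y → 0# < x → 0# < y → 0# < x * y
    supremum : (P : Pred Carrier (c ⊔ ℓ₁ ⊔ ℓ₂)) → ∃ P → ∃ (IsUpperBound P) →
               ∃[ s ] IsUpperBound P s × (∀ u → IsUpperBound P u → s ≤ u)

  commutativeRing : CommutativeRing c ℓ₁
  commutativeRing = record { isCommutativeRing = isCommutativeRing }

  open CommutativeRing commutativeRing public using (rawRing; +-rawMonoid)

-- A polynomial is its list of coefficients, constant term first; trailing
-- zeros are allowed, so equality and degree refer to coefficients and not to
-- the list or its length.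
module Polynomials {c ℓ} (R : RawRing c ℓ) where
  open RawRing R
  open RawMonoidDefs +-rawMonoid using () renaming (_×_ to _·_)

  infixl 7 _*ₚ_
  infixl 6 _+ₚ_
  infix  4 _≈ₚ_

  Poly : Set c
  Poly = List Carrier

  coeff : Poly → ℕ → Carrier
  coeff []      _         = 0#
  coeff (a ∷ p) zero      = a
  coeff (a ∷ p) (ℕ.suc k) = coeff p k

  _≈ₚ_ : Rel Poly ℓ
  p ≈ₚ q = ∀ k → coeff p k ≈ coeff q k

  HasDegree : Poly → ℕ → Set ℓ
  HasDegree p d = ¬ coeff p d ≈ 0# × (∀ k → d ℕ.< k → coeff p k ≈ 0#)

  eval : Poly → Carrier → Carrier
  eval p x = foldr (λ a v → a + x * v) 0# p

  _+ₚ_ : Poly → Poly → Poly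
  []      +ₚ q       = q
  (a ∷ p) +ₚ []      = a ∷ p
  (a ∷ p) +ₚ (b ∷ q) = (a + b) ∷ (p +ₚ q)

  _*ₚ_ : Poly → Poly → Poly
  []      *ₚ q = []
  (a ∷ p) *ₚ q = map (a *_) q +ₚ (0# ∷ (p *ₚ q))

  polyRawRing : RawRing c ℓ
  polyRawRing = record
    { Carrier = Poly
    ; _≈_     = _≈ₚ_
    ; _+_     = _+ₚ_
    ; _*_     = _*ₚ_
    ; -_      = map -_
    ; 0#      = []
    ; 1#      = 1# ∷ []
    }

  -- scaleFrom k [a₀, a₁, …] = [k a₀, (k+1) a₁, …]
  scaleFrom : ℕ → Poly → Poly
  scaleFrom k []      = []
  scaleFrom k (a ∷ p) = (k · a) ∷ scaleFrom (ℕ.suc k) p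

  derivative : Poly → Poly
  derivative []      = []
  derivative (_ ∷ p) = scaleFrom 1 p

module RealAndComplex {c ℓ₁ ℓ₂} (ℝ : CompleteOrderedField c ℓ₁ ℓ₂) where
  open CompleteOrderedField ℝ

  open RawMonoidDefs +-rawMonoid public using () renaming (_×_ to _·_)

  infix 5 _+i_

  record ℂ : Set c where
    constructor _+i_
    field
      re im : Carrier

  open ℂ public

  ℂ-rawRing : RawRing c ℓ₁
  ℂ-rawRing = record
    { Carrier = ℂ
    ; _≈_     = λ z w → re z ≈ re w × im z ≈ im w
    ; _+_     = λ z w → (re z + re w) +i (im z + im w)
    ; _*_     = λ z w → (re z * re w + - (im z * im w)) +i (re z * im w + im z * re w)
    ; -_      = λ z → (- re z) +i (- im z)
    ; 0#      = 0# +i 0#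
    ; 1#      = 1# +i 0#
    }

  open Polynomials rawRing public
  module ℂ[x] = Polynomials ℂ-rawRing

  complexify : Poly → ℂ[x].Poly
  complexify = map (_+i 0#)

  HurwitzStable : ℂ[x].Poly → Set (c ⊔ ℓ₁ ⊔ ℓ₂)
  HurwitzStable f = f ℂ[x].≈ₚ [] ⊎ (∀ z → 0# < re z → ¬ ℂ[x].eval f z ≈ᶜ 0ᶜ)
    where open RawRing ℂ-rawRing using () renaming (_≈_ to _≈ᶜ_; 0# to 0ᶜ)

  -- f(x) = x^d f(1/x) for every x ≠ 0, with d = deg f; here y is 1/x.
  IsSymmetric : Poly → ℕ → Set (c ⊔ ℓ₁)
  IsSymmetric f d = HasDegree f d × (∀ x y → x * y ≈ 1# → eval f x ≈ x ^ d * eval f y)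
    where open RawSemiringDefs (RawRing.rawSemiring rawRing) using (_^_)

  -- (1+x)^ν ∑_{k=0}^{N} g_k x^k (1+x²)^{N-k}
  gammaExpansion : (ν N : ℕ) → (Fin (ℕ.suc N) → Carrier) → Poly
  gammaExpansion ν N g =
    (1# ∷ 1# ∷ []) ^ ν *ₚ
    sum (λ k → (g k ∷ []) *ₚ X ^ toℕ k *ₚ (1# ∷ 0# ∷ 1# ∷ []) ^ (N ℕ.∸ toℕ k))
    where
    open RawSemiringDefs (RawRing.rawSemiring polyRawRing) using (_^_; sum)
    X : Poly
    X = 0# ∷ 1# ∷ []

  -- The coefficients g are uniquely determined by f, so asking for some
  -- nonnegative g is the same as asking that the g of f be nonnegative.
  SemiGammaPositive : Poly → Set (c ⊔ ℓ₁ ⊔ ℓ₂)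
  SemiGammaPositive f =
    ∃[ N ] ∃[ ν ] IsSymmetric f (2 ℕ.* N ℕ.+ toℕ {2} ν) ×
      ∃[ g ] f ≈ₚ gammaExpansion (toℕ ν) N g × (∀ k → 0# ≤ g k)

{-# OPTIONS --safe #-}
module Submission where

-- Put e = -(μ + ν)/2 and h = (2β + m(μ + ν))/2.  Then ν, e and h are
-- nonnegative and the recurrence reads T₁ = P T + S T′, where the coefficients
-- of P and S are linear in m ν, m e, h and in ν, e respectively.
--
-- Stability.  Let the zeros r of T satisfy Re r ≤ 0 and let x = Re z > 0.  Then
-- T′/T (z) is a sum of m numbers 1/(z - r) in the disc x |ζ|² ≤ Re ζ, which by
-- convexity gives Laguerre's inequality x |T′|² ≤ m Re (T′ T̄).  A zero of
-- P T + S T′ at z would turn it into x |P|² + m Re (P S̄) ≤ 0, but that quantity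
-- is a quadratic form in m ν, m e, h with nonnegative coefficients and positive
-- diagonal.
--
-- γ-positivity.  The recurrence maps each (1 + x)^ν x^j (1 + x²)^i to a
-- nonnegative combination of such products, so only T₀ is at stake.  Since
-- z + 1/z = u has a solution with Re z > 0 whenever Re u > 0, stability of T₀
-- makes Σ g_k u^{N-k} stable; by Gauss–Lucas so are its derivatives, hence all
-- its coefficients are nonnegative.
--
-- Constructively a complex polynomial has a root only up to double negation.
-- That is enough, because every inequality and every nonvanishing statement
-- above is stable under double negation.

open import Defs
open import Algebra.Bundles using (CommutativeRing; RawRing)
open import Algebra.Structures using (IsCommutativeRing)
import Algebra.Definitions.RawMonoid as RawMonoidDefs
import Algebra.Definitions.RawSemiring as RawSemiringDefs
import Algebra.Properties.CommutativeMonoid.Mult as CommutativeMonoidMult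
import Algebra.Properties.CommutativeSemiring.Exp as CommutativeExp
import Algebra.Properties.Ring as RingProperties
import Algebra.Properties.Semiring.Exp as Exp
import Algebra.Properties.Semiring.Mult as Mult
import Algebra.Properties.Semiring.Mult.TCOptimised as OptimisedMult
import Algebra.Properties.Semiring.Sum as Sum
import Algebra.Solver.Ring as RingSolver
open import Algebra.Solver.Ring.AlmostCommutativeRing
  using (fromCommutativeRing; _-Raw-AlmostCommutative⟶_)
open import Data.Empty using (⊥; ⊥-elim)
open import Data.Fin.Base using (Fin; zero; suc; toℕ)
import Data.Fin.Properties as Fin
open import Data.Integer.Base as ℤ using (ℤ; +_; -[1+_])
import Data.Integer.Properties as ℤ
open import Data.List.Base using (List; []; _∷_; _∷ʳ_; foldr; length; map; take)
import Data.List.Properties as List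
open import Data.List.Relation.Unary.All using (All; []; _∷_)
import Data.List.Relation.Unary.All.Properties as All
open import Data.Maybe.Base using (Maybe; just; nothing)
open import Data.Nat.Base as ℕ using (ℕ; zero; suc)
import Data.Nat.Induction as ℕ
import Data.Nat.Properties as ℕ
open import Data.Product.Base using (_×_; _,_; proj₁; proj₂; ∃-syntax)
open import Data.Sum.Base using (_⊎_; inj₁; inj₂; [_,_]′)
open import Function.Base using (id; _∘_)
open import Level using (Lift; lift; _⊔_)
import Relation.Binary.Construct.StrictToNonStrict as ToNonStrict
open import Relation.Binary.Definitions using (tri<; tri≈; tri>)
open import Relation.Binary.PropositionalEquality as ≡ using (_≡_)
open import Relation.Binary.Structures using (IsStrictTotalOrder; IsTotalOrder)
open import Relation.Nullary.Decidable.Core using (Dec; yes; no)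
open import Relation.Nullary.Negation using (¬_)

-- Laguerre's inequality is multiplied through by |T|², so it involves no division, and no list of
-- all zeros is ever formed: each induction step splits off one zero, whose double negation is
-- discharged at once against an inequality. Estimates are made on |·|², which keeps moduli and
-- arguments out of them.
--
-- The order is decidable and suprema exist, but a supremum does not come with points approaching
-- it. This is why the fundamental theorem of algebra rests on compactness in contrapositive form
-- and not on a minimising sequence.
--
-- The positive leading coefficient of T₀ is by symmetry T₀(0) = g_0, which is the leading
-- coefficient of Σ g_k u^(N-k) and so fixes the sign of every g_k. Symmetry of the later T_n is
-- read off from their γ-expansions.
--
-- Polynomials are lists up to trailing zeros, so identities are proved on values; the values at
-- positive reals already determine all coefficients.

module IntegerCoefficientSolver {c ℓ} (R : CommutativeRing c ℓ) where
  open CommutativeRing R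
  open RingProperties ring
  open OptimisedMult semiring using (×-homo-+; ×1-homo-*; 1+×) renaming (_×_ to _·_)
  open import Relation.Binary.Reasoning.Setoid setoid

  -- The optimised multiple makes `fromℕ 1` and `fromℕ 2` compute to `1#` and `1# + 1#`, so that
  -- `con (+ 1)` and `con (+ 2)` denote the very terms that occur in the statements.
  fromℕ : ℕ → Carrier
  fromℕ n = n · 1#

  fromℤ : ℤ → Carrier
  fromℤ (+ n)    = fromℕ n
  fromℤ -[1+ n ] = - fromℕ (suc n)

  private
    cancel-1 : ∀ x y → (1# + x) + - (1# + y) ≈ x + - y
    cancel-1 x y = begin
      (1# + x) + - (1# + y)      ≈⟨ +-cong (+-comm 1# x) (sym (-‿+-comm 1# y)) ⟩
      (x + 1#) + (- 1# + - y)    ≈⟨ +-assoc x 1# _ ⟩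
      x + (1# + (- 1# + - y))    ≈⟨ +-congˡ (sym (+-assoc 1# (- 1#) (- y))) ⟩
      x + ((1# + - 1#) + - y)    ≈⟨ +-congˡ (+-congʳ (-‿inverseʳ 1#)) ⟩
      x + (0# + - y)             ≈⟨ +-congˡ (+-identityˡ _) ⟩
      x + - y                    ∎

  fromℤ-⊖ : ∀ m n → fromℤ (m ℤ.⊖ n) ≈ fromℕ m + - fromℕ n
  fromℤ-⊖ m zero = begin
    fromℤ (m ℤ.⊖ 0)   ≡⟨ ≡.cong fromℤ (ℤ.⊖-≥ {m} {0} ℕ.z≤n) ⟩
    fromℕ m           ≈⟨ sym (+-identityʳ _) ⟩
    fromℕ m + 0#      ≈⟨ +-congˡ (sym -0#≈0#) ⟩
    fromℕ m + - 0#    ∎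
  fromℤ-⊖ zero    (suc n) = sym (+-identityˡ _)
  fromℤ-⊖ (suc m) (suc n) = begin
    fromℤ (suc m ℤ.⊖ suc n)              ≡⟨ ≡.cong fromℤ (ℤ.[1+m]⊖[1+n]≡m⊖n m n) ⟩
    fromℤ (m ℤ.⊖ n)                      ≈⟨ fromℤ-⊖ m n ⟩
    fromℕ m + - fromℕ n                  ≈⟨ sym (cancel-1 _ _) ⟩
    (1# + fromℕ m) + - (1# + fromℕ n)    ≈⟨ sym (+-cong (1+× m 1#) (-‿cong (1+× n 1#))) ⟩
    fromℕ (suc m) + - fromℕ (suc n)      ∎

  fromℤ-+ : ∀ i j → fromℤ (i ℤ.+ j) ≈ fromℤ i + fromℤ j
  fromℤ-+ (+ m)    (+ n)    = ×-homo-+ 1# m n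
  fromℤ-+ (+ m)    -[1+ n ] = fromℤ-⊖ m (suc n)
  fromℤ-+ -[1+ m ] (+ n)    = trans (fromℤ-⊖ n (suc m)) (+-comm _ _)
  fromℤ-+ -[1+ m ] -[1+ n ] = begin
    - fromℕ (suc (suc (m ℕ.+ n)))            ≡⟨ ≡.cong (λ k → - fromℕ (suc k)) (≡.sym (ℕₚ.+-suc m n)) ⟩
    - fromℕ (suc m ℕ.+ suc n)                ≈⟨ -‿cong (×-homo-+ 1# (suc m) (suc n)) ⟩
    - (fromℕ (suc m) + fromℕ (suc n))        ≈⟨ sym (-‿+-comm _ _) ⟩
    - fromℕ (suc m) + - fromℕ (suc n)        ∎
    where import Data.Nat.Properties as ℕₚ

  fromℤ-neg : ∀ i → fromℤ (ℤ.- i) ≈ - fromℤ i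
  fromℤ-neg (+ zero)  = sym -0#≈0#
  fromℤ-neg (+ suc n) = refl
  fromℤ-neg -[1+ n ]  = sym (-‿involutive _)

  private
    fromℤ-*₊ : ∀ m j → fromℤ (+ m ℤ.* j) ≈ fromℕ m * fromℤ j
    fromℤ-*₊ m (+ n) = begin
      fromℤ (+ m ℤ.* + n)    ≡⟨ ≡.cong fromℤ (≡.sym (ℤ.pos-* m n)) ⟩
      fromℕ (m ℕ.* n)        ≈⟨ ×1-homo-* m n ⟩
      fromℕ m * fromℕ n      ∎
    fromℤ-*₊ m -[1+ n ] = begin
      fromℤ (+ m ℤ.* (ℤ.- + suc n))      ≡⟨ ≡.cong fromℤ (≡.sym (ℤ.neg-distribʳ-* (+ m) (+ suc n))) ⟩
      fromℤ (ℤ.- (+ m ℤ.* + suc n))      ≈⟨ fromℤ-neg (+ m ℤ.* + suc n) ⟩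
      - fromℤ (+ m ℤ.* + suc n)          ≈⟨ -‿cong (fromℤ-*₊ m (+ suc n)) ⟩
      - (fromℕ m * fromℕ (suc n))        ≈⟨ -‿distribʳ-* _ _ ⟩
      fromℕ m * - fromℕ (suc n)          ∎

  fromℤ-* : ∀ i j → fromℤ (i ℤ.* j) ≈ fromℤ i * fromℤ j
  fromℤ-* (+ m)    j = fromℤ-*₊ m j
  fromℤ-* -[1+ m ] j = begin
    fromℤ ((ℤ.- + suc m) ℤ.* j)    ≡⟨ ≡.cong fromℤ (≡.sym (ℤ.neg-distribˡ-* (+ suc m) j)) ⟩
    fromℤ (ℤ.- (+ suc m ℤ.* j))    ≈⟨ fromℤ-neg (+ suc m ℤ.* j) ⟩
    - fromℤ (+ suc m ℤ.* j)        ≈⟨ -‿cong (fromℤ-*₊ (suc m) j) ⟩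
    - (fromℕ (suc m) * fromℤ j)    ≈⟨ -‿distribˡ-* _ _ ⟩
    - fromℕ (suc m) * fromℤ j      ∎

  private
    morphism : ℤ.+-*-rawRing -Raw-AlmostCommutative⟶ fromCommutativeRing R
    morphism = record
      { ⟦_⟧    = fromℤ
      ; +-homo = fromℤ-+
      ; *-homo = fromℤ-*
      ; -‿homo = fromℤ-neg
      ; 0-homo = refl
      ; 1-homo = refl
      }

    coeff≟ : ∀ i j → Maybe (fromℤ i ≈ fromℤ j)
    coeff≟ i j with i ℤ.≟ j
    ... | yes i≡j = just (reflexive (≡.cong fromℤ i≡j))
    ... | no  _   = nothing

  open RingSolver ℤ.+-*-rawRing (fromCommutativeRing R) morphism coeff≟ public
    using (Polynomial; _:+_; _:*_; _:-_; :-_; _:=_; con; solve)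

-- Ordered fields: stability under double negation and certificates for inequalities

module OrderedFieldProperties {c ℓ₁ ℓ₂} (ℝ : CompleteOrderedField c ℓ₁ ℓ₂) where
  open CompleteOrderedField ℝ public
  open RealAndComplex ℝ public using (_·_)
  open CommutativeRing commutativeRing public
    using ( refl; sym; trans; reflexive; setoid; +-cong; +-congˡ; +-congʳ; *-cong; *-congˡ; *-congʳ
          ; -‿cong; +-comm; *-comm; +-assoc; *-assoc; zeroˡ; zeroʳ; *-identityˡ; *-identityʳ
          ; +-identityˡ; +-identityʳ; -‿inverseʳ; -‿inverseˡ; semiring; commutativeSemiring; ring )
  module Solver = IntegerCoefficientSolver commutativeRing
  open Solver using (solve; _:+_; _:*_; _:-_; :-_; _:=_; con)
  open IsStrictTotalOrder isStrictTotalOrder public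
    using (compare; _≟_; <-resp-≈) renaming (trans to <-trans; irrefl to <-irrefl)
  open IsTotalOrder (ToNonStrict.isTotalOrder _≈_ _<_ isStrictTotalOrder) public
    using (total) renaming (refl to ≤-refl; trans to ≤-trans; antisym to ≤-antisym)

  infixl 6 _0≤+_ _0<+≤_ _0≤+<_
  infixl 7 _0≤*_ _0<*_

  2# : Carrier
  2# = 1# + 1#

  nat : ℕ → Carrier
  nat n = n · 1#

  abstract
    <-respʳ : ∀ {x y z} → y ≈ z → x < y → x < z
    <-respʳ = proj₁ <-resp-≈

    <-respˡ : ∀ {x y z} → y ≈ z → y < x → z < x
    <-respˡ = proj₂ <-resp-≈

    ≤-respʳ : ∀ {x y z} → y ≈ z → x ≤ y → x ≤ z
    ≤-respʳ y≈z x≤y = ≤-trans x≤y (inj₂ y≈z)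

    ≤-respˡ : ∀ {x y z} → y ≈ z → y ≤ x → z ≤ x
    ≤-respˡ y≈z y≤x = ≤-trans (inj₂ (sym y≈z)) y≤x

    <-≤-trans : ∀ {x y z} → x < y → y ≤ z → x < z
    <-≤-trans = ToNonStrict.<-≤-trans _≈_ _<_ <-trans <-respʳ

    ≤-<-trans : ∀ {x y z} → x ≤ y → y < z → x < z
    ≤-<-trans = ToNonStrict.≤-<-trans _≈_ _<_ sym <-trans <-respˡ

    ≤⇒≯ : ∀ {x y} → x ≤ y → ¬ y < x
    ≤⇒≯ x≤y y<x = <-irrefl refl (<-≤-trans y<x x≤y)

    ≮⇒≥ : ∀ {x y} → ¬ x < y → y ≤ x
    ≮⇒≥ {x} {y} x≮y with compare x y
    ... | tri< x<y _ _ = ⊥-elim (x≮y x<y)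
    ... | tri≈ _ x≈y _ = inj₂ (sym x≈y)
    ... | tri> _ _ y<x = inj₁ y<x

    ≰⇒> : ∀ {x y} → ¬ x ≤ y → y < x
    ≰⇒> {x} {y} x≰y with compare y x
    ... | tri< y<x _ _ = y<x
    ... | tri≈ _ y≈x _ = ⊥-elim (x≰y (inj₂ (sym y≈x)))
    ... | tri> _ _ x<y = ⊥-elim (x≰y (inj₁ x<y))

    -- Trichotomy decides the order, so order statements may be proved by contradiction. This is the
    -- gate through which roots that exist only up to double negation are used.
    ≤-stable : ∀ {x y} → ¬ ¬ x ≤ y → x ≤ y
    ≤-stable ¬¬p = ≮⇒≥ λ y<x → ¬¬p λ x≤y → ≤⇒≯ x≤y y<x

    <-stable : ∀ {x y} → ¬ ¬ x < y → x < y
    <-stable ¬¬p = ≰⇒> λ y≤x → ¬¬p λ x<y → ≤⇒≯ y≤x x<y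

    ≈-stable : ∀ {x y} → ¬ ¬ x ≈ y → x ≈ y
    ≈-stable ¬¬p = ≤-antisym (≤-stable λ k → ¬¬p λ e → k (inj₂ e)) (≤-stable λ k → ¬¬p λ e → k (inj₂ (sym e)))

    ≤∧≉⇒< : ∀ {x y} → x ≤ y → ¬ x ≈ y → x < y
    ≤∧≉⇒< (inj₁ x<y) _   = x<y
    ≤∧≉⇒< (inj₂ x≈y) x≉y = ⊥-elim (x≉y x≈y)

    0<⇒≉0 : ∀ {x} → 0# < x → ¬ x ≈ 0#
    0<⇒≉0 0<x x≈0 = <-irrefl (sym x≈0) 0<x

    +-monoˡ-≤ : ∀ {x y} z → x ≤ y → x + z ≤ y + z
    +-monoˡ-≤ z (inj₁ x<y) = inj₁ (+-mono-< _ _ z x<y)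
    +-monoˡ-≤ z (inj₂ x≈y) = inj₂ (+-congʳ x≈y)

    -- The usual form of an inequality proof below: a visibly nonnegative difference `d` is written
    -- down, and what remains is an identity for the ring solver.
    ≤-by : ∀ {x y d} → 0# ≤ d → x + d ≈ y → x ≤ y
    ≤-by {x} {y} {d} 0≤d x+d≈y =
      ≤-respˡ (+-identityˡ x) (≤-respʳ (trans (+-comm d x) x+d≈y) (+-monoˡ-≤ x 0≤d))

    <-by : ∀ {x y d} → 0# < d → x + d ≈ y → x < y
    <-by {x} {y} {d} 0<d x+d≈y =
      <-respˡ (+-identityˡ x) (<-respʳ (trans (+-comm d x) x+d≈y) (+-mono-< _ _ x 0<d))

    ≤⇒0≤- : ∀ {x y} → x ≤ y → 0# ≤ y + - x
    ≤⇒0≤- {x} x≤y = ≤-respˡ (-‿inverseʳ x) (+-monoˡ-≤ (- x) x≤y)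

    <⇒0<- : ∀ {x y} → x < y → 0# < y + - x
    <⇒0<- {x} x<y = <-respˡ (-‿inverseʳ x) (+-mono-< _ _ (- x) x<y)

    _0≤+_ : ∀ {x y} → 0# ≤ x → 0# ≤ y → 0# ≤ x + y
    _0≤+_ {x} {y} 0≤x 0≤y = ≤-trans 0≤y (≤-by 0≤x (+-comm y x))

    _0<+≤_ : ∀ {x y} → 0# < x → 0# ≤ y → 0# < x + y
    _0<+≤_ {x} {y} 0<x 0≤y = <-≤-trans 0<x (≤-by 0≤y refl)

    _0≤+<_ : ∀ {x y} → 0# ≤ x → 0# < y → 0# < x + y
    _0≤+<_ {x} {y} 0≤x 0<y = <-≤-trans 0<y (≤-by 0≤x (+-comm y x))

    _0<*_ : ∀ {x y} → 0# < x → 0# < y → 0# < x * y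
    _0<*_ = *-pos _ _

    _0≤*_ : ∀ {x y} → 0# ≤ x → 0# ≤ y → 0# ≤ x * y
    inj₁ 0<x 0≤* inj₁ 0<y = inj₁ (0<x 0<* 0<y)
    inj₁ _   0≤* inj₂ 0≈y = inj₂ (sym (trans (*-congˡ (sym 0≈y)) (zeroʳ _)))
    inj₂ 0≈x 0≤* _        = inj₂ (sym (trans (*-congʳ (sym 0≈x)) (zeroˡ _)))

    0≤neg : ∀ {x} → x ≤ 0# → 0# ≤ - x
    0≤neg {x} x≤0 = ≤-respʳ (+-identityˡ _) (≤⇒0≤- x≤0)

    0<neg : ∀ {x} → x < 0# → 0# < - x
    0<neg {x} x<0 = <-respʳ (+-identityˡ _) (<⇒0<- x<0)

    0≤sq : ∀ x → 0# ≤ x * x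
    0≤sq x with total 0# x
    ... | inj₁ 0≤x = 0≤x 0≤* 0≤x
    ... | inj₂ x≤0 = ≤-respʳ (solve 1 (λ x → :- x :* :- x := x :* x) refl x) (0≤neg x≤0 0≤* 0≤neg x≤0)

    0<sq : ∀ {x} → ¬ x ≈ 0# → 0# < x * x
    0<sq {x} x≉0 with compare 0# x
    ... | tri< 0<x _ _ = 0<x 0<* 0<x
    ... | tri≈ _ 0≈x _ = ⊥-elim (x≉0 (sym 0≈x))
    ... | tri> _ _ x<0 = <-respʳ (solve 1 (λ x → :- x :* :- x := x :* x) refl x) (0<neg x<0 0<* 0<neg x<0)

    0≤1 : 0# ≤ 1#
    0≤1 = inj₁ 0<1

    0<2 : 0# < 2#
    0<2 = 0<1 0<+≤ 0≤1

    x*x≈0⇒x≈0 : ∀ {x} → x * x ≈ 0# → x ≈ 0#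
    x*x≈0⇒x≈0 xx≈0 = ≈-stable λ x≉0 → 0<⇒≉0 (0<sq x≉0) xx≈0

    +≈0⇒≈0 : ∀ {x y} → 0# ≤ x → 0# ≤ y → x + y ≈ 0# → x ≈ 0#
    +≈0⇒≈0 {x} {y} 0≤x 0≤y x+y≈0 = ≤-antisym (≤-by 0≤y x+y≈0) 0≤x

    *-cancel-0< : ∀ {x y} → 0# ≤ x → 0# < x * y → 0# < y
    *-cancel-0< {x} {y} 0≤x 0<xy = ≰⇒> λ y≤0 →
      ≤⇒≯ (≤-by (0≤x 0≤* 0≤neg y≤0) (solve 2 (λ x y → x :* y :+ x :* :- y := con (+ 0)) refl x y)) 0<xy

    *-cancel-0≤ : ∀ {x y} → 0# < x → 0# ≤ x * y → 0# ≤ y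
    *-cancel-0≤ {x} {y} 0<x 0≤xy = ≮⇒≥ λ y<0 →
      ≤⇒≯ 0≤xy (<-by (0<x 0<* 0<neg y<0) (solve 2 (λ x y → x :* y :+ x :* :- y := con (+ 0)) refl x y))

    *-≉0 : ∀ {x y} → x * y ≈ 0# → ¬ x ≈ 0# → y ≈ 0#
    *-≉0 {x} {y} xy≈0 x≉0 with inverse x x≉0
    ... | x⁻¹ , xx⁻¹≈1 = begin
      y              ≈⟨ sym (*-identityˡ y) ⟩
      1# * y         ≈⟨ *-congʳ (sym xx⁻¹≈1) ⟩
      x * x⁻¹ * y    ≈⟨ solve 3 (λ x w y → x :* w :* y := w :* (x :* y)) refl x x⁻¹ y ⟩
      x⁻¹ * (x * y)  ≈⟨ *-congˡ xy≈0 ⟩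
      x⁻¹ * 0#       ≈⟨ zeroʳ _ ⟩
      0#             ∎
      where open import Relation.Binary.Reasoning.Setoid setoid

    positive-inverse : ∀ {x} → 0# < x → ∃[ y ] 0# < y × x * y ≈ 1#
    positive-inverse {x} 0<x with inverse x (0<⇒≉0 0<x)
    ... | y , xy≈1 = y , *-cancel-0< (inj₁ 0<x) (<-respʳ (sym xy≈1) 0<1) , xy≈1

    ½ : Carrier
    ½ = proj₁ (positive-inverse 0<2)

    0<½ : 0# < ½
    0<½ = proj₁ (proj₂ (positive-inverse 0<2))

    2*½≈1 : 2# * ½ ≈ 1#
    2*½≈1 = proj₂ (proj₂ (positive-inverse 0<2))

    ½+½ : ∀ x → ½ * x + ½ * x ≈ x
    ½+½ x = trans (solve 2 (λ h x → h :* x :+ h :* x := (con (+ 2) :* h) :* x) refl ½ x)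
                  (trans (*-congʳ 2*½≈1) (*-identityˡ x))

    +-mono-≤ : ∀ {x y z w} → x ≤ y → z ≤ w → x + z ≤ y + w
    +-mono-≤ {x} {y} {z} {w} x≤y z≤w = ≤-by (≤⇒0≤- x≤y 0≤+ ≤⇒0≤- z≤w)
      (solve 4 (λ x y z w → x :+ z :+ (y :- x :+ (w :- z)) := y :+ w) refl x y z w)

    *-monoˡ-≤ : ∀ {x y} z → 0# ≤ z → x ≤ y → z * x ≤ z * y
    *-monoˡ-≤ {x} {y} z 0≤z x≤y = ≤-by (0≤z 0≤* ≤⇒0≤- x≤y)
      (solve 3 (λ x y z → z :* x :+ z :* (y :- x) := z :* y) refl x y z)

    *-mono-≤ : ∀ {x y z w} → 0# ≤ x → x ≤ y → 0# ≤ z → z ≤ w → x * z ≤ y * w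
    *-mono-≤ {x} {y} {z} {w} 0≤x x≤y 0≤z z≤w =
      ≤-trans (*-monoˡ-≤ x 0≤x z≤w)
        (≤-respˡ (*-comm w x) (≤-respʳ (*-comm w y) (*-monoˡ-≤ w (≤-trans 0≤z z≤w) x≤y)))

    min : ∀ x y → 0# < x → 0# < y → ∃[ z ] 0# < z × z ≤ x × z ≤ y
    min x y 0<x 0<y with total x y
    ... | inj₁ x≤y = x , 0<x , ≤-refl , x≤y
    ... | inj₂ y≤x = y , 0<y , y≤x , ≤-refl

    -- t = η / (E + η + 1)
    small-multiple : ∀ {E η} → 0# ≤ E → 0# < η → ∃[ t ] 0# < t × t ≤ 1# × t * E < η
    small-multiple {E} {η} 0≤E 0<η with positive-inverse (0≤E 0≤+< 0<η 0<+≤ 0≤1)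
    ... | w , 0<w , eq = η * w , 0<η 0<* 0<w
        , ≤-by (inj₁ (0≤E 0≤+< 0<1) 0≤* inj₁ 0<w)
            (trans (solve 3 (λ E η w → η :* w :+ (E :+ con (+ 1)) :* w := (E :+ η :+ con (+ 1)) :* w) refl E η w) eq)
        , <-by (0<η 0<* ((0<η 0<+≤ 0≤1) 0<* 0<w))
            (trans (solve 3 (λ E η w → η :* w :* E :+ η :* ((η :+ con (+ 1)) :* w) := η :* ((E :+ η :+ con (+ 1)) :* w)) refl E η w)
                   (trans (*-congˡ eq) (*-identityʳ η)))

    0≤nat : ∀ n → 0# ≤ nat n
    0≤nat zero    = ≤-refl
    0≤nat (suc n) = 0≤1 0≤+ 0≤nat n

    0<nat : ∀ n → 0# < nat (suc n)
    0<nat n = 0<1 0<+≤ 0≤nat n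

    ·≈* : ∀ n a → n · a ≈ nat n * a
    ·≈* zero    a = sym (zeroˡ a)
    ·≈* (suc n) a = trans (+-congˡ (·≈* n a)) (solve 2 (λ a n → a :+ n :* a := (con (+ 1) :+ n) :* a) refl a (nat n))

    0<fromℕ : ∀ n → 0# < Solver.fromℕ (suc n)
    0<fromℕ zero    = 0<1
    0<fromℕ (suc n) = 0<fromℕ n 0<+≤ 0≤1

    0≤fromℕ : ∀ n → 0# ≤ Solver.fromℕ n
    0≤fromℕ zero    = ≤-refl
    0≤fromℕ (suc n) = inj₁ (0<fromℕ n)

-- Complex numbers and their real inner product

module ComplexNumbers {c ℓ₁ ℓ₂} (ℝ : CompleteOrderedField c ℓ₁ ℓ₂) where
  open OrderedFieldProperties ℝ
  open RealAndComplex ℝ public using (ℂ; _+i_; re; im; ℂ-rawRing)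
  open Solver using (solve; _:+_; _:*_; _:-_; :-_; _:=_; con)

  open RawRing ℂ-rawRing public using ()
    renaming ( _≈_ to infix 4 _≈ᶜ_; _+_ to infixl 6 _+ᶜ_; _*_ to infixl 7 _*ᶜ_; -_ to infix 8 -ᶜ_
             ; 0# to 0ᶜ; 1# to 1ᶜ )

  abstract
    ℂ-isCommutativeRing : IsCommutativeRing _≈ᶜ_ _+ᶜ_ _*ᶜ_ -ᶜ_ 0ᶜ 1ᶜ
    ℂ-isCommutativeRing = record
      { isRing = record
        { +-isAbelianGroup = record
          { isGroup = record
            { isMonoid = record
              { isSemigroup = record
                { isMagma = record
                  { isEquivalence = record
                    { refl  = refl , refl
                    ; sym   = λ (p , q) → sym p , sym q
                    ; trans = λ (p , q) (r , s) → trans p r , trans q s }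
                  ; ∙-cong = λ (p , q) (r , s) → +-cong p r , +-cong q s }
                ; assoc = λ _ _ _ → +-assoc _ _ _ , +-assoc _ _ _ }
              ; identity = (λ _ → +-identityˡ _ , +-identityˡ _) , (λ _ → +-identityʳ _ , +-identityʳ _) }
            ; inverse = (λ _ → -‿inverseˡ _ , -‿inverseˡ _) , (λ _ → -‿inverseʳ _ , -‿inverseʳ _)
            ; ⁻¹-cong = λ (p , q) → -‿cong p , -‿cong q }
          ; comm = λ _ _ → +-comm _ _ , +-comm _ _ }
        ; *-cong = λ (p , q) (r , s) →
            +-cong (*-cong p r) (-‿cong (*-cong q s)) , +-cong (*-cong p s) (*-cong q r)
        ; *-assoc = λ z w v →
            solve 6 (λ a b c d e f →
              (a :* c :- b :* d) :* e :- (a :* d :+ b :* c) :* f :=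
              a :* (c :* e :- d :* f) :- b :* (c :* f :+ d :* e)) refl (re z) (im z) (re w) (im w) (re v) (im v)
          , solve 6 (λ a b c d e f →
              (a :* c :- b :* d) :* f :+ (a :* d :+ b :* c) :* e :=
              a :* (c :* f :+ d :* e) :+ b :* (c :* e :- d :* f)) refl (re z) (im z) (re w) (im w) (re v) (im v)
        ; *-identity =
            (λ z → solve 2 (λ a b → con (+ 1) :* a :- con (+ 0) :* b := a) refl (re z) (im z)
                 , solve 2 (λ a b → con (+ 1) :* b :+ con (+ 0) :* a := b) refl (re z) (im z))
          , (λ z → solve 2 (λ a b → a :* con (+ 1) :- b :* con (+ 0) := a) refl (re z) (im z)
                 , solve 2 (λ a b → a :* con (+ 0) :+ b :* con (+ 1) := b) refl (re z) (im z))
        ; distrib =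
            (λ z w v → solve 6 (λ a b c d e f → a :* (c :+ e) :- b :* (d :+ f) :=
                          (a :* c :- b :* d) :+ (a :* e :- b :* f)) refl (re z) (im z) (re w) (im w) (re v) (im v)
                     , solve 6 (λ a b c d e f → a :* (d :+ f) :+ b :* (c :+ e) :=
                          (a :* d :+ b :* c) :+ (a :* f :+ b :* e)) refl (re z) (im z) (re w) (im w) (re v) (im v))
          , (λ z w v → solve 6 (λ a b c d e f → (c :+ e) :* a :- (d :+ f) :* b :=
                          (c :* a :- d :* b) :+ (e :* a :- f :* b)) refl (re z) (im z) (re w) (im w) (re v) (im v)
                     , solve 6 (λ a b c d e f → (c :+ e) :* b :+ (d :+ f) :* a :=
                          (c :* b :+ d :* a) :+ (e :* b :+ f :* a)) refl (re z) (im z) (re w) (im w) (re v) (im v))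
        }
      ; *-comm = λ z w →
            solve 4 (λ a b c d → a :* c :- b :* d := c :* a :- d :* b) refl (re z) (im z) (re w) (im w)
          , solve 4 (λ a b c d → a :* d :+ b :* c := c :* b :+ d :* a) refl (re z) (im z) (re w) (im w)
      }

  ℂ-commutativeRing : CommutativeRing c ℓ₁
  ℂ-commutativeRing = record
    { RawRing ℂ-rawRing
    ; isCommutativeRing = ℂ-isCommutativeRing
    }

  module ℂ-Ring = CommutativeRing ℂ-commutativeRing
  module ℂ-Solver = IntegerCoefficientSolver ℂ-commutativeRing

  ι : Carrier → ℂ
  ι = _+i 0#

  abstract
    ι-* : ∀ a b → ι (a * b) ≈ᶜ ι a *ᶜ ι b
    ι-* a b = solve 2 (λ a b → a :* b := a :* b :- con (+ 0) :* con (+ 0)) refl a b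
            , solve 2 (λ a b → con (+ 0) := a :* con (+ 0) :+ con (+ 0) :* b) refl a b

    ι-+ : ∀ a b → ι (a + b) ≈ᶜ ι a +ᶜ ι b
    ι-+ a b = refl , sym (+-identityʳ 0#)

  infix 7 _∙_
  -- This is Re (z w̄). Thus `f′ ∙ f` is Re (f′/f) multiplied by |f|².
  _∙_ : ℂ → ℂ → Carrier
  z ∙ w = re z * re w + im z * im w

  normSq : ℂ → Carrier
  normSq z = z ∙ z

  abstract
    ∙-cong : ∀ {z z′ w w′} → z ≈ᶜ z′ → w ≈ᶜ w′ → z ∙ w ≈ z′ ∙ w′
    ∙-cong (p , q) (r , s) = +-cong (*-cong p r) (*-cong q s)

    normSq-cong : ∀ {z w} → z ≈ᶜ w → normSq z ≈ normSq w
    normSq-cong e = ∙-cong e e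

    0≤normSq : ∀ z → 0# ≤ normSq z
    0≤normSq z = 0≤sq (re z) 0≤+ 0≤sq (im z)

    normSq≈0 : ∀ {z} → normSq z ≈ 0# → z ≈ᶜ 0ᶜ
    normSq≈0 {z} e = x*x≈0⇒x≈0 (+≈0⇒≈0 (0≤sq (re z)) (0≤sq (im z)) e)
                   , x*x≈0⇒x≈0 (+≈0⇒≈0 (0≤sq (im z)) (0≤sq (re z)) (trans (+-comm _ _) e))

    0<normSq : ∀ {z} → ¬ z ≈ᶜ 0ᶜ → 0# < normSq z
    0<normSq {z} z≉0 = ≤∧≉⇒< (0≤normSq z) λ e → z≉0 (normSq≈0 (sym e))

    normSq-0 : ∀ {z} → z ≈ᶜ 0ᶜ → normSq z ≈ 0#
    normSq-0 e = trans (normSq-cong e) (solve 0 (con (+ 0) :* con (+ 0) :+ con (+ 0) :* con (+ 0) := con (+ 0)) refl)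

    normSq-* : ∀ z w → normSq (z *ᶜ w) ≈ normSq z * normSq w
    normSq-* z w = solve 4 (λ a b c d →
      (a :* c :- b :* d) :* (a :* c :- b :* d) :+ (a :* d :+ b :* c) :* (a :* d :+ b :* c) :=
      (a :* a :+ b :* b) :* (c :* c :+ d :* d)) refl (re z) (im z) (re w) (im w)

    normSq-ι* : ∀ t z → normSq (ι t *ᶜ z) ≈ t * t * normSq z
    normSq-ι* t z = solve 3 (λ t a b →
      (t :* a :- con (+ 0) :* b) :* (t :* a :- con (+ 0) :* b) :+ (t :* b :+ con (+ 0) :* a) :* (t :* b :+ con (+ 0) :* a) :=
      t :* t :* (a :* a :+ b :* b)) refl t (re z) (im z)

    -- By the parallelogram law the defect is |z - w|². It serves as a triangle inequality without
    -- square roots.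
    normSq-+ : ∀ z w → normSq (z +ᶜ w) ≤ 2# * normSq z + 2# * normSq w
    normSq-+ z w = ≤-by (0≤normSq (z +ᶜ -ᶜ w)) (solve 4 (λ a b c d →
      (a :+ c) :* (a :+ c) :+ (b :+ d) :* (b :+ d) :+ ((a :- c) :* (a :- c) :+ (b :- d) :* (b :- d)) :=
      con (+ 2) :* (a :* a :+ b :* b) :+ con (+ 2) :* (c :* c :+ d :* d)) refl (re z) (im z) (re w) (im w))

    0≉1ᶜ : ¬ 1ᶜ ≈ᶜ 0ᶜ
    0≉1ᶜ (1≈0 , _) = 0<⇒≉0 0<1 1≈0

    _≟ᶜ_ : ∀ z w → Dec (z ≈ᶜ w)
    z ≟ᶜ w with re z ≟ re w | im z ≟ im w
    ... | yes p | yes q = yes (p , q)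
    ... | no ¬p | _     = no λ e → ¬p (proj₁ e)
    ... | _     | no ¬q = no λ e → ¬q (proj₂ e)

    *ᶜ-≉0 : ∀ {z w} → ¬ z ≈ᶜ 0ᶜ → ¬ w ≈ᶜ 0ᶜ → ¬ z *ᶜ w ≈ᶜ 0ᶜ
    *ᶜ-≉0 {z} {w} z≉0 w≉0 e =
      0<⇒≉0 (0<normSq z≉0 0<* 0<normSq w≉0) (trans (sym (normSq-* z w)) (normSq-0 e))

-- Evaluation of polynomials and their derivatives along a ring homomorphism

module Evaluation {c₁ ℓ₁ c₂ ℓ₂} (R : CommutativeRing c₁ ℓ₁) (A : CommutativeRing c₂ ℓ₂) where
  private module R = CommutativeRing R
  open CommutativeRing A hiding (zero)
  open Polynomials R.rawRing
  private module P = RawSemiringDefs (RawRing.rawSemiring polyRawRing)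
  open Exp semiring using (_^_)
  open Mult semiring using (×-comm-*) renaming (_×_ to _·_)
  open CommutativeMonoidMult +-commutativeMonoid using (×-distrib-+)
  open RawMonoidDefs R.+-rawMonoid using () renaming (_×_ to _·ᴿ_)
  open Sum semiring using (sum)
  open IntegerCoefficientSolver A
  open import Relation.Binary.Reasoning.Setoid setoid

  module Along (φ : R.Carrier → Carrier)
    (φ-cong : ∀ {a b} → a R.≈ b → φ a ≈ φ b)
    (φ-0 : φ R.0# ≈ 0#) (φ-1 : φ R.1# ≈ 1#)
    (φ-+ : ∀ a b → φ (a R.+ b) ≈ φ a + φ b)
    (φ-* : ∀ a b → φ (a R.* b) ≈ φ a * φ b) where

    ev : Poly → Carrier → Carrier
    ev p z = foldr (λ a v → φ a + z * v) 0# p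

    -- Horner's scheme for the derivative, from (a + z p)′ = p + z p′. It avoids the multiples k ·
    -- a_k, which makes the product rule a plain induction.
    ev′ : Poly → Carrier → Carrier
    ev′ []      z = 0#
    ev′ (a ∷ p) z = ev p z + z * ev′ p z

    ev-congʳ : ∀ p {z w} → z ≈ w → ev p z ≈ ev p w
    ev-congʳ []      z≈w = refl
    ev-congʳ (a ∷ p) z≈w = +-congˡ (*-cong z≈w (ev-congʳ p z≈w))

    ev-≈[] : ∀ p z → (∀ k → coeff p k R.≈ R.0#) → ev p z ≈ 0#
    ev-≈[] []      z p≈0 = refl
    ev-≈[] (a ∷ p) z p≈0 = begin
      φ a + z * ev p z ≈⟨ +-cong (trans (φ-cong (p≈0 0)) φ-0) (*-congˡ (ev-≈[] p z (p≈0 ∘ suc))) ⟩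
      0# + z * 0#      ≈⟨ solve 1 (λ z → con (+ 0) :+ z :* con (+ 0) := con (+ 0)) refl z ⟩
      0#               ∎

    ev′-≈[] : ∀ p z → (∀ k → coeff p k R.≈ R.0#) → ev′ p z ≈ 0#
    ev′-≈[] []      z p≈0 = refl
    ev′-≈[] (a ∷ p) z p≈0 = begin
      ev p z + z * ev′ p z ≈⟨ +-cong (ev-≈[] p z (p≈0 ∘ suc)) (*-congˡ (ev′-≈[] p z (p≈0 ∘ suc))) ⟩
      0# + z * 0#          ≈⟨ solve 1 (λ z → con (+ 0) :+ z :* con (+ 0) := con (+ 0)) refl z ⟩
      0#                   ∎

    ev-cong : ∀ p q z → p ≈ₚ q → ev p z ≈ ev q z
    ev-cong []      q       z e = sym (ev-≈[] q z (λ k → R.sym (e k)))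
    ev-cong (a ∷ p) []      z e = ev-≈[] (a ∷ p) z e
    ev-cong (a ∷ p) (b ∷ q) z e = +-cong (φ-cong (e 0)) (*-congˡ (ev-cong p q z (e ∘ suc)))

    ev′-cong : ∀ p q z → p ≈ₚ q → ev′ p z ≈ ev′ q z
    ev′-cong []      q       z e = sym (ev′-≈[] q z (λ k → R.sym (e k)))
    ev′-cong (a ∷ p) []      z e = ev′-≈[] (a ∷ p) z e
    ev′-cong (a ∷ p) (b ∷ q) z e =
      +-cong (ev-cong p q z (e ∘ suc)) (*-congˡ (ev′-cong p q z (e ∘ suc)))

    ev-+ : ∀ p q z → ev (p +ₚ q) z ≈ ev p z + ev q z
    ev-+ []      q       z = sym (+-identityˡ _)
    ev-+ (a ∷ p) []      z = sym (+-identityʳ _)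
    ev-+ (a ∷ p) (b ∷ q) z = trans (+-cong (φ-+ a b) (*-congˡ (ev-+ p q z)))
      (solve 5 (λ a b z x y → a :+ b :+ z :* (x :+ y) := a :+ z :* x :+ (b :+ z :* y)) refl (φ a) (φ b) z (ev p z) (ev q z))

    ev′-+ : ∀ p q z → ev′ (p +ₚ q) z ≈ ev′ p z + ev′ q z
    ev′-+ []      q       z = sym (+-identityˡ _)
    ev′-+ (a ∷ p) []      z = sym (+-identityʳ _)
    ev′-+ (a ∷ p) (b ∷ q) z = trans (+-cong (ev-+ p q z) (*-congˡ (ev′-+ p q z)))
      (solve 5 (λ z x y x′ y′ → x :+ y :+ z :* (x′ :+ y′) := x :+ z :* x′ :+ (y :+ z :* y′)) refl
        z (ev p z) (ev q z) (ev′ p z) (ev′ q z))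

    ev-scale : ∀ a p z → ev (map (a R.*_) p) z ≈ φ a * ev p z
    ev-scale a []      z = sym (zeroʳ _)
    ev-scale a (b ∷ p) z = trans (+-cong (φ-* a b) (*-congˡ (ev-scale a p z)))
      (solve 4 (λ a b z x → a :* b :+ z :* (a :* x) := a :* (b :+ z :* x)) refl (φ a) (φ b) z (ev p z))

    ev′-scale : ∀ a p z → ev′ (map (a R.*_) p) z ≈ φ a * ev′ p z
    ev′-scale a []      z = sym (zeroʳ _)
    ev′-scale a (b ∷ p) z = trans (+-cong (ev-scale a p z) (*-congˡ (ev′-scale a p z)))
      (solve 4 (λ a z x x′ → a :* x :+ z :* (a :* x′) := a :* (x :+ z :* x′)) refl (φ a) z (ev p z) (ev′ p z))

    ev-* : ∀ p q z → ev (p *ₚ q) z ≈ ev p z * ev q z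
    ev-* []      q z = sym (zeroˡ _)
    ev-* (a ∷ p) q z = begin
      ev (map (a R.*_) q +ₚ (R.0# ∷ (p *ₚ q))) z         ≈⟨ ev-+ (map (a R.*_) q) _ z ⟩
      ev (map (a R.*_) q) z + (φ R.0# + z * ev (p *ₚ q) z) ≈⟨ +-cong (ev-scale a q z) (+-cong φ-0 (*-congˡ (ev-* p q z))) ⟩
      φ a * ev q z + (0# + z * (ev p z * ev q z))
        ≈⟨ solve 4 (λ a q z p → a :* q :+ (con (+ 0) :+ z :* (p :* q)) := (a :+ z :* p) :* q) refl (φ a) (ev q z) z (ev p z) ⟩
      (φ a + z * ev p z) * ev q z                        ∎

    ev′-* : ∀ p q z → ev′ (p *ₚ q) z ≈ ev′ p z * ev q z + ev p z * ev′ q z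
    ev′-* []      q z = solve 2 (λ x y → con (+ 0) := con (+ 0) :* x :+ con (+ 0) :* y) refl (ev q z) (ev′ q z)
    ev′-* (a ∷ p) q z = begin
      ev′ (map (a R.*_) q +ₚ (R.0# ∷ (p *ₚ q))) z
        ≈⟨ ev′-+ (map (a R.*_) q) _ z ⟩
      ev′ (map (a R.*_) q) z + (ev (p *ₚ q) z + z * ev′ (p *ₚ q) z)
        ≈⟨ +-cong (ev′-scale a q z) (+-cong (ev-* p q z) (*-congˡ (ev′-* p q z))) ⟩
      φ a * ev′ q z + (ev p z * ev q z + z * (ev′ p z * ev q z + ev p z * ev′ q z))
        ≈⟨ solve 6 (λ a z p p′ q q′ → a :* q′ :+ (p :* q :+ z :* (p′ :* q :+ p :* q′)) :=
             (p :+ z :* p′) :* q :+ (a :+ z :* p) :* q′) refl (φ a) z (ev p z) (ev′ p z) (ev q z) (ev′ q z) ⟩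
      (ev p z + z * ev′ p z) * ev q z + (φ a + z * ev p z) * ev′ q z ∎

    φ-· : ∀ n a → φ (n ·ᴿ a) ≈ n · φ a
    φ-· zero    a = φ-0
    φ-· (suc n) a = trans (φ-+ a _) (+-congˡ (φ-· n a))

    -- Multiplying the i-th coefficient by k + i is the operator k + z d/dz. The offset k has to be
    -- arbitrary because it grows along the list.
    ev-scaleFrom : ∀ k p z → ev (scaleFrom k p) z ≈ k · ev p z + z * ev′ p z
    ev-scaleFrom k []      z = begin
      0#                ≈⟨ solve 1 (λ z → con (+ 0) := con (+ 0) :+ z :* con (+ 0)) refl z ⟩
      0# + z * 0#       ≈⟨ +-congʳ (sym (n·0 k)) ⟩
      k · 0# + z * 0#   ∎
      where
      n·0 : ∀ n → n · 0# ≈ 0#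
      n·0 zero    = refl
      n·0 (suc n) = trans (+-identityˡ _) (n·0 n)
    ev-scaleFrom k (a ∷ p) z = begin
      φ (k ·ᴿ a) + z * ev (scaleFrom (suc k) p) z
        ≈⟨ +-cong (φ-· k a) (*-congˡ (ev-scaleFrom (suc k) p z)) ⟩
      k · φ a + z * (ev p z + k · ev p z + z * ev′ p z)
        ≈⟨ solve 5 (λ a z p kp p′ → a :+ z :* (p :+ kp :+ z :* p′) := a :+ z :* kp :+ z :* (p :+ z :* p′))
             refl (k · φ a) z (ev p z) (k · ev p z) (ev′ p z) ⟩
      k · φ a + z * (k · ev p z) + z * (ev p z + z * ev′ p z)
        ≈⟨ +-congʳ (+-congˡ (×-comm-* k z (ev p z))) ⟩
      k · φ a + k · (z * ev p z) + z * (ev p z + z * ev′ p z)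
        ≈⟨ +-congʳ (sym (×-distrib-+ (φ a) (z * ev p z) k)) ⟩
      k · (φ a + z * ev p z) + z * (ev p z + z * ev′ p z) ∎

    ev-derivative : ∀ p z → ev (derivative p) z ≈ ev′ p z
    ev-derivative []      z = refl
    ev-derivative (a ∷ p) z = trans (ev-scaleFrom 1 p z) (+-congʳ (+-identityʳ _))

    ev-one : ∀ z → ev (R.1# ∷ []) z ≈ 1#
    ev-one z = trans (+-cong φ-1 (zeroʳ z)) (+-identityʳ 1#)

    ev-^ : ∀ p n z → ev (p P.^ n) z ≈ ev p z ^ n
    ev-^ p zero    z = ev-one z
    ev-^ p (suc n) z = trans (ev-* p (p P.^ n) z) (*-congˡ (ev-^ p n z))

    ev-sum : ∀ {n} (f : Fin n → Poly) z → ev (P.sum f) z ≈ sum (λ i → ev (f i) z)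
    ev-sum {zero}  f z = refl
    ev-sum {suc n} f z = trans (ev-+ (f zero) (P.sum (f ∘ suc)) z) (+-congˡ (ev-sum (f ∘ suc) z))

    ev′-sum : ∀ {n} (f : Fin n → Poly) z → ev′ (P.sum f) z ≈ sum (λ i → ev′ (f i) z)
    ev′-sum {zero}  f z = refl
    ev′-sum {suc n} f z = trans (ev′-+ (f zero) (P.sum (f ∘ suc)) z) (+-congˡ (ev′-sum (f ∘ suc) z))

    ev-∷ʳ : ∀ p a z → ev (p ∷ʳ a) z ≈ ev p z + z ^ length p * φ a
    ev-∷ʳ []      a z = solve 2 (λ a z → a :+ z :* con (+ 0) := con (+ 0) :+ con (+ 1) :* a) refl (φ a) z
    ev-∷ʳ (b ∷ p) a z = trans (+-congˡ (*-congˡ (ev-∷ʳ p a z)))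
      (solve 5 (λ b z x w a → b :+ z :* (x :+ w :* a) := b :+ z :* x :+ z :* w :* a) refl
        (φ b) z (ev p z) (z ^ length p) (φ a))

-- Square roots, compactness of intervals and directions of powers

module Roots {c ℓ₁ ℓ₂} (ℝ : CompleteOrderedField c ℓ₁ ℓ₂) where
  open OrderedFieldProperties ℝ
  open Solver using (solve; _:+_; _:*_; _:-_; :-_; _:=_; con)
  open ComplexNumbers ℝ

  abstract
    sq-≤⇒≤ : ∀ {x y} → 0# ≤ y → x * x ≤ y * y → x ≤ y
    sq-≤⇒≤ {x} {y} 0≤y xx≤yy = ≮⇒≥ λ y<x → ≤⇒≯ xx≤yy
      (<-by (<⇒0<- y<x 0<* (0≤y 0≤+ 0≤y 0≤+< <⇒0<- y<x))
        (solve 2 (λ x y → y :* y :+ (x :- y) :* (y :+ y :+ (x :- y)) := x :* x) refl x y))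

    sq-inj : ∀ {x y} → 0# ≤ x → 0# ≤ y → x * x ≈ y * y → x ≈ y
    sq-inj 0≤x 0≤y e = ≤-antisym (sq-≤⇒≤ 0≤y (inj₂ e)) (sq-≤⇒≤ 0≤x (inj₂ (sym e)))

  module _ (a : Carrier) (0≤a : 0# ≤ a) where
    -- Lifted because `supremum` takes predicates of one universe level only.
    SquareBelow : Carrier → Set (c ⊔ ℓ₁ ⊔ ℓ₂)
    SquareBelow t = Lift (c ⊔ ℓ₁ ⊔ ℓ₂) (0# ≤ t × t * t ≤ a)

    abstract
      square-below-bound : IsUpperBound SquareBelow (a + 1#)
      square-below-bound t (lift (_ , tt≤a)) = sq-≤⇒≤ (0≤a 0≤+ 0≤1)
        (≤-trans tt≤a (≤-by (0≤a 0≤* 0≤a 0≤+ 0≤a 0≤+ 0≤1)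
          (solve 1 (λ a → a :+ (a :* a :+ a :+ con (+ 1)) := (a :+ con (+ 1)) :* (a :+ con (+ 1))) refl a)))

      square-below-0 : SquareBelow 0#
      square-below-0 = lift (≤-refl , ≤-respˡ (sym (zeroˡ 0#)) 0≤a)

    abstract
      sqrt-supremum : ∀ s → IsUpperBound SquareBelow s → (∀ u → IsUpperBound SquareBelow u → s ≤ u) →
                      0# ≤ s → s * s ≈ a
      sqrt-supremum s upper least 0≤s with compare (s * s) a
      ... | tri≈ _ e _ = e
      -- For small t ≤ 1, (s + t)² ≤ s² + t (2 s + 1) < a, so s + t would belong to the set.
      ... | tri< ss<a _ _ with small-multiple (0≤s 0≤+ 0≤s 0≤+ 0≤1) (<⇒0<- ss<a)
      ...   | t , 0<t , t≤1 , tE<η = ⊥-elim (≤⇒≯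
              (upper (s + t) (lift (0≤s 0≤+ inj₁ 0<t
                , ≤-by (inj₁ (<⇒0<- tE<η) 0≤+ inj₁ 0<t 0≤* ≤⇒0≤- t≤1)
                    (solve 3 (λ a s t → (s :+ t) :* (s :+ t) :+ (a :- s :* s :- t :* (s :+ s :+ con (+ 1)) :+ t :* (con (+ 1) :- t)) := a)
                      refl a s t))))
              (<-by 0<t refl))
      -- For small t, (s - t)² ≥ s² - 2 s t > a, so s - t would already be an upper bound.
      sqrt-supremum s upper least 0≤s | tri> _ _ a<ss with small-multiple (0≤s 0≤+ 0≤s) (<⇒0<- a<ss)
      ...   | t , 0<t , _ , tE<η = ⊥-elim (≤⇒≯
              (least (s + - t) λ x (lift (0≤x , xx≤a)) → ≮⇒≥ λ s-t<x → ≤⇒≯ xx≤a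
                (<-by (<⇒0<- tE<η 0<+≤ (0≤x 0≤* inj₁ (<⇒0<- s-t<x)) 0<+≤ (0≤s 0≤* inj₁ (<⇒0<- s-t<x))
                         0<+≤ (inj₁ 0<t 0≤* ≤⇒0≤- (upper x (lift (0≤x , xx≤a)))))
                  (solve 4 (λ a s t x → a :+ (s :* s :- a :- t :* (s :+ s) :+ x :* (x :- (s :- t)) :+ s :* (x :- (s :- t))
                       :+ t :* (s :- x)) := x :* x) refl a s t x)))
              (<-by 0<t (solve 2 (λ s t → s :- t :+ t := s) refl s t)))

    abstract
      sqrt : ∃[ s ] 0# ≤ s × s * s ≈ a
      sqrt with supremum SquareBelow (0# , square-below-0) (a + 1# , square-below-bound)
      ... | s , upper , least = s , upper 0# square-below-0 , sqrt-supremum s upper least (upper 0# square-below-0)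

  module _ (Good : Carrier → Carrier → Set (c ⊔ ℓ₁ ⊔ ℓ₂))
    (shrink : ∀ {s s′ t t′} → s ≤ s′ → t′ ≤ t → Good s t → Good s′ t′)
    (join : ∀ {s t u} → Good s t → Good t u → Good s u) where

    abstract
      -- Let s be the supremum of the points reached from a. A good neighbourhood of s joins any
      -- reached point beyond s - δ to s + δ, which then either lies past b or violates the upper
      -- bound; hence s - δ is an upper bound, contrary to leastness. The local hypothesis is doubly
      -- negated because it may itself come from another use of the lemma.
      heine-borel : ∀ {a b} → a ≤ b → (∀ s → ¬ ¬ (∃[ δ ] 0# < δ × Good (s + - δ) (s + δ))) → ¬ ¬ Good a b
      heine-borel {a} {b} a≤b local ¬good = local s λ (δ , 0<δ , good) →
        ≤⇒≯ (least (s + - δ) λ t t∈ → ≮⇒≥ λ s-δ<t → beyond δ 0<δ good t t∈ s-δ<t)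
            (<-by 0<δ (solve 2 (λ s t → s :- t :+ t := s) refl s δ))
        where
        -- The alternative t ≤ a makes the set inhabited by a without requiring `Good a a`.
        Reached : Carrier → Set (c ⊔ ℓ₁ ⊔ ℓ₂)
        Reached t = t ≤ b × (t ≤ a ⊎ Good a t)

        sup : ∃[ s ] IsUpperBound Reached s × (∀ u → IsUpperBound Reached u → s ≤ u)
        sup = supremum Reached (a , a≤b , inj₁ ≤-refl) (b , λ _ → proj₁)

        s : Carrier
        s = proj₁ sup

        least : ∀ u → IsUpperBound Reached u → s ≤ u
        least = proj₂ (proj₂ sup)

        beyond : ∀ δ → 0# < δ → Good (s + - δ) (s + δ) → ∀ t → Reached t → ¬ s + - δ < t
        beyond δ 0<δ good t (t≤b , t∈) s-δ<t = [ at-most-b , past-b ]′ (total (s + δ) b)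
          where
          reached : Good a (s + δ)
          reached = [ (λ t≤a → shrink (≤-trans (inj₁ s-δ<t) t≤a) ≤-refl good)
                    , (λ good′ → join good′ (shrink (inj₁ s-δ<t) ≤-refl good)) ]′ t∈

          past-b : ¬ b ≤ s + δ
          past-b b≤ = ¬good (shrink ≤-refl b≤ reached)

          at-most-b : ¬ s + δ ≤ b
          at-most-b ≤b = ≤⇒≯ (proj₁ (proj₂ sup) (s + δ) (≤b , inj₂ reached)) (<-by 0<δ refl)

  abstract
    re≤norm : ∀ z {r} → 0# ≤ r → r * r ≈ normSq z → re z ≤ r
    re≤norm z 0≤r rr≈ = sq-≤⇒≤ 0≤r (≤-by (0≤sq (im z)) (sym rr≈))

    -re≤norm : ∀ z {r} → 0# ≤ r → r * r ≈ normSq z → - re z ≤ r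
    -re≤norm z 0≤r rr≈ = sq-≤⇒≤ 0≤r (≤-by (0≤sq (im z))
      (trans (solve 2 (λ a b → :- a :* :- a :+ b :* b := a :* a :+ b :* b) refl (re z) (im z)) (sym rr≈)))

    -- With r = |z|, the half-angle formulas give p² - q² = Re z and (2 p q)² = (Im z)². What is
    -- left is a sign: q has to be taken with the sign of Im z.
    half-angle : ∀ z r p q → r * r ≈ normSq z → 0# ≤ p → p * p ≈ ½ * (r + - - re z) →
                 0# ≤ q → q * q ≈ ½ * (r + - re z) → ∃[ w ] w *ᶜ w ≈ᶜ z
    half-angle z r p q rr≈ 0≤p pp≈ 0≤q qq≈ = by-sign (total 0# (im z))
      where
      a b : Carrier
      a = re z
      b = im z
      open import Relation.Binary.Reasoning.Setoid setoid

      real-part : p * p + - (q * q) ≈ a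
      real-part = begin
        p * p + - (q * q)                        ≈⟨ +-cong pp≈ (-‿cong qq≈) ⟩
        ½ * (r + - - a) + - (½ * (r + - a))      ≈⟨ solve 3 (λ h r a → h :* (r :- :- a) :- h :* (r :- a) := h :* a :+ h :* a) refl ½ r a ⟩
        ½ * a + ½ * a                            ≈⟨ ½+½ a ⟩
        a                                        ∎

      squares : (p * q + q * p) * (p * q + q * p) ≈ b * b
      squares = begin
        (p * q + q * p) * (p * q + q * p)
          ≈⟨ solve 2 (λ p q → (p :* q :+ q :* p) :* (p :* q :+ q :* p) := con (+ 4) :* ((p :* p) :* (q :* q))) refl p q ⟩
        Solver.fromℤ (+ 4) * ((p * p) * (q * q))
          ≈⟨ *-congˡ (*-cong pp≈ qq≈) ⟩
        Solver.fromℤ (+ 4) * ((½ * (r + - - a)) * (½ * (r + - a)))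
          ≈⟨ solve 3 (λ h r a → con (+ 4) :* ((h :* (r :- :- a)) :* (h :* (r :- a))) :=
               (con (+ 2) :* h) :* (con (+ 2) :* h) :* (r :* r :- a :* a)) refl ½ r a ⟩
        (2# * ½) * (2# * ½) * (r * r + - (a * a))
          ≈⟨ *-cong (*-cong 2*½≈1 2*½≈1) (+-congʳ rr≈) ⟩
        1# * 1# * (a * a + b * b + - (a * a))
          ≈⟨ solve 2 (λ a b → con (+ 1) :* con (+ 1) :* (a :* a :+ b :* b :- a :* a) := b :* b) refl a b ⟩
        b * b ∎

      0≤pq : 0# ≤ p * q + q * p
      0≤pq = 0≤p 0≤* 0≤q 0≤+ 0≤q 0≤* 0≤p

      by-sign : 0# ≤ b ⊎ b ≤ 0# → ∃[ w ] w *ᶜ w ≈ᶜ z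
      by-sign (inj₁ 0≤b) = p +i q , real-part , sq-inj 0≤pq 0≤b squares
      by-sign (inj₂ b≤0) = p +i (- q)
        , trans (solve 2 (λ p q → p :* p :- :- q :* :- q := p :* p :- q :* q) refl p q) real-part
        , (begin
            p * - q + - q * p          ≈⟨ solve 2 (λ p q → p :* :- q :+ :- q :* p := :- (p :* q :+ q :* p)) refl p q ⟩
            - (p * q + q * p)          ≈⟨ -‿cong (sq-inj 0≤pq (0≤neg b≤0)
                                            (trans squares (solve 1 (λ b → b :* b := :- b :* :- b) refl b))) ⟩
            - - b                      ≈⟨ solve 1 (λ b → :- :- b := b) refl b ⟩
            b                          ∎)

  abstract
    sqrtᶜ : ∀ z → ∃[ w ] w *ᶜ w ≈ᶜ z
    sqrtᶜ z = let
      r , 0≤r , rr≈ = sqrt _ (0≤normSq z)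
      p , 0≤p , pp≈ = sqrt _ (inj₁ 0<½ 0≤* ≤⇒0≤- (-re≤norm z 0≤r rr≈))
      q , 0≤q , qq≈ = sqrt _ (inj₁ 0<½ 0≤* ≤⇒0≤- (re≤norm z 0≤r rr≈))
      in half-angle z r p q rr≈ 0≤p pp≈ 0≤q qq≈

  open Exp ℂ-Ring.semiring using (_^_; ^-homo-*; ^-congˡ)
  open CommutativeExp ℂ-Ring.commutativeSemiring using (^-distrib-*)

  abstract
    ±1-^ : ∀ {e} n → e ≈ᶜ 1ᶜ ⊎ e ≈ᶜ -ᶜ 1ᶜ → e ^ n ≈ᶜ 1ᶜ ⊎ e ^ n ≈ᶜ -ᶜ 1ᶜ
    ±1-^ zero    _ = inj₁ ℂ-Ring.refl
    ±1-^ {e} (suc n) e≈±1 with e≈±1 | ±1-^ n e≈±1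
    ... | inj₁ p | inj₁ q = inj₁ (ℂ-Ring.trans (ℂ-Ring.*-cong p q) (ℂ-Ring.*-identityˡ _))
    ... | inj₁ p | inj₂ q = inj₂ (ℂ-Ring.trans (ℂ-Ring.*-cong p q) (ℂ-Ring.*-identityˡ _))
    ... | inj₂ p | inj₁ q = inj₂ (ℂ-Ring.trans (ℂ-Ring.*-cong p q) (ℂ-Ring.*-identityʳ _))
    ... | inj₂ p | inj₂ q = inj₁ (ℂ-Ring.trans (ℂ-Ring.*-cong p q)
          (ℂ-Solver.solve 0 (ℂ-Solver.:- ℂ-Solver.con (+ 1) ℂ-Solver.:* ℂ-Solver.:- ℂ-Solver.con (+ 1) ℂ-Solver.:= ℂ-Solver.con (+ 1)) ℂ-Ring.refl))

  abstract
    -- Since v^(2j+1) = v (v²)^j = ± v and the exponent is odd, one of v and -v is a root.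
    odd-root : ∀ v j → v *ᶜ v ≈ᶜ 1ᶜ ⊎ v *ᶜ v ≈ᶜ -ᶜ 1ᶜ → ∃[ w ] w ^ suc (j ℕ.+ j) ≈ᶜ v
    odd-root v j vv≈±1 = [ (λ e → v , (begin
        v *ᶜ v ^ (j ℕ.+ j)      ≈⟨ C.*-congˡ (power v) ⟩
        v *ᶜ (v *ᶜ v) ^ j       ≈⟨ C.*-congˡ e ⟩
        v *ᶜ 1ᶜ                 ≈⟨ C.*-identityʳ v ⟩
        v                       ∎))
      , (λ e → -ᶜ v , (begin
        -ᶜ v *ᶜ (-ᶜ v) ^ (j ℕ.+ j)       ≈⟨ C.*-congˡ {x = -ᶜ v} (power (-ᶜ v)) ⟩
        -ᶜ v *ᶜ (-ᶜ v *ᶜ -ᶜ v) ^ j       ≈⟨ C.*-congˡ {x = -ᶜ v} (^-congˡ j (S.solve 1 (λ v → S.:- v S.:* S.:- v S.:= v S.:* v) C.refl v)) ⟩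
        -ᶜ v *ᶜ (v *ᶜ v) ^ j             ≈⟨ C.*-congˡ {x = -ᶜ v} e ⟩
        -ᶜ v *ᶜ -ᶜ 1ᶜ                    ≈⟨ S.solve 1 (λ v → S.:- v S.:* S.:- S.con (+ 1) S.:= v) C.refl v ⟩
        v                                ∎)) ]′ (±1-^ j vv≈±1)
      where
      module S = ℂ-Solver
      module C = ℂ-Ring
      open import Relation.Binary.Reasoning.Setoid C.setoid
      power : ∀ v → v ^ (j ℕ.+ j) ≈ᶜ (v *ᶜ v) ^ j
      power v = C.trans (^-homo-* v j j) (C.sym (^-distrib-* v v j))

  abstract
    -- One of the quarter turns 1, -1, i, -i moves a nonzero number into the open left half-plane;
    -- their squares are ± 1, as `odd-root` requires.
    unit-direction : ∀ a → ¬ a ≈ᶜ 0ᶜ → ∃[ v ] (v *ᶜ v ≈ᶜ 1ᶜ ⊎ v *ᶜ v ≈ᶜ -ᶜ 1ᶜ) × re (a *ᶜ v) < 0#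
    unit-direction a a≉0 with compare (re a) 0#
    ... | tri< a₁<0 _ _ = 1ᶜ , inj₁ (ℂ-Ring.*-identityˡ 1ᶜ)
                        , <-respˡ (sym (proj₁ (ℂ-Ring.*-identityʳ a))) a₁<0
    ... | tri> _ _ 0<a₁ = -ᶜ 1ᶜ , inj₁ (ℂ-Solver.solve 0 (ℂ-Solver.:- ℂ-Solver.con (+ 1) ℂ-Solver.:* ℂ-Solver.:- ℂ-Solver.con (+ 1) ℂ-Solver.:= ℂ-Solver.con (+ 1)) ℂ-Ring.refl)
                        , <-by 0<a₁ (solve 2 (λ a b → a :* :- con (+ 1) :- b :* :- con (+ 0) :+ a := con (+ 0)) refl (re a) (im a))
    ... | tri≈ _ a₁≈0 _ with compare (im a) 0#
    ...   | tri≈ _ a₂≈0 _ = ⊥-elim (a≉0 (a₁≈0 , a₂≈0))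
    ...   | tri> _ _ 0<a₂ = 0# +i 1#
                          , inj₂ ( solve 0 (con (+ 0) :* con (+ 0) :- con (+ 1) :* con (+ 1) := :- con (+ 1)) refl
                                 , solve 0 (con (+ 0) :* con (+ 1) :+ con (+ 1) :* con (+ 0) := :- con (+ 0)) refl)
                          , <-by 0<a₂ (solve 2 (λ a b → a :* con (+ 0) :- b :* con (+ 1) :+ b := con (+ 0)) refl (re a) (im a))
    ...   | tri< a₂<0 _ _ = 0# +i (- 1#)
                          , inj₂ ( solve 0 (con (+ 0) :* con (+ 0) :- :- con (+ 1) :* :- con (+ 1) := :- con (+ 1)) refl
                                 , solve 0 (con (+ 0) :* :- con (+ 1) :+ :- con (+ 1) :* con (+ 0) := :- con (+ 0)) refl)
                          , <-respˡ (solve 2 (λ a b → b := a :* con (+ 0) :- b :* :- con (+ 1)) refl (re a) (im a)) a₂<0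

  abstract
    halve : ∀ n → ∃[ j ] (n ≡ j ℕ.+ j ⊎ n ≡ suc (j ℕ.+ j))
    halve zero = 0 , inj₁ ≡.refl
    halve (suc n) with halve n
    ... | j , inj₁ ≡.refl = j , inj₂ ≡.refl
    ... | j , inj₂ ≡.refl = suc j , inj₁ (≡.cong suc (≡.sym (ℕ.+-suc j j)))

  abstract
    power-direction-odd : ∀ j a → ¬ a ≈ᶜ 0ᶜ → ∃[ w ] re (a *ᶜ w ^ suc (j ℕ.+ j)) < 0#
    power-direction-odd j a a≉0 = let
      v , vv≈±1 , av<0 = unit-direction a a≉0
      w , wⁿ≈v = odd-root v j vv≈±1
      in w , <-respˡ (sym (proj₁ (ℂ-Ring.*-congˡ {x = a} wⁿ≈v))) av<0

    power-direction-double : ∀ j a → ∃[ w ] re (a *ᶜ w ^ suc j) < 0# →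
                             ∃[ u ] re (a *ᶜ u ^ suc (suc (j ℕ.+ j))) < 0#
    power-direction-double j a (w , awʲ<0) = let
      u , uu≈w = sqrtᶜ w
      in u , <-respˡ (sym (proj₁ (ℂ-Ring.*-congˡ {x = a} (even u uu≈w)))) awʲ<0
      where
      open import Relation.Binary.Reasoning.Setoid ℂ-Ring.setoid
      even : ∀ u → u *ᶜ u ≈ᶜ w → u ^ suc (suc (j ℕ.+ j)) ≈ᶜ w ^ suc j
      even u uu≈w = begin
        u ^ suc (suc (j ℕ.+ j))    ≡⟨ ≡.cong (λ k → u ^ suc k) (≡.sym (ℕ.+-suc j j)) ⟩
        u ^ (suc j ℕ.+ suc j)      ≈⟨ ^-homo-* u (suc j) (suc j) ⟩
        u ^ suc j *ᶜ u ^ suc j     ≈⟨ ℂ-Ring.sym (^-distrib-* u u (suc j)) ⟩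
        (u *ᶜ u) ^ suc j           ≈⟨ ^-congˡ (suc j) uu≈w ⟩
        w ^ suc j                  ∎

    -- This avoids arguments and general n-th roots: square roots halve an even exponent until it is
    -- odd, and for odd exponents fourth roots of unity suffice.
    power-direction : ∀ n a → ¬ a ≈ᶜ 0ᶜ → ∃[ w ] re (a *ᶜ w ^ suc n) < 0#
    power-direction = ℕ.<-rec _ step
      where
      step : ∀ n → (∀ {m} → m ℕ.< n → ∀ a → ¬ a ≈ᶜ 0ᶜ → ∃[ w ] re (a *ᶜ w ^ suc m) < 0#) →
             ∀ a → ¬ a ≈ᶜ 0ᶜ → ∃[ w ] re (a *ᶜ w ^ suc n) < 0#
      step n rec a a≉0 with halve n
      -- `n` is one less than the exponent, so even `n` is the case of an odd exponent.
      ... | j , inj₁ ≡.refl = power-direction-odd j a a≉0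
      ... | j , inj₂ ≡.refl = power-direction-double j a (rec (ℕ.s≤s (ℕ.m≤m+n j j)) a a≉0)

-- Such a list has exactly d + 1 entries, so induction on it is induction on the degree, which
-- `HasDegree` with its trailing zeros does not allow. The predicate on the last entry is a
-- parameter since both nonzero and positive leading coefficients occur.
data HasLead {a p} {A : Set a} (NonZero : A → Set p) : ℕ → List A → Set (a ⊔ p) where
  [_] : ∀ {x} → NonZero x → HasLead NonZero 0 (x ∷ [])
  _∷_ : ∀ {d xs} x → HasLead NonZero d xs → HasLead NonZero (suc d) (x ∷ xs)

-- Complex polynomials: linear division, expansion at a point, bounds

module ComplexPolynomials {c ℓ₁ ℓ₂} (ℝ : CompleteOrderedField c ℓ₁ ℓ₂) where
  open OrderedFieldProperties ℝ
  open Solver using (solve; _:+_; _:*_; _:-_; :-_; _:=_; con)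
  open ComplexNumbers ℝ
  private
    module C = ℂ-Ring
    module S = ℂ-Solver

  open Evaluation.Along ℂ-commutativeRing ℂ-commutativeRing id id C.refl C.refl (λ _ _ → C.refl) (λ _ _ → C.refl) public
  open Exp C.semiring using (_^_)

  Leadᶜ : ℕ → List ℂ → Set _
  Leadᶜ = HasLead (λ a → ¬ a ≈ᶜ 0ᶜ)

  -- Synthetic division: the coefficients of (p(z) - p(r))/(z - r) are the Horner values at r of the
  -- tails of p.
  quotient : List ℂ → ℂ → List ℂ
  quotient []          r = []
  quotient (a ∷ [])    r = []
  quotient (a ∷ b ∷ p) r = ev (b ∷ p) r ∷ quotient (b ∷ p) r

  abstract
    ev-quotient : ∀ a p r z → ev (a ∷ p) z ≈ᶜ ev (a ∷ p) r +ᶜ (z +ᶜ -ᶜ r) *ᶜ ev (quotient (a ∷ p) r) z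
    ev-quotient a []      r z = S.solve 3 (λ a r z → a S.:+ z S.:* S.con (+ 0) S.:=
      a S.:+ r S.:* S.con (+ 0) S.:+ (z S.:- r) S.:* S.con (+ 0)) C.refl a r z
    ev-quotient a (b ∷ p) r z = C.trans (C.+-congˡ {x = a} (C.*-congˡ {x = z} (ev-quotient b p r z)))
      (S.solve 5 (λ a r z p q → a S.:+ z S.:* (p S.:+ (z S.:- r) S.:* q) S.:=
        a S.:+ r S.:* p S.:+ (z S.:- r) S.:* (p S.:+ z S.:* q)) C.refl a r z (ev (b ∷ p) r) (ev (quotient (b ∷ p) r) z))

    ev′-quotient : ∀ a p r z → ev′ (a ∷ p) z ≈ᶜ
      ev (quotient (a ∷ p) r) z +ᶜ (z +ᶜ -ᶜ r) *ᶜ ev′ (quotient (a ∷ p) r) z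
    ev′-quotient a []      r z = S.solve 2 (λ r z → S.con (+ 0) S.:+ z S.:* S.con (+ 0) S.:=
      S.con (+ 0) S.:+ (z S.:- r) S.:* S.con (+ 0)) C.refl r z
    ev′-quotient a (b ∷ p) r z = C.trans
      (C.+-cong (ev-quotient b p r z) (C.*-congˡ {x = z} (ev′-quotient b p r z)))
      (S.solve 5 (λ r z p q q′ → p S.:+ (z S.:- r) S.:* q S.:+ z S.:* (q S.:+ (z S.:- r) S.:* q′) S.:=
        p S.:+ z S.:* q S.:+ (z S.:- r) S.:* (q S.:+ z S.:* q′)) C.refl
        r z (ev (b ∷ p) r) (ev (quotient (b ∷ p) r) z) (ev′ (quotient (b ∷ p) r) z))

    quotient-lead : ∀ {d p} r → Leadᶜ (suc d) p → Leadᶜ d (quotient p r)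
    quotient-lead r (a ∷ [ b≉0 ]) = [ (λ e → b≉0 (C.trans
      (S.solve 2 (λ b r → b S.:= b S.:+ r S.:* S.con (+ 0)) C.refl _ r) e)) ]
    quotient-lead r (a ∷ l@(b ∷ _)) = _ ∷ quotient-lead r l

    -- Dividing by z - z₀ again and again leaves the Taylor coefficients at z₀ as remainders.
    translate : ∀ {d p} z₀ → Leadᶜ d p → ∃[ q ] Leadᶜ d q × (∀ w → ev p (z₀ +ᶜ w) ≈ᶜ ev q w)
    translate z₀ ([_] {a} a≉0) = a ∷ [] , [ a≉0 ] , λ w →
      S.solve 3 (λ a z w → a S.:+ (z S.:+ w) S.:* S.con (+ 0) S.:= a S.:+ w S.:* S.con (+ 0)) C.refl a z₀ w
    translate {p = a ∷ p} z₀ l@(_ ∷ _) = let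
      q , lead , eq = translate z₀ (quotient-lead z₀ l)
      in ev (a ∷ p) z₀ ∷ q , _ ∷ lead , λ w → C.trans (ev-quotient a p z₀ (z₀ +ᶜ w))
           (C.+-congˡ {x = ev (a ∷ p) z₀} (C.*-cong (S.solve 2 (λ z w → z S.:+ w S.:- z S.:= w) C.refl z₀ w) (eq w)))

    translate-at-0 : ∀ p c q z₀ → (∀ w → ev p (z₀ +ᶜ w) ≈ᶜ ev (c ∷ q) w) → ev p z₀ ≈ᶜ c
    translate-at-0 p c q z₀ eq = C.trans
      (ev-congʳ p (S.solve 1 (λ z → z S.:= z S.:+ S.con (+ 0)) C.refl z₀))
      (C.trans (eq 0ᶜ) (S.solve 2 (λ c x → c S.:+ S.con (+ 0) S.:* x S.:= c) C.refl c (ev q 0ᶜ)))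

    bounded : ∀ p {K} → 0# ≤ K → ∃[ M ] 0# ≤ M × (∀ w → normSq w ≤ K → normSq (ev p w) ≤ M)
    bounded []      {K} 0≤K = 0# , ≤-refl , λ w _ → inj₂ (normSq-0 C.refl)
    bounded (a ∷ p) {K} 0≤K = let
      M , 0≤M , bound = bounded p 0≤K
      in 2# * normSq a + 2# * (K * M)
       , inj₁ 0<2 0≤* 0≤normSq a 0≤+ inj₁ 0<2 0≤* (0≤K 0≤* 0≤M)
       , λ w w≤K → ≤-trans (normSq-+ a (w *ᶜ ev p w))
           (+-mono-≤ ≤-refl (*-monoˡ-≤ 2# (inj₁ 0<2)
             (≤-respˡ (sym (normSq-* w (ev p w))) (*-mono-≤ (0≤normSq w) w≤K (0≤normSq (ev p w)) (bound w w≤K)))))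

    -- Equality with zero is decidable, so vanishing low coefficients can be skipped; the nonzero
    -- leading one ends the search.
    lowest-term : ∀ {d q} → Leadᶜ d q →
      ∃[ j ] ∃[ a ] ∃[ r ] ¬ a ≈ᶜ 0ᶜ × (∀ w → ev q w ≈ᶜ w ^ j *ᶜ (a +ᶜ w *ᶜ ev r w))
    lowest-term ([_] {a} a≉0) = 0 , a , [] , a≉0 , λ w →
      S.solve 2 (λ a w → a S.:+ w S.:* S.con (+ 0) S.:= S.con (+ 1) S.:* (a S.:+ w S.:* S.con (+ 0))) C.refl a w
    lowest-term (_∷_ {xs = q} a lead) with a ≟ᶜ 0ᶜ
    ... | no a≉0  = 0 , a , q , a≉0 , λ w → C.sym (C.*-identityˡ _)
    ... | yes a≈0 = let
      j , b , r , b≉0 , eq = lowest-term lead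
      in suc j , b , r , b≉0 , λ w → C.trans (C.+-cong a≈0 (C.*-congˡ {x = w} (eq w)))
           (S.solve 3 (λ w wʲ x → S.con (+ 0) S.:+ w S.:* (wʲ S.:* x) S.:= w S.:* wʲ S.:* x) C.refl
             w (w ^ j) (b +ᶜ w *ᶜ ev r w))

    -- Here τ = t^(j+1), which stays below t because t ≤ 1.
    ι-^ : ∀ {t} → 0# < t → t ≤ 1# → ∀ j → ∃[ τ ] 0# < τ × τ ≤ t × ι t ^ suc j ≈ᶜ ι τ
    ι-^ {t} 0<t t≤1 zero    = t , 0<t , ≤-refl , C.*-identityʳ (ι t)
    ι-^ {t} 0<t t≤1 (suc j) = let
      τ , 0<τ , τ≤t , eq = ι-^ 0<t t≤1 j
      in t * τ , 0<t 0<* 0<τ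
       , ≤-by (inj₁ 0<t 0≤* ≤⇒0≤- (≤-trans τ≤t t≤1)) (solve 2 (λ t τ → t :* τ :+ t :* (con (+ 1) :- τ) := t) refl t τ)
       , C.trans (C.*-congˡ {x = ι t} eq) (C.sym (ι-* t τ))

-- The fundamental theorem of algebra up to double negation

module FundamentalTheoremOfAlgebra {c₀ ℓ₁ ℓ₂} (ℝ : CompleteOrderedField c₀ ℓ₁ ℓ₂) where
  open OrderedFieldProperties ℝ
  open Solver using (solve; _:+_; _:*_; _:-_; :-_; _:=_; con)
  open ComplexNumbers ℝ
  open Roots ℝ
  open ComplexPolynomials ℝ
  private
    module C = ℂ-Ring
    module S = ℂ-Solver
  open Exp C.semiring using (_^_)
  open CommutativeExp C.commutativeSemiring using (^-distrib-*)

  conj : ℂ → ℂ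
  conj z = re z +i (- im z)

  abstract
    -- Put v = u + t s and expand |c + τ v|². The term 2 τ (c ∙ u) is negative. The others are at
    -- most τ t times the bracket in the last hypothesis, by 2 (c ∙ s) ≤ |c|² + S, |v|² ≤ 2 |u|² + 2
    -- S and τ ≤ t.
    decrease : ∀ c u s {t τ S} → 0# < τ → τ ≤ t → t ≤ 1# → normSq s ≤ S →
      t * (normSq c + S + (2# * normSq u + 2# * S)) < - (c ∙ u + c ∙ u) →
      normSq (c +ᶜ ι τ *ᶜ (u +ᶜ ι t *ᶜ s)) < normSq c
    decrease c u s {t} {τ} {S} 0<τ τ≤t t≤1 s≤S small =
      <-by (0<τ 0<* (<⇒0<- small 0<+≤ (0≤t 0≤* ≤⇒0≤- cross) 0<+≤ (≤⇒0≤- τ≤t 0≤* (0≤2u 0≤+ 0≤2S)) 0<+≤ (inj₁ 0<τ 0≤* ≤⇒0≤- v≤)))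
        (trans (+-congʳ expand)
          (solve 8 (λ X cu cs V U S t τ →
            X :+ con (+ 2) :* τ :* (cu :+ t :* cs) :+ τ :* τ :* V :+
            τ :* (:- (cu :+ cu) :- t :* (X :+ S :+ (con (+ 2) :* U :+ con (+ 2) :* S)) :+ t :* (X :+ S :- con (+ 2) :* cs)
              :+ (t :- τ) :* (con (+ 2) :* U :+ con (+ 2) :* S) :+ τ :* (con (+ 2) :* U :+ con (+ 2) :* S :- V)) := X)
            refl (normSq c) (c ∙ u) (c ∙ s) (normSq v) (normSq u) S t τ))
      where
      v : ℂ
      v = u +ᶜ ι t *ᶜ s
      0≤t : 0# ≤ t
      0≤t = ≤-trans (inj₁ 0<τ) τ≤t
      0≤S : 0# ≤ S
      0≤S = ≤-trans (0≤normSq s) s≤S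
      0≤2u : 0# ≤ 2# * normSq u
      0≤2u = inj₁ 0<2 0≤* 0≤normSq u
      0≤2S : 0# ≤ 2# * S
      0≤2S = inj₁ 0<2 0≤* 0≤S

      cross : 2# * (c ∙ s) ≤ normSq c + S
      cross = ≤-trans (≤-by (0≤normSq (c +ᶜ -ᶜ s)) (solve 4 (λ a b x y →
        con (+ 2) :* (a :* x :+ b :* y) :+ ((a :- x) :* (a :- x) :+ (b :- y) :* (b :- y)) :=
        a :* a :+ b :* b :+ (x :* x :+ y :* y)) refl (re c) (im c) (re s) (im s))) (+-mono-≤ ≤-refl s≤S)

      ts≤S : normSq (ι t *ᶜ s) ≤ S
      ts≤S = ≤-respˡ (sym (normSq-ι* t s)) (≤-trans
        (≤-by ((≤⇒0≤- t≤1 0≤* (0≤1 0≤+ 0≤t)) 0≤* 0≤normSq s)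
          (solve 2 (λ t x → t :* t :* x :+ (con (+ 1) :- t) :* (con (+ 1) :+ t) :* x := x) refl t (normSq s))) s≤S)

      v≤ : normSq v ≤ 2# * normSq u + 2# * S
      v≤ = ≤-trans (normSq-+ u (ι t *ᶜ s)) (+-mono-≤ ≤-refl (*-monoˡ-≤ 2# (inj₁ 0<2) ts≤S))

      expand : normSq (c +ᶜ ι τ *ᶜ v) ≈ normSq c + 2# * τ * (c ∙ u + t * (c ∙ s)) + τ * τ * normSq v
      expand = trans
        (solve 5 (λ a b x y τ →
          (a :+ (τ :* x :- con (+ 0) :* y)) :* (a :+ (τ :* x :- con (+ 0) :* y)) :+
          (b :+ (τ :* y :+ con (+ 0) :* x)) :* (b :+ (τ :* y :+ con (+ 0) :* x)) :=
          a :* a :+ b :* b :+ con (+ 2) :* τ :* (a :* x :+ b :* y) :+ τ :* τ :* (x :* x :+ y :* y))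
          refl (re c) (im c) (re v) (im v) τ)
        (+-congʳ (+-congˡ (*-congˡ (solve 7 (λ a b x y z w t →
          a :* (x :+ (t :* z :- con (+ 0) :* w)) :+ b :* (y :+ (t :* w :+ con (+ 0) :* z)) :=
          a :* x :+ b :* y :+ t :* (a :* z :+ b :* w))
          refl (re c) (im c) (re u) (im u) (re s) (im s) t))))

    -- Multiplied by t, the right side minus the left is |t c + y|² + t |y|² + (t² M - |y|²).
    perturb-lower : ∀ c y {t M} → 0# < t → normSq y ≤ t * t * M →
      normSq c + - (t * (normSq c + M)) ≤ normSq (c +ᶜ y)
    perturb-lower c y {t} {M} 0<t y≤ = ≤-by (*-cancel-0≤ 0<t
      (≤-respʳ (solve 6 (λ a b x z t M →
          (t :* a :- con (+ 0) :* b :+ x) :* (t :* a :- con (+ 0) :* b :+ x) :+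
          (t :* b :+ con (+ 0) :* a :+ z) :* (t :* b :+ con (+ 0) :* a :+ z) :+
          t :* (x :* x :+ z :* z) :+ (t :* t :* M :- (x :* x :+ z :* z)) :=
          t :* ((a :+ x) :* (a :+ x) :+ (b :+ z) :* (b :+ z) :- (a :* a :+ b :* b :- t :* (a :* a :+ b :* b :+ M))))
          refl (re c) (im c) (re y) (im y) t M)
        (0≤normSq (ι t *ᶜ c +ᶜ y) 0≤+ inj₁ 0<t 0≤* 0≤normSq y 0≤+ ≤⇒0≤- y≤)))
      (solve 2 (λ x y → x :+ (y :- x) := y) refl _ _)

    module _ (c a v : ℂ) (r : List ℂ) (j : ℕ) {M : Carrier} (0≤M : 0# ≤ M)
      (bound : ∀ w → normSq w ≤ normSq v → normSq (ev r w) ≤ M) where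
      private
        vᵏ u : ℂ
        vᵏ = v ^ suc j
        u = vᵏ *ᶜ a
        S : Carrier
        S = normSq (vᵏ *ᶜ v) * M

      -- At w = t v the value is c + τ (u + t s) with τ = t^(j+1), u = v^(j+1) a and s = v^(j+2) ev
      -- r w, which is the shape that `decrease` handles.
      decrease-along : ∀ {t τ} → 0# < t → t ≤ 1# → 0# < τ → τ ≤ t → ι t ^ suc j ≈ᶜ ι τ →
        t * (normSq c + S + (2# * normSq u + 2# * S)) < - (c ∙ u + c ∙ u) →
        normSq (c +ᶜ (ι t *ᶜ v) *ᶜ ((ι t *ᶜ v) ^ j *ᶜ (a +ᶜ (ι t *ᶜ v) *ᶜ ev r (ι t *ᶜ v)))) < normSq c
      decrease-along {t} {τ} 0<t t≤1 0<τ τ≤t pow small =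
        <-respˡ (sym (normSq-cong value)) (decrease c u s 0<τ τ≤t t≤1 s≤S small)
        where
        w ρ s : ℂ
        w = ι t *ᶜ v
        ρ = ev r w
        s = vᵏ *ᶜ v *ᶜ ρ

        w≤v : normSq w ≤ normSq v
        w≤v = ≤-respˡ (sym (normSq-ι* t v)) (≤-by ((≤⇒0≤- t≤1 0≤* (0≤1 0≤+ inj₁ 0<t)) 0≤* 0≤normSq v)
          (solve 2 (λ t x → t :* t :* x :+ (con (+ 1) :- t) :* (con (+ 1) :+ t) :* x := x) refl t (normSq v)))

        s≤S : normSq s ≤ S
        s≤S = ≤-respˡ (sym (normSq-* (vᵏ *ᶜ v) ρ)) (*-monoˡ-≤ _ (0≤normSq (vᵏ *ᶜ v)) (bound w w≤v))

        open import Relation.Binary.Reasoning.Setoid C.setoid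
        value : c +ᶜ w *ᶜ (w ^ j *ᶜ (a +ᶜ w *ᶜ ρ)) ≈ᶜ c +ᶜ ι τ *ᶜ (u +ᶜ ι t *ᶜ s)
        value = C.+-congˡ {x = c} (begin
          w *ᶜ (w ^ j *ᶜ (a +ᶜ w *ᶜ ρ))            ≈⟨ C.sym (C.*-assoc w (w ^ j) _) ⟩
          w ^ suc j *ᶜ (a +ᶜ w *ᶜ ρ)               ≈⟨ C.*-congʳ {x = a +ᶜ w *ᶜ ρ} (^-distrib-* (ι t) v (suc j)) ⟩
          ι t ^ suc j *ᶜ vᵏ *ᶜ (a +ᶜ w *ᶜ ρ)       ≈⟨ C.*-congʳ {x = a +ᶜ w *ᶜ ρ} (C.*-congʳ {x = vᵏ} pow) ⟩
          ι τ *ᶜ vᵏ *ᶜ (a +ᶜ w *ᶜ ρ)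
            ≈⟨ ℂ-Solver.solve 6 (λ τ k a t v ρ → τ S.:* k S.:* (a S.:+ t S.:* v S.:* ρ) S.:=
               τ S.:* (k S.:* a S.:+ t S.:* (k S.:* v S.:* ρ))) C.refl (ι τ) vᵏ a (ι t) v ρ ⟩
          ι τ *ᶜ (u +ᶜ ι t *ᶜ s)                   ∎)

      decrease-near-0 : c ∙ u < 0# → ∃[ w ] normSq (c +ᶜ w *ᶜ (w ^ j *ᶜ (a +ᶜ w *ᶜ ev r w))) < normSq c
      decrease-near-0 cu<0 = let
        t , 0<t , t≤1 , small = small-multiple (0≤normSq c 0≤+ 0≤S 0≤+ (inj₁ 0<2 0≤* 0≤normSq u 0≤+ inj₁ 0<2 0≤* 0≤S)) 0<-2cu
        τ , 0<τ , τ≤t , pow = ι-^ 0<t t≤1 j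
        in ι t *ᶜ v , decrease-along 0<t t≤1 0<τ τ≤t pow small
        where
        0≤S : 0# ≤ S
        0≤S = 0≤normSq (vᵏ *ᶜ v) 0≤* 0≤M
        0<-2cu : 0# < - (c ∙ u + c ∙ u)
        0<-2cu = <-respʳ (solve 1 (λ x → :- x :+ :- x := :- (x :+ x)) refl (c ∙ u)) (0<neg cu<0 0<+≤ inj₁ (0<neg cu<0))

  abstract
    -- The first perturbing term a w^(j+1) has to point against c. A direction v with Re (c̄ a
    -- v^(j+1)) < 0 achieves this, and that real part is `c ∙ u`.
    decrease-power : ∀ c j a r → ¬ c ≈ᶜ 0ᶜ → ¬ a ≈ᶜ 0ᶜ →
      ∃[ w ] normSq (c +ᶜ w *ᶜ (w ^ j *ᶜ (a +ᶜ w *ᶜ ev r w))) < normSq c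
    decrease-power c j a r c≉0 a≉0 = let
      v , cav<0 = power-direction j (conj c *ᶜ a) (*ᶜ-≉0 (conj≉0 c≉0) a≉0)
      M , 0≤M , bound = bounded r (0≤normSq v)
      in decrease-near-0 c a v r j 0≤M bound (<-respˡ (rearrange (v ^ suc j)) cav<0)
      where
      rearrange : ∀ x → re (conj c *ᶜ a *ᶜ x) ≈ c ∙ (x *ᶜ a)
      rearrange w = solve 6 (λ a b x y z w → (a :* x :- :- b :* y) :* z :- (a :* y :+ :- b :* x) :* w :=
        a :* (z :* x :- w :* y) :+ b :* (z :* y :+ w :* x)) refl (re c) (im c) (re a) (im a) (re w) (im w)
      conj≉0 : ∀ {z} → ¬ z ≈ᶜ 0ᶜ → ¬ conj z ≈ᶜ 0ᶜ
      conj≉0 {z} z≉0 (p , q) = z≉0 (p , trans (solve 1 (λ y → y := :- :- y) refl (im z))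
        (trans (-‿cong q) (solve 0 (:- con (+ 0) := con (+ 0)) refl)))

  abstract
    -- The lemma of d'Alembert and Argand: near z₀ the lowest nonconstant term of the expansion
    -- dominates all later ones.
    descend : ∀ {d p} → Leadᶜ (suc d) p → ∀ z₀ → ¬ ev p z₀ ≈ᶜ 0ᶜ → ∃[ z ] normSq (ev p z) < normSq (ev p z₀)
    descend {d} {p} lead z₀ pz₀≉0 = go (translate z₀ lead)
      where
      go : (∃[ q ] Leadᶜ (suc d) q × (∀ w → ev p (z₀ +ᶜ w) ≈ᶜ ev q w)) → ∃[ z ] normSq (ev p z) < normSq (ev p z₀)
      go (c ∷ q , _ ∷ lead-q , eq) = let
        j , a , r , a≉0 , low = lowest-term lead-q
        pz₀≈c = translate-at-0 p c q z₀ eq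
        w , less = decrease-power c j a r (λ c≈0 → pz₀≉0 (C.trans pz₀≈c c≈0)) a≉0
        in z₀ +ᶜ w , <-respʳ (normSq-cong (C.sym pz₀≈c))
             (<-respˡ (normSq-cong (C.sym (C.trans (eq w) (C.+-congˡ {x = c} (C.*-congˡ {x = w} (low w)))))) less)

  data Square (z₀ : ℂ) (δ : Carrier) (z : ℂ) : Set (ℓ₁ ⊔ ℓ₂) where
    square : re z₀ + - δ ≤ re z → re z ≤ re z₀ + δ → im z₀ + - δ ≤ im z → im z ≤ im z₀ + δ → Square z₀ δ z

  abstract
    between-sq : ∀ {x y δ} → y + - δ ≤ x → x ≤ y + δ → (x + - y) * (x + - y) ≤ δ * δ
    between-sq {x} {y} {δ} lo hi = ≤-by (≤⇒0≤- lo 0≤* ≤⇒0≤- hi)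
      (solve 3 (λ x y δ → (x :- y) :* (x :- y) :+ (x :- (y :- δ)) :* (y :+ δ :- x) := δ :* δ) refl x y δ)

    square-normSq : ∀ {z₀ δ z} → Square z₀ δ z → normSq (z +ᶜ -ᶜ z₀) ≤ δ * δ * 2#
    square-normSq {δ = δ} (square a b c d) = ≤-respʳ (solve 1 (λ δ → δ :* δ :+ δ :* δ := δ :* δ :* con (+ 2)) refl δ)
      (+-mono-≤ (between-sq a b) (between-sq c d))

    -- Continuity with a margin ε that is uniform on a whole square; compactness can combine only
    -- such uniform margins.
    stays-above : ∀ {d p} → Leadᶜ (suc d) p → ∀ z₀ {L} → L < normSq (ev p z₀) →
      ∃[ δ ] ∃[ ε ] 0# < δ × 0# < ε × (∀ z → Square z₀ δ z → L + ε ≤ normSq (ev p z))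
    stays-above {d} {p} lead z₀ {L} L<p = go (translate z₀ lead)
      where
      Goal : Set (c₀ ⊔ ℓ₁ ⊔ ℓ₂)
      Goal = ∃[ δ ] ∃[ ε ] 0# < δ × 0# < ε × (∀ z → Square z₀ δ z → L + ε ≤ normSq (ev p z))

      go : (∃[ q ] Leadᶜ (suc d) q × (∀ w → ev p (z₀ +ᶜ w) ≈ᶜ ev q w)) → Goal
      go (c ∷ q , _ ∷ _ , eq) = with-δ (small-multiple (0≤normSq c 0≤+ 0≤2M) (<⇒0<- L<c))
        where
        -- The radius: |z - z₀|² ≤ 2 on a square of half-side t ≤ 1.
        bound : ∃[ M ] 0# ≤ M × (∀ w → normSq w ≤ 2# → normSq (ev q w) ≤ M)
        bound = bounded q (inj₁ 0<2)
        M : Carrier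
        M = proj₁ bound
        0≤2M : 0# ≤ 2# * M
        0≤2M = inj₁ 0<2 0≤* proj₁ (proj₂ bound)
        L<c : L < normSq c
        L<c = <-respʳ (normSq-cong (translate-at-0 p c q z₀ eq)) L<p

        with-δ : (∃[ t ] 0# < t × t ≤ 1# × t * (normSq c + 2# * M) < normSq c + - L) → Goal
        with-δ (t , 0<t , t≤1 , small) = t , _ , 0<t , <⇒0<- small , λ z z∈ → ≤-respˡ
            (solve 3 (λ L X y → X :- y := L :+ (X :- L :- y)) refl L (normSq c) (t * (normSq c + 2# * M)))
            (≤-respʳ (normSq-cong (C.sym (value z))) (perturb-lower c (shift z *ᶜ ev q (shift z)) 0<t (small-term z z∈)))
          where
          shift : ℂ → ℂ
          shift z = z +ᶜ -ᶜ z₀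
          value : ∀ z → ev p z ≈ᶜ c +ᶜ shift z *ᶜ ev q (shift z)
          value z = C.trans (ev-congʳ p (S.solve 2 (λ z z₀ → z S.:= z₀ S.:+ (z S.:- z₀)) C.refl z z₀)) (eq (shift z))
          small-term : ∀ z → Square z₀ t z → normSq (shift z *ᶜ ev q (shift z)) ≤ t * t * (2# * M)
          small-term z z∈ = ≤-respˡ (sym (normSq-* (shift z) _)) (≤-respʳ (*-assoc (t * t) 2# M)
            (*-mono-≤ (0≤normSq (shift z)) (square-normSq z∈) (0≤normSq _)
              (proj₂ (proj₂ bound) (shift z) (≤-trans (square-normSq z∈)
                (≤-by ((≤⇒0≤- t≤1 0≤* (0≤1 0≤+ inj₁ 0<t)) 0≤* inj₁ 0<2)
                  (solve 1 (λ t → t :* t :* con (+ 2) :+ (con (+ 1) :- t) :* (con (+ 1) :+ t) :* con (+ 2) := con (+ 2)) refl t))))))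

    *-cancel-2 : ∀ {x y} → 2# * x ≤ 2# * y → x ≤ y
    *-cancel-2 {x} {y} le = ≤-by (*-cancel-0≤ 0<2 (≤-respʳ
      (solve 2 (λ x y → con (+ 2) :* y :- con (+ 2) :* x := con (+ 2) :* (y :- x)) refl x y) (≤⇒0≤- le)))
      (solve 2 (λ x y → x :+ (y :- x) := y) refl x y)

    -- If |z|² ≥ (2 K + 2 |a|²)/δ, then |z q|² ≥ 2 K + 2 |a|², whereas |z q|² ≤ 2 |a + z q|² + 2
    -- |a|². The summand R in the new threshold keeps the hypothesis on q available.
    grows : ∀ a q {δ R K} → 0# < δ → 0# ≤ R → 0# ≤ K → (∀ z → R ≤ normSq z → δ ≤ normSq (ev q z)) →
      ∃[ R′ ] 0# ≤ R′ × (∀ z → R′ ≤ normSq z → K ≤ normSq (ev (a ∷ q) z))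
    grows a q {δ} {R} {K} 0<δ 0≤R 0≤K large = go (positive-inverse 0<δ)
      where
      go : (∃[ w ] 0# < w × δ * w ≈ 1#) → ∃[ R′ ] 0# ≤ R′ × (∀ z → R′ ≤ normSq z → K ≤ normSq (ev (a ∷ q) z))
      go (w , 0<w , δw≈1) = R + B * w , 0≤R 0≤+ 0≤Bw , λ z R′≤z → *-cancel-2 (bound z R′≤z)
        where
        B : Carrier
        B = 2# * K + 2# * normSq a
        0≤Bw : 0# ≤ B * w
        0≤Bw = (inj₁ 0<2 0≤* 0≤K 0≤+ inj₁ 0<2 0≤* 0≤normSq a) 0≤* inj₁ 0<w
        bound : ∀ z → R + B * w ≤ normSq z → 2# * K ≤ 2# * normSq (a +ᶜ z *ᶜ ev q z)
        bound z R′≤z = ≤-by (≤⇒0≤- B≤) (solve 3 (λ K A X →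
            con (+ 2) :* K :+ (con (+ 2) :* X :+ con (+ 2) :* A :- (con (+ 2) :* K :+ con (+ 2) :* A)) := con (+ 2) :* X)
            refl K (normSq a) (normSq (a +ᶜ z *ᶜ ev q z)))
          where
          zq : ℂ
          zq = z *ᶜ ev q z
          zq≤ : normSq zq ≤ 2# * normSq (a +ᶜ zq) + 2# * normSq a
          zq≤ = ≤-by (0≤normSq (a +ᶜ a +ᶜ zq)) (solve 4 (λ a b x y →
            x :* x :+ y :* y :+ ((a :+ a :+ x) :* (a :+ a :+ x) :+ (b :+ b :+ y) :* (b :+ b :+ y)) :=
            con (+ 2) :* ((a :+ x) :* (a :+ x) :+ (b :+ y) :* (b :+ y)) :+ con (+ 2) :* (a :* a :+ b :* b))
            refl (re a) (im a) (re zq) (im zq))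
          B≤ : B ≤ 2# * normSq (a +ᶜ zq) + 2# * normSq a
          B≤ = ≤-trans (≤-respˡ (trans (solve 3 (λ B w δ → B :* w :* δ := B :* (δ :* w)) refl B w δ)
                                  (trans (*-congˡ δw≈1) (*-identityʳ B)))
                 (*-mono-≤ 0≤Bw (≤-trans (≤-by 0≤R (+-comm _ _)) R′≤z) (inj₁ 0<δ) (large z (≤-trans (≤-by 0≤Bw refl) R′≤z))))
               (≤-respˡ (normSq-* z (ev q z)) zq≤)

    bounded-below : ∀ {d p} → Leadᶜ d p → ∃[ δ ] ∃[ R ] 0# < δ × 0# ≤ R × (∀ z → R ≤ normSq z → δ ≤ normSq (ev p z))
    bounded-below ([_] {a} a≉0) = normSq a , 0# , 0<normSq a≉0 , ≤-refl , λ z _ →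
      inj₂ (normSq-cong (S.solve 2 (λ a z → a S.:= a S.:+ z S.:* S.con (+ 0)) C.refl a z))
    bounded-below (_∷_ {xs = q} a lead) = let
      δ , R , 0<δ , 0≤R , large = bounded-below lead
      R′ , 0≤R′ , large′ = grows a q 0<δ 0≤R 0≤1 large
      in 1# , R′ , 0<1 , 0≤R′ , large′

    coercive : ∀ {d p} → Leadᶜ (suc d) p → ∀ {K} → 0# ≤ K →
      ∃[ R ] 0# ≤ R × (∀ z → R ≤ normSq z → K ≤ normSq (ev p z))
    coercive (_∷_ {xs = q} a lead) 0≤K = let
      δ , R , 0<δ , 0≤R , large = bounded-below lead
      in grows a q 0<δ 0≤R 0≤K large

  -- A polynomial without roots has no local minimum of |p|², so every point
  -- has a square on which |p|² exceeds its infimum I by a fixed amount; by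
  -- compactness |p|² then exceeds I by a fixed amount everywhere.
  module _ {d : ℕ} {p : List ℂ} (lead : Leadᶜ (suc d) p) (no-root : ∀ z → ¬ ev p z ≈ᶜ 0ᶜ) where
    LowerBound : Carrier → Set (c₀ ⊔ ℓ₁ ⊔ ℓ₂)
    LowerBound t = ∀ z → t ≤ normSq (ev p z)

    module _ (I : Carrier) (I-lower : LowerBound I) (I-greatest : ∀ ε → 0# < ε → ¬ LowerBound (I + ε)) where
      module _ (ρ : Carrier) (0≤ρ : 0# ≤ ρ) where
        Strip : Carrier → Carrier → Set (c₀ ⊔ ℓ₁ ⊔ ℓ₂)
        Strip s t = ∃[ ε ] 0# < ε ×
          (∀ z → s ≤ re z → re z ≤ t → - ρ ≤ im z → im z ≤ ρ → I + ε ≤ normSq (ev p z))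

        Segment : Carrier → Carrier → Carrier → Set (c₀ ⊔ ℓ₁ ⊔ ℓ₂)
        Segment x s t = ∃[ δ ] ∃[ ε ] 0# < δ × 0# < ε ×
          (∀ z → x + - δ ≤ re z → re z ≤ x + δ → s ≤ im z → im z ≤ t → I + ε ≤ normSq (ev p z))

        abstract
          I+-mono : ∀ {ε ε′} → ε ≤ ε′ → I + ε ≤ I + ε′
          I+-mono = +-mono-≤ ≤-refl

          x+-mono : ∀ {x δ δ′} → δ ≤ δ′ → x + δ ≤ x + δ′
          x+-mono = +-mono-≤ ≤-refl

          x--mono : ∀ {x δ δ′} → δ ≤ δ′ → x + - δ′ ≤ x + - δ
          x--mono {x} {δ} {δ′} δ≤δ′ = ≤-by (≤⇒0≤- δ≤δ′) (solve 3 (λ x δ δ′ → x :- δ′ :+ (δ′ :- δ) := x :- δ) refl x δ δ′)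

          -ρ≤ρ : - ρ ≤ ρ
          -ρ≤ρ = ≤-by (0≤ρ 0≤+ 0≤ρ) (solve 1 (λ ρ → :- ρ :+ (ρ :+ ρ) := ρ) refl ρ)

          strip-join : ∀ {s t u} → Strip s t → Strip t u → Strip s u
          strip-join {t = t} (ε₁ , 0<ε₁ , b₁) (ε₂ , 0<ε₂ , b₂) = let
            ε , 0<ε , ε≤ε₁ , ε≤ε₂ = min ε₁ ε₂ 0<ε₁ 0<ε₂
            in ε , 0<ε , λ z a b c d → [ (λ z≤t → ≤-trans (I+-mono ε≤ε₁) (b₁ z a z≤t c d))
                                       , (λ t≤z → ≤-trans (I+-mono ε≤ε₂) (b₂ z t≤z b c d)) ]′ (total (re z) t)

          strip-shrink : ∀ {s s′ t t′} → s ≤ s′ → t′ ≤ t → Strip s t → Strip s′ t′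
          strip-shrink s≤s′ t′≤t (ε , 0<ε , b) = ε , 0<ε , λ z p q → b z (≤-trans s≤s′ p) (≤-trans q t′≤t)

          segment-join : ∀ x {s t u} → Segment x s t → Segment x t u → Segment x s u
          segment-join x {t = t} (δ₁ , ε₁ , 0<δ₁ , 0<ε₁ , b₁) (δ₂ , ε₂ , 0<δ₂ , 0<ε₂ , b₂) = let
            ε , 0<ε , ε≤ε₁ , ε≤ε₂ = min ε₁ ε₂ 0<ε₁ 0<ε₂
            δ , 0<δ , δ≤δ₁ , δ≤δ₂ = min δ₁ δ₂ 0<δ₁ 0<δ₂
            in δ , ε , 0<δ , 0<ε , λ z a b c d →
              [ (λ z≤t → ≤-trans (I+-mono ε≤ε₁) (b₁ z (≤-trans (x--mono δ≤δ₁) a) (≤-trans b (x+-mono δ≤δ₁)) c z≤t))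
              , (λ t≤z → ≤-trans (I+-mono ε≤ε₂) (b₂ z (≤-trans (x--mono δ≤δ₂) a) (≤-trans b (x+-mono δ≤δ₂)) t≤z d))
              ]′ (total (im z) t)

          segment-shrink : ∀ x {s s′ t t′} → s ≤ s′ → t′ ≤ t → Segment x s t → Segment x s′ t′
          segment-shrink x s≤s′ t′≤t (δ , ε , 0<δ , 0<ε , b) = δ , ε , 0<δ , 0<ε ,
            λ z a a′ p q → b z a a′ (≤-trans s≤s′ p) (≤-trans q t′≤t)

          point : ∀ x y → ∃[ δ ] 0# < δ × Segment x (y + - δ) (y + δ)
          point x y = let
            z′ , less = descend lead (x +i y) (no-root (x +i y))
            δ , ε , 0<δ , 0<ε , above = stays-above lead (x +i y) (≤-<-trans (I-lower z′) less)
            in δ , 0<δ , δ , ε , 0<δ , 0<ε , λ z a b c d → above z (square a b c d)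

          -- The tube lemma: covering the vertical segment over x gives a strip of positive width
          -- around x, and these strips then cover the horizontal interval. The inner covering
          -- exists only up to double negation, which the outer one tolerates.
          whole-square : ¬ ¬ Strip (- ρ) ρ
          whole-square = heine-borel Strip strip-shrink strip-join -ρ≤ρ λ x k →
            heine-borel (Segment x) (segment-shrink x) (segment-join x) -ρ≤ρ (λ y k′ → k′ (point x y))
              λ (δ , ε , 0<δ , 0<ε , b) → k (δ , 0<δ , ε , 0<ε , b)

      abstract
        outside : ∀ {R ρ} z → R ≤ ρ * ρ → 0# ≤ ρ → ¬ (- ρ ≤ re z × re z ≤ ρ × - ρ ≤ im z × im z ≤ ρ) → R ≤ normSq z
        outside {R} {ρ} z R≤ρρ 0≤ρ not-in = ≤-trans R≤ρρ (≤-stable λ ¬le → not-in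
          ( ≮⇒≥ (λ lt → ¬le (≤-trans (neg lt) (≤-by (0≤sq (im z)) refl)))
          , ≮⇒≥ (λ lt → ¬le (≤-trans (pos lt) (≤-by (0≤sq (im z)) refl)))
          , ≮⇒≥ (λ lt → ¬le (≤-trans (neg lt) (≤-by (0≤sq (re z)) (+-comm _ _))))
          , ≮⇒≥ (λ lt → ¬le (≤-trans (pos lt) (≤-by (0≤sq (re z)) (+-comm _ _)))) ))
          where
          pos : ∀ {x} → ρ < x → ρ * ρ ≤ x * x
          pos lt = *-mono-≤ 0≤ρ (inj₁ lt) 0≤ρ (inj₁ lt)
          neg : ∀ {x} → x < - ρ → ρ * ρ ≤ x * x
          neg {x} lt = ≤-respʳ (solve 1 (λ x → :- x :* :- x := x :* x) refl x)
            (pos (<-by (<⇒0<- lt) (solve 2 (λ x ρ → ρ :+ (:- ρ :- x) := :- x) refl x ρ)))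

        infimum-absurd : ⊥
        infimum-absurd = go (coercive lead 0≤I+1)
          where
          -- `coercive` asks for a nonnegative bound; 1 + (I² + 1) is one, and it is at least I + 1
          -- whatever the sign of I.
          0≤I+1 : 0# ≤ 1# + (I * I + 1#)
          0≤I+1 = 0≤1 0≤+ (0≤sq I 0≤+ 0≤1)
          I+1≤ : I + 1# ≤ 1# + (I * I + 1#)
          I+1≤ = *-cancel-2 (≤-by (0≤sq (I + - 1#) 0≤+ (0≤sq I 0≤+ 0≤1))
            (solve 1 (λ I → con (+ 2) :* (I :+ con (+ 1)) :+ ((I :- con (+ 1)) :* (I :- con (+ 1)) :+ (I :* I :+ con (+ 1))) :=
              con (+ 2) :* (con (+ 1) :+ (I :* I :+ con (+ 1)))) refl I))
          go : (∃[ R ] 0# ≤ R × (∀ z → R ≤ normSq z → 1# + (I * I + 1#) ≤ normSq (ev p z))) → ⊥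
          go (R , 0≤R , large) = whole-square (R + 1#) 0≤ρ λ (ε , 0<ε , inside) → let
              ε′ , 0<ε′ , ε′≤ε , ε′≤1 = min ε 1# 0<ε 0<1
              in I-greatest ε′ 0<ε′ λ z → ≤-stable λ ¬le → ¬le (≤-trans (≤-trans (+-mono-≤ ≤-refl ε′≤1) I+1≤)
                   (large z (outside z R≤ρρ 0≤ρ λ (a , b , c , d) →
                     ¬le (≤-trans (+-mono-≤ ≤-refl ε′≤ε) (inside z a b c d)))))
            where
            0≤ρ : 0# ≤ R + 1#
            0≤ρ = 0≤R 0≤+ 0≤1
            R≤ρρ : R ≤ (R + 1#) * (R + 1#)
            R≤ρρ = ≤-by (0≤sq R 0≤+ 0≤R 0≤+ 0≤1)
              (solve 1 (λ R → R :+ (R :* R :+ R :+ con (+ 1)) := (R :+ con (+ 1)) :* (R :+ con (+ 1))) refl R)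

    abstract
      no-root-absurd : ⊥
      no-root-absurd = let
        I , upper , least = supremum LowerBound (0# , λ z → 0≤normSq (ev p z)) (normSq (ev p 0ᶜ) , λ t lower → lower 0ᶜ)
        in infimum-absurd I (λ z → least (normSq (ev p z)) λ t lower → lower z)
             (λ ε 0<ε lower → ≤⇒≯ (upper (I + ε) lower) (<-by 0<ε refl))

  abstract
    fundamental-theorem-of-algebra : ∀ {d p} → Leadᶜ (suc d) p → ¬ ¬ (∃[ z ] ev p z ≈ᶜ 0ᶜ)
    fundamental-theorem-of-algebra lead none = no-root-absurd lead λ z e → none (z , e)

-- Laguerre's inequality and Gauss-Lucas in the right half-plane

module Laguerre {c₀ ℓ₁ ℓ₂} (ℝ : CompleteOrderedField c₀ ℓ₁ ℓ₂) where
  open OrderedFieldProperties ℝ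
  open Solver using (solve; _:+_; _:*_; _:-_; :-_; _:=_; con)
  open ComplexNumbers ℝ
  open ComplexPolynomials ℝ
  open FundamentalTheoremOfAlgebra ℝ
  private
    module C = ℂ-Ring
    module S = ℂ-Solver

  Stable : List ℂ → Set _
  Stable p = ∀ z → 0# < re z → ¬ ev p z ≈ᶜ 0ᶜ

  abstract
    -- For p = ζ q with ζ = z - r this is Re (p′ p̄), that is, Re (p′/p) = Re (1/ζ) + Re (q′/q)
    -- cleared of denominators.
    product-rule-∙ : ∀ ζ q q′ → (q +ᶜ ζ *ᶜ q′) ∙ (ζ *ᶜ q) ≈ normSq q * re ζ + normSq ζ * (q′ ∙ q)
    product-rule-∙ ζ q q′ = solve 6 (λ z w a b x y →
      (a :+ (z :* x :- w :* y)) :* (z :* a :- w :* b) :+ (b :+ (z :* y :+ w :* x)) :* (z :* b :+ w :* a) :=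
      (a :* a :+ b :* b) :* z :+ (z :* z :+ w :* w) :* (x :* a :+ y :* b))
      refl (re ζ) (im ζ) (re q) (im q) (re q′) (im q′)

    normSq-+-∙ : ∀ z w → normSq (z +ᶜ w) ≈ normSq z + 2# * (z ∙ w) + normSq w
    normSq-+-∙ z w = solve 4 (λ a b x y → (a :+ x) :* (a :+ x) :+ (b :+ y) :* (b :+ y) :=
      a :* a :+ b :* b :+ con (+ 2) :* (a :* x :+ b :* y) :+ (x :* x :+ y :* y)) refl (re z) (im z) (re w) (im w)

    normSq-combination : ∀ M z w → normSq (ι M *ᶜ z +ᶜ -ᶜ w) ≈ M * M * normSq z + - (2# * M * (z ∙ w)) + normSq w
    normSq-combination M z w = solve 5 (λ M a b x y →
      (M :* a :- con (+ 0) :* b :- x) :* (M :* a :- con (+ 0) :* b :- x) :+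
      (M :* b :+ con (+ 0) :* a :- y) :* (M :* b :+ con (+ 0) :* a :- y) :=
      M :* M :* (a :* a :+ b :* b) :- con (+ 2) :* M :* (a :* x :+ b :* y) :+ (x :* x :+ y :* y))
      refl M (re z) (im z) (re w) (im w)

    -- M (RHS − LHS) is a sum of nonnegative terms, one of them x |M q − ζ q′|².
    linear-factor : ∀ {x M} ζ q q′ → 0# < x → x ≤ re ζ → 0# < M → x * normSq q′ ≤ M * (q′ ∙ q) →
      x * normSq (q +ᶜ ζ *ᶜ q′) ≤ (1# + M) * ((q +ᶜ ζ *ᶜ q′) ∙ (ζ *ᶜ q))
    linear-factor {x} {M} ζ q q′ 0<x x≤ζ 0<M ih = ≤-respˡ (*-congˡ (sym (normSq-+-∙ q w)))
      (≤-respʳ (sym (*-congˡ (product-rule-∙ ζ q q′)))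
      (≤-by (*-cancel-0≤ 0<M (≤-respʳ identity
        (1+M≥0 0≤* inj₁ 0<M 0≤* 0≤normSq q 0≤* ≤⇒0≤- x≤ζ
          0≤+ 1+M≥0 0≤* 0≤normSq ζ 0≤* ≤⇒0≤- ih
          0≤+ inj₁ 0<x 0≤* ≤-respʳ (normSq-combination M q w) (0≤normSq (ι M *ᶜ q +ᶜ -ᶜ w)))))
        (solve 2 (λ x y → x :+ (y :- x) := y) refl _ _)))
      where
      w : ℂ
      w = ζ *ᶜ q′
      1+M≥0 : 0# ≤ 1# + M
      1+M≥0 = 0≤1 0≤+ inj₁ 0<M
      open import Relation.Binary.Reasoning.Setoid setoid
      Q Z D Q′ : Carrier
      Q = normSq q
      Z = normSq ζ
      D = q′ ∙ q
      Q′ = normSq q′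
      identity : (1# + M) * M * Q * (re ζ + - x) + (1# + M) * Z * (M * D + - (x * Q′)) +
                 x * (M * M * Q + - (2# * M * (q ∙ w)) + normSq w) ≈
                 M * ((1# + M) * (Q * re ζ + Z * D) + - (x * (Q + 2# * (q ∙ w) + normSq w)))
      identity = begin
        _ ≈⟨ +-congˡ (*-congˡ (+-congˡ (normSq-* ζ q′))) ⟩
        _ ≈⟨ solve 8 (λ x M X Q Z D Q′ qw →
               (con (+ 1) :+ M) :* M :* Q :* (X :- x) :+ (con (+ 1) :+ M) :* Z :* (M :* D :- x :* Q′) :+
               x :* (M :* M :* Q :- con (+ 2) :* M :* qw :+ Z :* Q′) :=
               M :* ((con (+ 1) :+ M) :* (Q :* X :+ Z :* D) :- x :* (Q :+ con (+ 2) :* qw :+ Z :* Q′)))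
               refl x M (re ζ) Q Z D Q′ (q ∙ w) ⟩
        _ ≈⟨ *-congˡ (+-congˡ (-‿cong (*-congˡ (+-congˡ (sym (normSq-* ζ q′)))))) ⟩
        _ ∎

    -- The case M = 0 is separate because `linear-factor` cancels a factor M.
    linear-factor₀ : ∀ {x} ζ q q′ → x ≤ re ζ → q′ ≈ᶜ 0ᶜ →
      x * normSq (q +ᶜ ζ *ᶜ q′) ≤ (1# + 0#) * ((q +ᶜ ζ *ᶜ q′) ∙ (ζ *ᶜ q))
    linear-factor₀ {x} ζ q q′ x≤ζ q′≈0 = ≤-respˡ (*-congˡ (normSq-cong (vanish q)))
      (≤-respʳ (*-congˡ (∙-cong (vanish q) C.refl)) (≤-by (≤⇒0≤- x≤ζ 0≤* 0≤normSq q)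
        (solve 5 (λ x z w a b → x :* (a :* a :+ b :* b) :+ (z :- x) :* (a :* a :+ b :* b) :=
          (con (+ 1) :+ con (+ 0)) :* (a :* (z :* a :- w :* b) :+ b :* (z :* b :+ w :* a)))
          refl x (re ζ) (im ζ) (re q) (im q))))
      where
      vanish : ∀ q → q ≈ᶜ q +ᶜ ζ *ᶜ q′
      vanish q = C.sym (C.trans (C.+-congˡ {x = q} (C.*-congˡ {x = ζ} q′≈0))
        (S.solve 2 (λ q z → q S.:+ z S.:* S.con (+ 0) S.:= q) C.refl q ζ))

    ev′-constant : ∀ {p} → Leadᶜ 0 p → ∀ z → ev′ p z ≈ᶜ 0ᶜ
    ev′-constant [ _ ] z = S.solve 1 (λ z → S.con (+ 0) S.:+ z S.:* S.con (+ 0) S.:= S.con (+ 0)) C.refl z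

    module _ {a : ℂ} {p : List ℂ} {r : ℂ} (root : ev (a ∷ p) r ≈ᶜ 0ᶜ) (stable : Stable (a ∷ p)) where
      ev-factor : ∀ z → ev (a ∷ p) z ≈ᶜ (z +ᶜ -ᶜ r) *ᶜ ev (quotient (a ∷ p) r) z
      ev-factor z = C.trans (ev-quotient a p r z) (C.trans (C.+-congʳ root) (C.+-identityˡ _))

      quotient-stable : Stable (quotient (a ∷ p) r)
      quotient-stable z 0<x q≈0 = stable z 0<x (C.trans (ev-factor z)
        (C.trans (C.*-congˡ {x = z +ᶜ -ᶜ r} q≈0) (C.zeroʳ (z +ᶜ -ᶜ r))))

      root-left : re r ≤ 0#
      root-left = ≮⇒≥ λ 0<r → stable r 0<r root

      distance : ∀ z → re z ≤ re (z +ᶜ -ᶜ r)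
      distance z = ≤-by (0≤neg root-left) refl

    -- Convexity of the disc is used one zero at a time: passing from q to (z - r) q raises the
    -- factor n by one. A zero r lies in the closed left half-plane, so Re (z - r) ≥ Re z.
    laguerre : ∀ n {p} → Leadᶜ n p → Stable p → ∀ z → 0# < re z →
      re z * normSq (ev′ p z) ≤ nat n * (ev′ p z ∙ ev p z)
    laguerre zero lead _ z _ = inj₂ (trans (*-congˡ (normSq-0 (ev′-constant lead z))) (trans (zeroʳ _) (sym (zeroˡ _))))
    laguerre (suc n) {a ∷ p} lead@(_ ∷ _) stable z 0<x = ≤-stable λ ¬le → fundamental-theorem-of-algebra lead λ (r , root) →
      ¬le (≤-respˡ (*-congˡ (normSq-cong (C.sym (ev′-quotient a p r z))))
        (≤-respʳ (*-congˡ (∙-cong (C.sym (ev′-quotient a p r z)) (C.sym (ev-factor {a} {p} root stable z))))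
          (step n {quotient (a ∷ p) r} {r} (quotient-lead r lead) (quotient-stable {a} {p} root stable) (distance {a} {p} root stable z))))
      where
      step : ∀ n {q r} → Leadᶜ n q → Stable q → re z ≤ re (z +ᶜ -ᶜ r) →
        re z * normSq (ev q z +ᶜ (z +ᶜ -ᶜ r) *ᶜ ev′ q z) ≤
        (1# + nat n) * ((ev q z +ᶜ (z +ᶜ -ᶜ r) *ᶜ ev′ q z) ∙ ((z +ᶜ -ᶜ r) *ᶜ ev q z))
      step zero    {q} {r} lead stable x≤ = linear-factor₀ (z +ᶜ -ᶜ r) (ev q z) (ev′ q z) x≤ (ev′-constant lead z)
      step (suc n) {q} {r} lead stable x≤ = linear-factor (z +ᶜ -ᶜ r) (ev q z) (ev′ q z) 0<x x≤ (0<nat n)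
        (laguerre (suc n) lead stable z 0<x)

    -- Re (p′/p) is a sum of terms Re (1/(z - r)), all positive. It gives p′ ≠ 0 in the right
    -- half-plane, and on the real axis also the sign of p p′.
    gauss-lucas : ∀ n {p} → Leadᶜ (suc n) p → Stable p → ∀ z → 0# < re z → 0# < ev′ p z ∙ ev p z
    gauss-lucas n {a ∷ p} lead@(_ ∷ _) stable z 0<x = <-stable λ ¬lt → fundamental-theorem-of-algebra lead λ (r , root) →
      ¬lt (<-respʳ (trans (sym (product-rule-∙ (z +ᶜ -ᶜ r) (ev (quotient (a ∷ p) r) z) (ev′ (quotient (a ∷ p) r) z))) (∙-cong (C.sym (ev′-quotient a p r z)) (C.sym (ev-factor {a} {p} root stable z))))
        (0<normSq {ev (quotient (a ∷ p) r) z} (quotient-stable {a} {p} root stable z 0<x) 0<* <-≤-trans 0<x (distance {a} {p} root stable z)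
          0<+≤ (0≤normSq (z +ᶜ -ᶜ r) 0≤* nonneg n {quotient (a ∷ p) r} (quotient-lead r lead) (quotient-stable {a} {p} root stable))))
      where
      nonneg : ∀ n {q} → Leadᶜ n q → Stable q → 0# ≤ ev′ q z ∙ ev q z
      nonneg zero    {q} lead _ = inj₂ (sym (trans (∙-cong (ev′-constant lead z) C.refl)
        (solve 2 (λ a b → con (+ 0) :* a :+ con (+ 0) :* b := con (+ 0)) refl (re (ev q z)) (im (ev q z)))))
      nonneg (suc n) lead stable = inj₁ (gauss-lucas n lead stable z 0<x)

-- Stability under one step of the recurrence

module RecurrenceStability {c ℓ₁ ℓ₂} (ℝ : CompleteOrderedField c ℓ₁ ℓ₂) where
  open OrderedFieldProperties ℝ
  open Solver using (Polynomial; solve; _:+_; _:*_; _:-_; :-_; _:=_; con)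
  open ComplexNumbers ℝ
  private
    module C = ℂ-Ring
    module S = ℂ-Solver

  abstract
    -- P t + S t′ = 0 turns x |t′|² ≤ M Re(t′ t̄) into |t′|² (x |P|² + M Re(P S̄)) ≤ 0.
    combination-≉0 : ∀ {x M} P S t t′ → ¬ t ≈ᶜ 0ᶜ → x * normSq t′ ≤ M * (t′ ∙ t) →
      0# < x * normSq P + M * (P ∙ S) → ¬ P *ᶜ t +ᶜ S *ᶜ t′ ≈ᶜ 0ᶜ
    combination-≉0 {x} {M} P S t t′ t≉0 lag 0<E zero-sum = t≉0 t≈0
      where
      Pt≈-St′ : P *ᶜ t ≈ᶜ -ᶜ (S *ᶜ t′)
      Pt≈-St′ = C.trans (S.solve 2 (λ a b → a S.:= (a S.:+ b) S.:- b) C.refl (P *ᶜ t) (S *ᶜ t′))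
        (C.trans (C.+-congʳ zero-sum) (C.+-identityˡ _))

      cross : normSq P * (t′ ∙ t) ≈ - (normSq t′ * (P ∙ S))
      cross = trans (solve 6 (λ a b x y z w →
          (a :* a :+ b :* b) :* (x :* z :+ y :* w) :=
          (a :* z :- b :* w) :* (a :* x :- b :* y) :+ (a :* w :+ b :* z) :* (a :* y :+ b :* x))
          refl (re P) (im P) (re t′) (im t′) (re t) (im t))
        (trans (∙-cong Pt≈-St′ (C.refl {x = P *ᶜ t′}))
          (solve 6 (λ a b x y z w →
            :- (z :* x :- w :* y) :* (a :* x :- b :* y) :+ :- (z :* y :+ w :* x) :* (a :* y :+ b :* x) :=
            :- ((x :* x :+ y :* y) :* (a :* z :+ b :* w)))
            refl (re P) (im P) (re t′) (im t′) (re S) (im S)))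

      t′E≤0 : normSq t′ * (x * normSq P + M * (P ∙ S)) ≤ 0#
      t′E≤0 = ≤-by (0≤normSq P 0≤* ≤⇒0≤- lag)
        (trans (+-congˡ (trans (solve 5 (λ p t x M d → p :* (M :* d :- x :* t) := M :* (p :* d) :- x :* (t :* p))
                 refl (normSq P) (normSq t′) x M (t′ ∙ t))
                 (+-congʳ (*-congˡ cross))))
          (solve 5 (λ p t x M d → t :* (x :* p :+ M :* d) :+ (M :* :- (t :* d) :- x :* (t :* p)) := con (+ 0))
             refl (normSq P) (normSq t′) x M (P ∙ S)))

      t′≈0 : t′ ≈ᶜ 0ᶜ
      t′≈0 = normSq≈0 (≈-stable λ n≉0 → ≤⇒≯ t′E≤0 (≤∧≉⇒< (0≤normSq t′) (λ e → n≉0 (sym e)) 0<* 0<E))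

      Pt≈0 : P *ᶜ t ≈ᶜ 0ᶜ
      Pt≈0 = C.trans (S.solve 2 (λ a s → a S.:= a S.:+ s S.:* S.con (+ 0)) C.refl (P *ᶜ t) S)
        (C.trans (C.+-congˡ {x = P *ᶜ t} (C.*-congˡ {x = S} (C.sym t′≈0))) zero-sum)

      P≉0 : ¬ P ≈ᶜ 0ᶜ
      P≉0 P≈0 = 0<⇒≉0 0<E (trans (+-cong (*-congˡ (normSq-0 P≈0)) (*-congˡ (∙-cong P≈0 (C.refl {x = S}))))
        (solve 4 (λ x M a b → x :* con (+ 0) :+ M :* (con (+ 0) :* a :+ con (+ 0) :* b) := con (+ 0)) refl x M (re S) (im S)))

      t≈0 : t ≈ᶜ 0ᶜ
      t≈0 = normSq≈0 (*-≉0 (trans (sym (normSq-* P t)) (normSq-0 Pt≈0)) (λ e → P≉0 (normSq≈0 e)))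

  -- With μ = -(2e + v) and β = h + M e the coefficients of the recurrence are
  -- P = M (v (z² + 1) + e (2 z² + z + 1)) + h (z + 1),
  -- S = (2 e + v)(1 - z³) + v (z² - z).
  module _ (M v e h : Carrier) (z : ℂ) where
    P-value : ℂ
    P-value = ι (h + M * e + M * v) +ᶜ z *ᶜ (ι (h + M * e) +ᶜ z *ᶜ (ι (M * (2# * e + v)) +ᶜ z *ᶜ 0ᶜ))

    S-value : ℂ
    S-value = ι (2# * e + v) +ᶜ z *ᶜ (ι (- v) +ᶜ z *ᶜ (ι v +ᶜ z *ᶜ (ι (- (2# * e + v)) +ᶜ z *ᶜ 0ᶜ)))

  private
    infixl 7 _⊕_
    infixl 8 _⊗_
    -- Complex arithmetic on pairs of solver expressions: the values of P and S can be entered in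
    -- Horner form, and their expansion is left to the real solver.
    _⊕_ _⊗_ : ∀ {n} → Polynomial n × Polynomial n → Polynomial n × Polynomial n → Polynomial n × Polynomial n
    (a , b) ⊕ (c , d) = (a :+ c) , (b :+ d)
    (a , b) ⊗ (c , d) = (a :* c :- b :* d) , (a :* d :+ b :* c)

    real : ∀ {n} → Polynomial n → Polynomial n × Polynomial n
    real a = a , con (+ 0)

    _⊙_ : ∀ {n} → Polynomial n × Polynomial n → Polynomial n × Polynomial n → Polynomial n
    (a , b) ⊙ (c , d) = a :* c :+ b :* d

  abstract
    -- P is linear in V = M v, W = M e and h, and M S is linear in V and W. The energy is therefore
    -- a quadratic form in V, W, h, and its coefficients `vv`, ..., `hh` turn out nonnegative for Re
    -- z > 0.
    energy-positive : ∀ {M v e h} z → 0# ≤ M → 0# ≤ v → 0# ≤ e → 0# ≤ h → 0# < re z →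
      ¬ (M * v ≈ 0# × M * e ≈ 0# × h ≈ 0#) →
      0# < re z * normSq (P-value M v e h z) + M * (P-value M v e h z ∙ S-value M v e h z)
    energy-positive {M} {v} {e} {h} z 0≤M 0≤v 0≤e 0≤h 0<x not-all-0 =
      -- Each of V, W, h, if positive, makes its diagonal term positive. So if the energy were not
      -- positive, all three would vanish.
      <-respʳ identity (<-stable λ ¬lt → not-all-0
        ( square-0 (λ 0<V → ¬lt (0<V² 0<V 0<+≤ 0≤VW 0<+≤ 0≤W² 0<+≤ 0≤hV 0<+≤ 0≤hW 0<+≤ 0≤h²)) 0≤V
        , square-0 (λ 0<W → ¬lt (0≤V² 0≤+ 0≤VW 0≤+< 0<W² 0<W 0<+≤ 0≤hV 0<+≤ 0≤hW 0<+≤ 0≤h²)) 0≤W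
        , square-0 (λ 0<h → ¬lt (0≤V² 0≤+ 0≤VW 0≤+ 0≤W² 0≤+ 0≤hV 0≤+ 0≤hW 0≤+< 0<h² 0<h)) 0≤h))
      where
      x y V W r : Carrier
      x = re z
      y = im z
      V = M * v
      W = M * e
      r = x * x + y * y

      square-0 : ∀ {a} → ¬ 0# < a → 0# ≤ a → a ≈ 0#
      square-0 a≯0 0≤a = ≤-antisym (≮⇒≥ a≯0) 0≤a

      0≤x : 0# ≤ x
      0≤x = inj₁ 0<x
      0≤V : 0# ≤ V
      0≤V = 0≤M 0≤* 0≤v
      0≤W : 0# ≤ W
      0≤W = 0≤M 0≤* 0≤e
      0≤r : 0# ≤ r
      0≤r = 0≤normSq z

      vv vw ww hv hw hh : Carrier
      -- This is |1 + z²|²: the v-part of S is (1 - z)(1 + z²), so the factor left over is x + Re (1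
      -- - z) = 1. Likewise `hh` is x |1 + z|², as S does not involve h.
      vv = 2# * x * (2# * x) + (r + - 1#) * (r + - 1#)
      vw = vv + vv + vv + 2# * (r * x + x)
      ww = 3# * x + (2# * ((r + - 1#) * (r + - 1#)) + 3# * (r * x) + 10# * (x * x))
        where
        3# 10# : Carrier
        3# = Solver.fromℤ (+ 3)
        10# = Solver.fromℤ (+ 10)
      hv = vv + 2# * x * (r + 1#)
      hw = 2# + (2# * (r * r) + 4# * (r * x) + 4# * x + 4# * (x * x))
        where
        4# : Carrier
        4# = Solver.fromℤ (+ 4)
      hh = x * ((x + 1#) * (x + 1#) + y * y)

      0<vv : 0# < vv
      0<vv = 0<2 0<* 0<x 0<* (0<2 0<* 0<x) 0<+≤ 0≤sq (r + - 1#)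
      0≤vw : 0# ≤ vw
      0≤vw = inj₁ 0<vv 0≤+ inj₁ 0<vv 0≤+ inj₁ 0<vv 0≤+ inj₁ 0<2 0≤* (0≤r 0≤* 0≤x 0≤+ 0≤x)
      0<ww : 0# < ww
      0<ww = 0<fromℕ 2 0<* 0<x 0<+≤ (inj₁ 0<2 0≤* 0≤sq (r + - 1#) 0≤+ 0≤fromℕ 3 0≤* (0≤r 0≤* 0≤x) 0≤+ 0≤fromℕ 10 0≤* 0≤sq x)
      0≤hv : 0# ≤ hv
      0≤hv = inj₁ 0<vv 0≤+ inj₁ 0<2 0≤* 0≤x 0≤* (0≤r 0≤+ 0≤1)
      0≤hw : 0# ≤ hw
      0≤hw = inj₁ 0<2 0≤+ (inj₁ 0<2 0≤* 0≤sq r 0≤+ 0≤fromℕ 4 0≤* (0≤r 0≤* 0≤x) 0≤+ 0≤fromℕ 4 0≤* 0≤x 0≤+ 0≤fromℕ 4 0≤* 0≤sq x)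
      0<hh : 0# < hh
      0<hh = 0<x 0<* ((0<x 0<+≤ 0≤1) 0<* (0<x 0<+≤ 0≤1) 0<+≤ 0≤sq y)

      0<V² : 0# < V → 0# < V * V * vv
      0<V² 0<V = 0<V 0<* 0<V 0<* 0<vv
      0≤V² : 0# ≤ V * V * vv
      0≤V² = 0≤sq V 0≤* inj₁ 0<vv
      0≤VW : 0# ≤ V * W * vw
      0≤VW = 0≤V 0≤* 0≤W 0≤* 0≤vw
      0<W² : 0# < W → 0# < W * W * ww
      0<W² 0<W = 0<W 0<* 0<W 0<* 0<ww
      0≤W² : 0# ≤ W * W * ww
      0≤W² = 0≤sq W 0≤* inj₁ 0<ww
      0≤hV : 0# ≤ h * V * hv
      0≤hV = 0≤h 0≤* 0≤V 0≤* 0≤hv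
      0≤hW : 0# ≤ h * W * hw
      0≤hW = 0≤h 0≤* 0≤W 0≤* 0≤hw
      0≤h² : 0# ≤ h * h * hh
      0≤h² = 0≤sq h 0≤* inj₁ 0<hh
      0<h² : 0# < h → 0# < h * h * hh
      0<h² 0<h = 0<h 0<* 0<h 0<* 0<hh

      identity : V * V * vv + V * W * vw + W * W * ww + h * V * hv + h * W * hw + h * h * hh ≈
        x * normSq (P-value M v e h z) + M * (P-value M v e h z ∙ S-value M v e h z)
      identity = solve 6 (λ M v e h x y → let
        z  = x , y
        V  = M :* v
        W  = M :* e
        r  = x :* x :+ y :* y
        𝟙  = con (+ 1)
        vv = con (+ 2) :* x :* (con (+ 2) :* x) :+ (r :- 𝟙) :* (r :- 𝟙)
        vw = vv :+ vv :+ vv :+ con (+ 2) :* (r :* x :+ x)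
        ww = con (+ 3) :* x :+ (con (+ 2) :* ((r :- 𝟙) :* (r :- 𝟙)) :+ con (+ 3) :* (r :* x) :+ con (+ 10) :* (x :* x))
        hv = vv :+ con (+ 2) :* x :* (r :+ 𝟙)
        hw = con (+ 2) :+ (con (+ 2) :* (r :* r) :+ con (+ 4) :* (r :* x) :+ con (+ 4) :* x :+ con (+ 4) :* (x :* x))
        hh = x :* ((x :+ 𝟙) :* (x :+ 𝟙) :+ y :* y)
        a  = con (+ 2) :* e :+ v
        P  = real (h :+ W :+ V) ⊕ z ⊗ (real (h :+ W) ⊕ z ⊗ (real (M :* a) ⊕ z ⊗ real (con (+ 0))))
        S  = real a ⊕ z ⊗ (real (:- v) ⊕ z ⊗ (real v ⊕ z ⊗ (real (:- a) ⊕ z ⊗ real (con (+ 0)))))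
        in V :* V :* vv :+ V :* W :* vw :+ W :* W :* ww :+ h :* V :* hv :+ h :* W :* hw :+ h :* h :* hh :=
           x :* (P ⊙ P) :+ M :* (P ⊙ S)) refl M v e h x y

-- Homogeneous binary forms

module HomogeneousForm {c ℓ} (A : CommutativeRing c ℓ) where
  open CommutativeRing A hiding (zero)
  open Exp semiring using (_^_; ^-congˡ)
  open Sum semiring using (sum; sum-cong-≋; *-distribˡ-sum)
  open IntegerCoefficientSolver A

  -- Σ_{k=0}^{N} g_k x^k s^{N-k}
  form : ∀ N → (Fin (suc N) → Carrier) → Carrier → Carrier → Carrier
  form zero    g x s = g zero
  form (suc N) g x s = g zero * s ^ suc N + x * form N (g ∘ suc) x s

  abstract
    form-sum : ∀ N g x s → form N g x s ≈ sum (λ k → g k * x ^ toℕ k * s ^ (N ℕ.∸ toℕ k))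
    form-sum zero    g x s = solve 1 (λ g → g := g :* con (+ 1) :* con (+ 1) :+ con (+ 0)) refl (g zero)
    form-sum (suc N) g x s = +-cong
      (solve 2 (λ g s → g :* s := g :* con (+ 1) :* s) refl (g zero) (s ^ suc N))
      (trans (*-congˡ (form-sum N (g ∘ suc) x s)) (trans
        (*-distribˡ-sum {suc N} x (λ k → g (suc k) * x ^ toℕ k * s ^ (N ℕ.∸ toℕ k)))
        (sum-cong-≋ λ k → solve 4 (λ g x y z → x :* (g :* y :* z) := g :* (x :* y) :* z) refl
          (g (suc k)) x (x ^ toℕ k) (s ^ (N ℕ.∸ toℕ k)))))

    form-congᵍ : ∀ N {g g′} x s → (∀ k → g k ≈ g′ k) → form N g x s ≈ form N g′ x s
    form-congᵍ zero    x s e = e zero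
    form-congᵍ (suc N) x s e = +-cong (*-congʳ (e zero)) (*-congˡ (form-congᵍ N x s (e ∘ suc)))

    form-cong : ∀ N g {x x′ s s′} → x ≈ x′ → s ≈ s′ → form N g x s ≈ form N g x′ s′
    form-cong zero    g p q = refl
    form-cong (suc N) g p q = +-cong (*-congˡ (^-congˡ (suc N) q)) (*-cong p (form-cong N (g ∘ suc) p q))

    form-+ : ∀ N g g′ x s → form N (λ k → g k + g′ k) x s ≈ form N g x s + form N g′ x s
    form-+ zero    g g′ x s = refl
    form-+ (suc N) g g′ x s = trans (+-congˡ (*-congˡ (form-+ N _ _ x s)))
      (solve 6 (λ a b s x f g → (a :+ b) :* s :+ x :* (f :+ g) := a :* s :+ x :* f :+ (b :* s :+ x :* g)) refl
        (g zero) (g′ zero) (s ^ suc N) x (form N (g ∘ suc) x s) (form N (g′ ∘ suc) x s))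

    form-* : ∀ N a g x s → form N (λ k → a * g k) x s ≈ a * form N g x s
    form-* zero    a g x s = refl
    form-* (suc N) a g x s = trans (+-congˡ (*-congˡ (form-* N a _ x s)))
      (solve 5 (λ a b s x f → a :* b :* s :+ x :* (a :* f) := a :* (b :* s :+ x :* f)) refl
        a (g zero) (s ^ suc N) x (form N (g ∘ suc) x s))

    form-0 : ∀ N x s → form N (λ _ → 0#) x s ≈ 0#
    form-0 zero    x s = refl
    form-0 (suc N) x s = trans (+-congˡ (*-congˡ (form-0 N x s)))
      (solve 2 (λ s x → con (+ 0) :* s :+ x :* con (+ 0) := con (+ 0)) refl (s ^ suc N) x)

  unit : ∀ N → ℕ → Fin (suc N) → Carrier
  unit N       zero    zero    = 1#
  unit N       zero    (suc k) = 0#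
  unit N       (suc j) zero    = 0#
  unit (suc N) (suc j) (suc k) = unit N j k

  abstract
    form-unit : ∀ j i x s → form (j ℕ.+ i) (unit (j ℕ.+ i) j) x s ≈ x ^ j * s ^ i
    form-unit zero zero    x s = solve 0 (con (+ 1) := con (+ 1) :* con (+ 1)) refl
    form-unit zero (suc i) x s = trans (+-congˡ (*-congˡ (trans (form-congᵍ i x s (λ _ → refl)) (form-0 i x s))))
      (solve 2 (λ s x → con (+ 1) :* s :+ x :* con (+ 0) := con (+ 1) :* s) refl (s ^ suc i) x)
    form-unit (suc j) i x s = trans (+-congˡ (*-congˡ (form-unit j i x s)))
      (solve 4 (λ s x y z → con (+ 0) :* s :+ x :* (y :* z) := x :* y :* z) refl (s ^ suc (j ℕ.+ i)) x (x ^ j) (s ^ i))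

-- Values of a γ-expansion at real and complex points

module _ {c ℓ₁ ℓ₂} (ℝ : CompleteOrderedField c ℓ₁ ℓ₂) where
  open OrderedFieldProperties ℝ
  open RealAndComplex ℝ using (gammaExpansion; Poly; _*ₚ_; polyRawRing)
  open RawSemiringDefs (RawRing.rawSemiring polyRawRing) using () renaming (_^_ to infixr 8 _^ₚ_; sum to sumₚ)

  module GammaValue {a ℓ} (A : CommutativeRing a ℓ)
    (φ : Carrier → CommutativeRing.Carrier A)
    (φ-cong : ∀ {a b} → a ≈ b → CommutativeRing._≈_ A (φ a) (φ b))
    (φ-0 : CommutativeRing._≈_ A (φ 0#) (CommutativeRing.0# A))
    (φ-1 : CommutativeRing._≈_ A (φ 1#) (CommutativeRing.1# A))
    (φ-+ : ∀ a b → CommutativeRing._≈_ A (φ (a + b)) (CommutativeRing._+_ A (φ a) (φ b)))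
    (φ-* : ∀ a b → CommutativeRing._≈_ A (φ (a * b)) (CommutativeRing._*_ A (φ a) (φ b))) where
    private module A = CommutativeRing A
    open Evaluation.Along commutativeRing A φ φ-cong φ-0 φ-1 φ-+ φ-*
    open IntegerCoefficientSolver A
    open HomogeneousForm A
    open Exp A.semiring using (_^_; ^-congˡ)
    open Sum A.semiring using (sum; sum-cong-≋)

    abstract
      ev-1+x : ∀ z → ev (1# ∷ 1# ∷ []) z A.≈ A.1# A.+ z
      ev-1+x z = A.trans (A.+-cong φ-1 (A.*-congˡ (A.+-congʳ φ-1)))
        (solve 1 (λ z → con (+ 1) :+ z :* (con (+ 1) :+ z :* con (+ 0)) := con (+ 1) :+ z) A.refl z)

      ev-x : ∀ z → ev (0# ∷ 1# ∷ []) z A.≈ z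
      ev-x z = A.trans (A.+-cong φ-0 (A.*-congˡ (A.+-congʳ φ-1)))
        (solve 1 (λ z → con (+ 0) :+ z :* (con (+ 1) :+ z :* con (+ 0)) := z) A.refl z)

      ev-1+x² : ∀ z → ev (1# ∷ 0# ∷ 1# ∷ []) z A.≈ A.1# A.+ z A.* z
      ev-1+x² z = A.trans (A.+-cong φ-1 (A.*-congˡ (A.+-cong φ-0 (A.*-congˡ (A.+-congʳ φ-1)))))
        (solve 1 (λ z → con (+ 1) :+ z :* (con (+ 0) :+ z :* (con (+ 1) :+ z :* con (+ 0))) := con (+ 1) :+ z :* z) A.refl z)

      ev-const : ∀ b z → ev (b ∷ []) z A.≈ φ b
      ev-const b z = solve 2 (λ b z → b :+ z :* con (+ 0) := b) A.refl (φ b) z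

      ev-gammaExpansion : ∀ ν N g z → ev (gammaExpansion ν N g) z A.≈
        (A.1# A.+ z) ^ ν A.* form N (φ ∘ g) z (A.1# A.+ z A.* z)
      ev-gammaExpansion ν N g z = A.trans (ev-* (L ^ₚ ν) (sumₚ term) z) (A.*-cong
        (A.trans (ev-^ L ν z) (^-congˡ ν (ev-1+x z)))
        (A.trans (ev-sum term z) (A.trans (sum-cong-≋ ev-term)
          (A.sym (form-sum N (φ ∘ g) z (A.1# A.+ z A.* z))))))
        where
        L X Q : Poly
        L = 1# ∷ 1# ∷ []
        X = 0# ∷ 1# ∷ []
        Q = 1# ∷ 0# ∷ 1# ∷ []

        term : Fin (suc N) → Poly
        term k = (g k ∷ []) *ₚ X ^ₚ toℕ k *ₚ Q ^ₚ (N ℕ.∸ toℕ k)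

        ev-term : ∀ k → ev (term k) z A.≈ φ (g k) A.* z ^ toℕ k A.* (A.1# A.+ z A.* z) ^ (N ℕ.∸ toℕ k)
        ev-term k = A.trans (ev-* ((g k ∷ []) *ₚ X ^ₚ toℕ k) (Q ^ₚ (N ℕ.∸ toℕ k)) z) (A.*-cong
          (A.trans (ev-* (g k ∷ []) (X ^ₚ toℕ k) z) (A.*-cong (ev-const (g k) z)
            (A.trans (ev-^ X (toℕ k) z) (^-congˡ (toℕ k) (ev-x z)))))
          (A.trans (ev-^ Q (N ℕ.∸ toℕ k) z) (^-congˡ (N ℕ.∸ toℕ k) (ev-1+x² z))))

-- The cone of nonnegative γ-expansions

module GammaCone {c ℓ₁ ℓ₂} (ℝ : CompleteOrderedField c ℓ₁ ℓ₂) where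
  open OrderedFieldProperties ℝ
  open HomogeneousForm commutativeRing
  open Exp semiring using (_^_)
  open Sum semiring using (sum)
  open Solver using (solve; _:+_; _:*_; _:-_; :-_; _:=_; con)

  s : Carrier → Carrier
  s x = 1# + x * x

  -- DX j and 2 x DS i are the derivatives of x^j and (1 + x²)^i.
  DX DS : ℕ → Carrier → Carrier
  DX zero    x = 0#
  DX (suc j) x = nat (suc j) * x ^ j
  DS zero    x = 0#
  DS (suc i) x = nat (suc i) * s x ^ i

  -- Membership concerns values and not coefficient lists, so sums and multiples of expansions need
  -- no polynomial arithmetic. Agreement on positive reals restores the coefficients at the end.
  data InCone (N ν : ℕ) (f : Carrier → Carrier) : Set (c ⊔ ℓ₁ ⊔ ℓ₂) where
    cone : (g : Fin (suc N) → Carrier) → (∀ k → 0# ≤ g k) →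
           (∀ x → f x ≈ (1# + x) ^ ν * form N g x (s x)) → InCone N ν f

  abstract
    x*DX : ∀ j x → x * DX j x ≈ nat j * x ^ j
    x*DX zero    x = solve 1 (λ x → x :* con (+ 0) := con (+ 0) :* con (+ 1)) refl x
    x*DX (suc j) x = solve 3 (λ x n y → x :* (n :* y) := n :* (x :* y)) refl x (nat (suc j)) (x ^ j)

    s*DS : ∀ i x → s x * DS i x ≈ nat i * s x ^ i
    s*DS zero    x = solve 1 (λ x → x :* con (+ 0) := con (+ 0) :* con (+ 1)) refl (s x)
    s*DS (suc i) x = solve 3 (λ x n y → x :* (n :* y) := n :* (x :* y)) refl (s x) (nat (suc i)) (s x ^ i)

    cone-cong : ∀ {N ν f f′} → (∀ x → f x ≈ f′ x) → InCone N ν f → InCone N ν f′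
    cone-cong e (cone g 0≤g eq) = cone g 0≤g λ x → trans (sym (e x)) (eq x)

    cone-0 : ∀ {N ν} → InCone N ν (λ _ → 0#)
    cone-0 {N} {ν} = cone (λ _ → 0#) (λ _ → ≤-refl) λ x → sym (trans (*-congˡ (form-0 N x (s x))) (zeroʳ _))

    cone-+ : ∀ {N ν f f′} → InCone N ν f → InCone N ν f′ → InCone N ν (λ x → f x + f′ x)
    cone-+ {N} {ν} (cone g 0≤g eq) (cone g′ 0≤g′ eq′) = cone (λ k → g k + g′ k) (λ k → 0≤g k 0≤+ 0≤g′ k) λ x →
      trans (+-cong (eq x) (eq′ x)) (trans
        (solve 3 (λ y a b → y :* a :+ y :* b := y :* (a :+ b)) refl ((1# + x) ^ ν) (form N g x (s x)) (form N g′ x (s x)))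
        (*-congˡ (sym (form-+ N g g′ x (s x)))))

    cone-* : ∀ {N ν f a} → 0# ≤ a → InCone N ν f → InCone N ν (λ x → a * f x)
    cone-* {N} {ν} {a = a} 0≤a (cone g 0≤g eq) = cone (λ k → a * g k) (λ k → 0≤a 0≤* 0≤g k) λ x →
      trans (*-congˡ (eq x)) (trans
        (solve 3 (λ a y f → a :* (y :* f) := y :* (a :* f)) refl a ((1# + x) ^ ν) (form N g x (s x)))
        (*-congˡ (sym (form-* N a g x (s x)))))

    cone-sum : ∀ {N ν n} (g : Fin n → Carrier) (f : Fin n → Carrier → Carrier) → (∀ k → 0# ≤ g k) →
      (∀ k → InCone N ν (f k)) → InCone N ν (λ x → sum (λ k → g k * f k x))
    cone-sum {n = zero}  g f 0≤g f∈ = cone-0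
    cone-sum {n = suc n} g f 0≤g f∈ =
      cone-+ (cone-* (0≤g zero) (f∈ zero)) (cone-sum (g ∘ suc) (f ∘ suc) (0≤g ∘ suc) (f∈ ∘ suc))

    cone-basis : ∀ {N ν} j i → j ℕ.+ i ≡ N → InCone N ν (λ x → (1# + x) ^ ν * (x ^ j * s x ^ i))
    cone-basis j i ≡.refl = cone (unit (j ℕ.+ i) j) (0≤unit (j ℕ.+ i) j) λ x → *-congˡ (sym (form-unit j i x (s x)))
      where
      0≤unit : ∀ N j k → 0# ≤ unit N j k
      0≤unit N       zero    zero    = 0≤1
      0≤unit N       zero    (suc k) = ≤-refl
      0≤unit N       (suc j) zero    = ≤-refl
      0≤unit (suc N) (suc j) (suc k) = 0≤unit N j k

    cone-DX : ∀ {N ν} j i → j ℕ.+ i ≡ suc N → InCone N ν (λ x → (1# + x) ^ ν * (DX j x * s x ^ i))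
    cone-DX {ν = ν} zero    i _ = cone-cong
      (λ x → solve 2 (λ y z → con (+ 0) := y :* (con (+ 0) :* z)) refl ((1# + x) ^ ν) (s x ^ i)) cone-0
    cone-DX {ν = ν} (suc j) i e = cone-cong
      (λ x → solve 4 (λ n y a b → n :* (y :* (a :* b)) := y :* (n :* a :* b)) refl (nat (suc j)) ((1# + x) ^ ν) (x ^ j) (s x ^ i))
      (cone-* (0≤nat (suc j)) (cone-basis j i (ℕ.suc-injective e)))

    cone-DS : ∀ {N ν} j i → j ℕ.+ i ≡ suc N → InCone N ν (λ x → (1# + x) ^ ν * (x ^ j * DS i x))
    cone-DS {ν = ν} j zero    _ = cone-cong
      (λ x → solve 2 (λ y z → con (+ 0) := y :* (z :* con (+ 0))) refl ((1# + x) ^ ν) (x ^ j)) cone-0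
    cone-DS {ν = ν} j (suc i) e = cone-cong
      (λ x → solve 4 (λ n y a b → n :* (y :* (a :* b)) := y :* (a :* (n :* b))) refl (nat (suc i)) ((1# + x) ^ ν) (x ^ j) (s x ^ i))
      (cone-* (0≤nat (suc i)) (cone-basis j i (ℕ.suc-injective (≡.trans (≡.sym (ℕ.+-suc j i)) e))))

  -- The coefficients of the recurrence in the parameters M = m_n, v = ν_n,
  -- e = -(μ_n + ν_n)/2 and h = (2 β_n + m_n (μ_n + ν_n))/2.
  module _ (M v e h : Carrier) where
    P S : Carrier → Carrier
    P x = h + M * e + M * v + x * (h + M * e + x * (M * (2# * e + v) + x * 0#))
    S x = 2# * e + v + x * (- v + x * (v + x * (- (2# * e + v) + x * 0#)))

  abstract
    -- Modulo the relations x B = J A and s D = I C for A = x^j, B = DX j,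
    -- C = s^i, D = DS i, the image of the basis element is a nonnegative
    -- combination of basis elements.
    even-identity : ∀ {M v e h x A B C D J I} → x * B ≈ J * A → s x * D ≈ I * C → M ≈ 2# * (J + I) →
      (h + 2# * I * (e + v)) * ((1# + x) ^ 1 * (A * C)) + (2# * e + v) * ((1# + x) ^ 1 * (B * (s x * C)))
        + 2# * 2# * e * ((1# + x) ^ 1 * (x * A * D)) ≈
      P M v e h x * (A * C) + S M v e h x * (B * C + A * (2# * x * D))
    even-identity {M} {v} {e} {h} {x} {A} {B} {C} {D} {J} {I} xB sD M≈ = begin
      -- The target of this step displays 2 (J + I), J A and I C as factors, so that the three
      -- hypotheses apply by congruence.
      _ ≈⟨ solve 10 (λ v e h x A B C D J I → let S = con (+ 1) :+ x :* x ; a = con (+ 2) :* e :+ v in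
             (h :+ con (+ 2) :* I :* (e :+ v)) :* ((con (+ 1) :+ x) :* con (+ 1) :* (A :* C))
               :+ a :* ((con (+ 1) :+ x) :* con (+ 1) :* (B :* (S :* C)))
               :+ con (+ 2) :* con (+ 2) :* e :* ((con (+ 1) :+ x) :* con (+ 1) :* (x :* A :* D)) :=
             con (+ 2) :* (J :+ I) :* (e :* (con (+ 1) :+ x :+ con (+ 2) :* x :* x) :+ v :* S) :* A :* C
               :+ h :* (con (+ 1) :+ x) :* A :* C
               :+ J :* A :* C :* (con (+ 2) :* e :* (con (+ 1) :- x) :- con (+ 2) :* a :* S)
               :+ I :* C :* A :* (x :* (con (+ 2) :* (con (+ 1) :- x) :* a :- con (+ 4) :* e))
               :+ ((con (+ 1) :+ x) :* (a :* B :* S :* C :+ con (+ 4) :* e :* x :* A :* D)))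
             refl v e h x A B C D J I ⟩
      _ ≈⟨ +-congʳ (+-cong (+-cong (+-congʳ (*-congʳ (*-congʳ (*-congʳ (sym M≈))))) (*-congʳ (*-congʳ (sym xB)))) (*-congʳ (*-congʳ (sym sD)))) ⟩
      _ ≈⟨ solve 9 (λ M v e h x A B C D → let S = con (+ 1) :+ x :* x ; a = con (+ 2) :* e :+ v in
             M :* (e :* (con (+ 1) :+ x :+ con (+ 2) :* x :* x) :+ v :* S) :* A :* C
               :+ h :* (con (+ 1) :+ x) :* A :* C
               :+ x :* B :* C :* (con (+ 2) :* e :* (con (+ 1) :- x) :- con (+ 2) :* a :* S)
               :+ S :* D :* A :* (x :* (con (+ 2) :* (con (+ 1) :- x) :* a :- con (+ 4) :* e))
               :+ ((con (+ 1) :+ x) :* (a :* B :* S :* C :+ con (+ 4) :* e :* x :* A :* D)) :=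
             (h :+ M :* e :+ M :* v :+ x :* (h :+ M :* e :+ x :* (M :* a :+ x :* con (+ 0)))) :* (A :* C)
               :+ (a :+ x :* (:- v :+ x :* (v :+ x :* (:- a :+ x :* con (+ 0))))) :* (B :* C :+ A :* (con (+ 2) :* x :* D)))
             refl M v e h x A B C D ⟩
      _ ∎
      where open import Relation.Binary.Reasoning.Setoid setoid

    -- The source carries a factor 1 + x and the target none: (1 + x)² = (1 + x²) + 2 x spreads it
    -- over two basis elements, and the product rule adds the term S A C.
    odd-identity : ∀ {M v e h x A B C D J I} → x * B ≈ J * A → s x * D ≈ I * C → M ≈ 2# * (J + I) + 1# →
      (2# * e + v) * (1# * (B * (s x * (s x * C))))
        + (h + 2# * (J + I + 1#) * v + (2# * (J + J) + 2# * I + 2# + 1#) * e) * (1# * (A * (s x * C)))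
        + (2# * h + 2# * (2# * I) * (2# * e + v) + 2# * e) * (1# * (x * A * C))
        + 2# * (2# * 2#) * e * (1# * (x * (x * A) * D)) ≈
      P M v e h x * ((1# + x) * (A * C)) + S M v e h x * (A * C + (1# + x) * (B * C + A * (2# * x * D)))
    odd-identity {M} {v} {e} {h} {x} {A} {B} {C} {D} {J} {I} xB sD M≈ = begin
      _ ≈⟨ solve 10 (λ v e h x A B C D J I → let S = con (+ 1) :+ x :* x ; a = con (+ 2) :* e :+ v in
             a :* (con (+ 1) :* (B :* (S :* (S :* C))))
               :+ (h :+ con (+ 2) :* (J :+ I :+ con (+ 1)) :* v :+ (con (+ 2) :* (J :+ J) :+ con (+ 2) :* I :+ con (+ 2) :+ con (+ 1)) :* e)
                    :* (con (+ 1) :* (A :* (S :* C)))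
               :+ (con (+ 2) :* h :+ con (+ 2) :* (con (+ 2) :* I) :* a :+ con (+ 2) :* e) :* (con (+ 1) :* (x :* A :* C))
               :+ con (+ 2) :* (con (+ 2) :* con (+ 2)) :* e :* (con (+ 1) :* (x :* (x :* A) :* D)) :=
             (con (+ 2) :* (J :+ I) :+ con (+ 1)) :* (e :* (con (+ 1) :+ x :+ con (+ 2) :* x :* x) :+ v :* S) :* ((con (+ 1) :+ x) :* A :* C)
               :+ J :* A :* C :* (con (+ 2) :* e :* (con (+ 1) :- x :* x) :- con (+ 2) :* x :* a :* S)
               :+ I :* C :* A :* (con (+ 2) :* x :* (con (+ 1) :- x :* x) :* a :- con (+ 4) :* e :* x :* x)
               :+ (h :* (con (+ 1) :+ x) :* (con (+ 1) :+ x) :* A :* C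
                 :+ (con (+ 1) :- x) :* (a :* S :+ con (+ 2) :* e :* x) :* A :* C
                 :+ a :* B :* S :* S :* C :+ con (+ 8) :* e :* x :* x :* A :* D))
             refl v e h x A B C D J I ⟩
      _ ≈⟨ +-congʳ (+-cong (+-cong (*-congʳ (*-congʳ (sym M≈))) (*-congʳ (*-congʳ (sym xB)))) (*-congʳ (*-congʳ (sym sD)))) ⟩
      _ ≈⟨ solve 9 (λ M v e h x A B C D → let S = con (+ 1) :+ x :* x ; a = con (+ 2) :* e :+ v in
             M :* (e :* (con (+ 1) :+ x :+ con (+ 2) :* x :* x) :+ v :* S) :* ((con (+ 1) :+ x) :* A :* C)
               :+ x :* B :* C :* (con (+ 2) :* e :* (con (+ 1) :- x :* x) :- con (+ 2) :* x :* a :* S)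
               :+ S :* D :* A :* (con (+ 2) :* x :* (con (+ 1) :- x :* x) :* a :- con (+ 4) :* e :* x :* x)
               :+ (h :* (con (+ 1) :+ x) :* (con (+ 1) :+ x) :* A :* C
                 :+ (con (+ 1) :- x) :* (a :* S :+ con (+ 2) :* e :* x) :* A :* C
                 :+ a :* B :* S :* S :* C :+ con (+ 8) :* e :* x :* x :* A :* D) :=
             (h :+ M :* e :+ M :* v :+ x :* (h :+ M :* e :+ x :* (M :* a :+ x :* con (+ 0)))) :* ((con (+ 1) :+ x) :* (A :* C))
               :+ (a :+ x :* (:- v :+ x :* (v :+ x :* (:- a :+ x :* con (+ 0)))))
                  :* (A :* C :+ (con (+ 1) :+ x) :* (B :* C :+ A :* (con (+ 2) :* x :* D))))
             refl M v e h x A B C D ⟩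
      _ ∎
      where open import Relation.Binary.Reasoning.Setoid setoid

-- The recurrence preserves the cone

module GammaRecurrence {c ℓ₁ ℓ₂} (ℝ : CompleteOrderedField c ℓ₁ ℓ₂) where
  open OrderedFieldProperties ℝ
  open RealAndComplex ℝ using (gammaExpansion; Poly; _*ₚ_; polyRawRing; _≈ₚ_)
  open RawSemiringDefs (RawRing.rawSemiring polyRawRing) using () renaming (_^_ to infixr 8 _^ₚ_; sum to sumₚ)
  open Evaluation.Along commutativeRing commutativeRing id id refl refl (λ _ _ → refl) (λ _ _ → refl)
  open HomogeneousForm commutativeRing
  open Exp semiring using (_^_; ^-congˡ)
  open Sum semiring using (sum; sum-cong-≋; *-distribˡ-sum; ∑-distrib-+)
  open Mult semiring using (×-homo-+)
  open Solver using (solve; _:+_; _:*_; _:=_; con)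
  open GammaValue ℝ commutativeRing id id refl refl (λ _ _ → refl) (λ _ _ → refl)
  open GammaCone ℝ

  private
    L X Q : Poly
    L = 1# ∷ 1# ∷ []
    X = 0# ∷ 1# ∷ []
    Q = 1# ∷ 0# ∷ 1# ∷ []

  abstract
    ev′-one : ∀ x → ev′ (1# ∷ []) x ≈ 0#
    ev′-one x = solve 1 (λ x → con (+ 0) :+ x :* con (+ 0) := con (+ 0)) refl x

    ev′-L : ∀ x → ev′ L x ≈ 1#
    ev′-L x = solve 1 (λ x → con (+ 1) :+ x :* con (+ 0) :+ x :* (con (+ 0) :+ x :* con (+ 0)) := con (+ 1)) refl x

    ev′-Q : ∀ x → ev′ Q x ≈ 2# * x
    ev′-Q x = solve 1 (λ x → con (+ 0) :+ x :* (con (+ 1) :+ x :* con (+ 0)) :+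
      x :* (con (+ 1) :+ x :* con (+ 0) :+ x :* (con (+ 0) :+ x :* con (+ 0))) := con (+ 2) :* x) refl x

    ev′-^ : ∀ p n x → ev′ (p ^ₚ suc n) x ≈ nat (suc n) * (ev p x ^ n * ev′ p x)
    ev′-^ p zero x = trans (ev′-* p (1# ∷ []) x) (trans (+-cong (*-congˡ (ev-one x)) (*-congˡ (ev′-one x)))
      (solve 2 (λ p p′ → p′ :* con (+ 1) :+ p :* con (+ 0) := (con (+ 1) :+ con (+ 0)) :* (con (+ 1) :* p′)) refl (ev p x) (ev′ p x)))
    ev′-^ p (suc n) x = trans (ev′-* p (p ^ₚ suc n) x) (trans (+-cong (*-congˡ (ev-^ p (suc n) x)) (*-congˡ (ev′-^ p n x)))
      (solve 4 (λ p p′ q n → p′ :* (p :* q) :+ p :* (n :* (q :* p′)) := (con (+ 1) :+ n) :* (p :* q :* p′)) refl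
        (ev p x) (ev′ p x) (ev p x ^ n) (nat (suc n))))

    ev′-X^ : ∀ j x → ev′ (X ^ₚ j) x ≈ DX j x
    ev′-X^ zero    x = ev′-one x
    ev′-X^ (suc j) x = trans (ev′-^ X j x) (*-congˡ (trans (*-cong (^-congˡ j (ev-x x)) (ev′-L x)) (*-identityʳ _)))

    ev′-Q^ : ∀ i x → ev′ (Q ^ₚ i) x ≈ 2# * x * DS i x
    ev′-Q^ zero    x = trans (ev′-one x) (sym (zeroʳ _))
    ev′-Q^ (suc i) x = trans (ev′-^ Q i x) (trans (*-congˡ (*-cong (^-congˡ i (ev-1+x² x)) (ev′-Q x)))
      (solve 3 (λ n y d → n :* (y :* d) := d :* (n :* y)) refl (nat (suc i)) (s x ^ i) (2# * x)))

    ev′-const : ∀ b x → ev′ (b ∷ []) x ≈ 0#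
    ev′-const b x = ev′-one x

  module _ (N : ℕ) (g : Fin (suc N) → Carrier) where
    private
      term : Fin (suc N) → Poly
      term k = (g k ∷ []) *ₚ X ^ₚ toℕ k *ₚ Q ^ₚ (N ℕ.∸ toℕ k)

    basis basis′ : Fin (suc N) → Carrier → Carrier
    basis  k x = x ^ toℕ k * s x ^ (N ℕ.∸ toℕ k)
    basis′ k x = DX (toℕ k) x * s x ^ (N ℕ.∸ toℕ k) + x ^ toℕ k * (2# * x * DS (N ℕ.∸ toℕ k) x)

    abstract
      ev-term : ∀ k x → ev (term k) x ≈ g k * basis k x
      ev-term k x = trans (ev-* ((g k ∷ []) *ₚ X ^ₚ toℕ k) (Q ^ₚ (N ℕ.∸ toℕ k)) x) (trans (*-cong
        (trans (ev-* (g k ∷ []) (X ^ₚ toℕ k) x) (*-cong (ev-const (g k) x)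
          (trans (ev-^ X (toℕ k) x) (^-congˡ (toℕ k) (ev-x x)))))
        (trans (ev-^ Q (N ℕ.∸ toℕ k) x) (^-congˡ (N ℕ.∸ toℕ k) (ev-1+x² x)))) (*-assoc _ _ _))

      ev′-term : ∀ k x → ev′ (term k) x ≈ g k * basis′ k x
      ev′-term k x = trans (ev′-* ((g k ∷ []) *ₚ X ^ₚ j) (Q ^ₚ i) x) (trans (+-cong
          (*-cong (trans (ev′-* (g k ∷ []) (X ^ₚ j) x) (+-cong (*-congʳ (ev′-const (g k) x)) (*-cong (ev-const (g k) x) (ev′-X^ j x))))
                  (trans (ev-^ Q i x) (^-congˡ i (ev-1+x² x))))
          (*-cong (trans (ev-* (g k ∷ []) (X ^ₚ j) x) (*-cong (ev-const (g k) x) (trans (ev-^ X j x) (^-congˡ j (ev-x x)))))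
                  (ev′-Q^ i x)))
          (solve 6 (λ g y d z w e → (con (+ 0) :* y :+ g :* d) :* z :+ g :* w :* e := g :* (d :* z :+ w :* e)) refl
            (g k) (ev (X ^ₚ j) x) (DX j x) (s x ^ i) (x ^ j) (2# * x * DS i x)))
        where
        j i : ℕ
        j = toℕ k
        i = N ℕ.∸ toℕ k

      combine : ∀ α β x → α * sum (λ k → ev (term k) x) + β * sum (λ k → ev′ (term k) x) ≈
                sum (λ k → g k * (α * basis k x + β * basis′ k x))
      combine α β x = trans (+-cong (*-distribˡ-sum {suc N} α (λ k → ev (term k) x)) (*-distribˡ-sum {suc N} β (λ k → ev′ (term k) x)))
        (trans (sym (∑-distrib-+ {suc N} (λ k → α * ev (term k) x) (λ k → β * ev′ (term k) x)))
          (sum-cong-≋ {suc N} λ k → trans (+-cong (*-congˡ (ev-term k x)) (*-congˡ (ev′-term k x)))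
            (solve 5 (λ α β g a b → α :* (g :* a) :+ β :* (g :* b) := g :* (α :* a :+ β :* b)) refl α β (g k) (basis k x) (basis′ k x))))

      nat-+ : ∀ m n → nat (m ℕ.+ n) ≈ nat m + nat n
      nat-+ m n = ×-homo-+ 1# m n

      split : ∀ (k : Fin (suc N)) → toℕ k ℕ.+ (N ℕ.∸ toℕ k) ≡ N
      split k = ℕ.m+[n∸m]≡n (ℕ.s≤s⁻¹ (Fin.toℕ<n k))

      nat-N : ∀ (k : Fin (suc N)) → nat N ≈ nat (toℕ k) + nat (N ℕ.∸ toℕ k)
      nat-N k = trans (reflexive (≡.cong nat (≡.sym (split k)))) (nat-+ (toℕ k) (N ℕ.∸ toℕ k))

      nat-2N : nat (2 ℕ.* N) ≈ 2# * nat N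
      nat-2N = trans (nat-+ N (N ℕ.+ 0)) (trans (+-congˡ (trans (nat-+ N 0) (+-identityʳ _)))
        (solve 1 (λ n → n :+ n := con (+ 2) :* n) refl (nat N)))

      module _ {M v e h : Carrier} (0≤v : 0# ≤ v) (0≤e : 0# ≤ e) (0≤h : 0# ≤ h) where
        -- In `even-identity` the term with B = DX j carries s C = (1 + x²)^(i+1), and the term with
        -- D = DS i carries x A = x^(j+1). This makes up for the exponent lost by differentiation,
        -- so the total stays N.
        even-basis : M ≈ nat (2 ℕ.* N ℕ.+ 0) → ∀ k → InCone N 1 (λ x → P M v e h x * basis k x + S M v e h x * basis′ k x)
        even-basis M≈ k = cone-cong
          (λ x → even-identity {M} {v} {e} {h} {x} {x ^ j} {DX j x} {s x ^ i} {DS i x} {nat j} {nat i} (x*DX j x) (s*DS i x) M≈2)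
          (cone-+ (cone-+
            (cone-* (0≤h 0≤+ inj₁ 0<2 0≤* 0≤nat i 0≤* (0≤e 0≤+ 0≤v)) (cone-basis j i (split k)))
            (cone-* (inj₁ 0<2 0≤* 0≤e 0≤+ 0≤v) (cone-DX j (suc i) (≡.trans (ℕ.+-suc j i) (≡.cong suc (split k))))))
            (cone-* (inj₁ 0<2 0≤* inj₁ 0<2 0≤* 0≤e) (cone-DS (suc j) i (≡.cong suc (split k)))))
          where
          j i : ℕ
          j = toℕ k
          i = N ℕ.∸ toℕ k
          M≈2 : M ≈ 2# * (nat j + nat i)
          M≈2 = trans M≈ (trans (nat-+ (2 ℕ.* N) 0) (trans (+-identityʳ _) (trans nat-2N (*-congˡ (nat-N k)))))

        odd-basis : M ≈ nat (2 ℕ.* N ℕ.+ 1) → ∀ k → InCone (suc N) 0 (λ x →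
          P M v e h x * ((1# + x) * basis k x) + S M v e h x * (basis k x + (1# + x) * basis′ k x))
        odd-basis M≈ k = cone-cong
          (λ x → odd-identity {M} {v} {e} {h} {x} {x ^ j} {DX j x} {s x ^ i} {DS i x} {nat j} {nat i} (x*DX j x) (s*DS i x) M≈2)
          (cone-+ (cone-+ (cone-+
            (cone-* (inj₁ 0<2 0≤* 0≤e 0≤+ 0≤v) (cone-DX j (suc (suc i))
              (≡.trans (ℕ.+-suc j (suc i)) (≡.cong suc (≡.trans (ℕ.+-suc j i) (≡.cong suc (split k)))))))
            (cone-* (0≤h 0≤+ inj₁ 0<2 0≤* (0≤nat j 0≤+ 0≤nat i 0≤+ 0≤1) 0≤* 0≤v 0≤+
                (inj₁ 0<2 0≤* (0≤nat j 0≤+ 0≤nat j) 0≤+ inj₁ 0<2 0≤* 0≤nat i 0≤+ inj₁ 0<2 0≤+ 0≤1) 0≤* 0≤e)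
              (cone-basis j (suc i) (≡.trans (ℕ.+-suc j i) (≡.cong suc (split k))))))
            (cone-* (inj₁ 0<2 0≤* 0≤h 0≤+ inj₁ 0<2 0≤* (inj₁ 0<2 0≤* 0≤nat i) 0≤* (inj₁ 0<2 0≤* 0≤e 0≤+ 0≤v) 0≤+ inj₁ 0<2 0≤* 0≤e)
              (cone-basis (suc j) i (≡.cong suc (split k)))))
            (cone-* (inj₁ 0<2 0≤* (inj₁ 0<2 0≤* inj₁ 0<2) 0≤* 0≤e) (cone-DS (suc (suc j)) i (≡.cong (λ n → suc (suc n)) (split k)))))
          where
          j i : ℕ
          j = toℕ k
          i = N ℕ.∸ toℕ k
          M≈2 : M ≈ 2# * (nat j + nat i) + 1#
          M≈2 = trans M≈ (trans (nat-+ (2 ℕ.* N) 1) (+-cong (trans nat-2N (*-congˡ (nat-N k))) (+-identityʳ 1#)))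

      module _ (0≤g : ∀ k → 0# ≤ g k) {M v e h : Carrier} (0≤v : 0# ≤ v) (0≤e : 0# ≤ e) (0≤h : 0# ≤ h)
        (p p₁ : Poly) (p₁≈ : ∀ x → ev p₁ x ≈ P M v e h x * ev p x + S M v e h x * ev′ p x) where
        even-step : M ≈ nat (2 ℕ.* N ℕ.+ 0) → p ≈ₚ gammaExpansion 0 N g → InCone N 1 (ev p₁)
        even-step M≈ p≈ = cone-cong (λ x → sym (trans (p₁≈ x) (trans (+-cong (*-congˡ (value x)) (*-congˡ (value′ x)))
            (combine (P M v e h x) (S M v e h x) x))))
          (cone-sum g _ 0≤g (even-basis 0≤v 0≤e 0≤h M≈))
          where
          value : ∀ x → ev p x ≈ sum (λ k → ev (term k) x)
          value x = trans (ev-cong p (gammaExpansion 0 N g) x p≈) (trans (ev-* (L ^ₚ 0) (sumₚ term) x)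
            (trans (*-cong (ev-one x) (ev-sum term x)) (*-identityˡ _)))
          value′ : ∀ x → ev′ p x ≈ sum (λ k → ev′ (term k) x)
          value′ x = trans (ev′-cong p (gammaExpansion 0 N g) x p≈) (trans (ev′-* (L ^ₚ 0) (sumₚ term) x)
            (trans (+-cong (*-congʳ (ev′-one x)) (*-cong (ev-one x) (ev′-sum term x)))
              (solve 2 (λ a b → con (+ 0) :* a :+ con (+ 1) :* b := b) refl (ev (sumₚ term) x) (sum (λ k → ev′ (term k) x)))))

        odd-step : M ≈ nat (2 ℕ.* N ℕ.+ 1) → p ≈ₚ gammaExpansion 1 N g → InCone (suc N) 0 (ev p₁)
        odd-step M≈ p≈ = cone-cong (λ x → sym (trans (p₁≈ x) (trans (+-cong (*-congˡ (value x)) (*-congˡ (value′ x)))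
            -- The product rule for (1 + x) q contributes S q as well, so `combine` is used with P
            -- (1 + x) + S and S (1 + x) in place of P and S.
            (trans (regroup (P M v e h x) (S M v e h x) (1# + x) _ _) (trans (combine _ _ x)
              (sum-cong-≋ {suc N} λ k → *-congˡ {g k} (regroup′ (P M v e h x) (S M v e h x) (1# + x) (basis k x) (basis′ k x))))))))
          (cone-sum g _ 0≤g (odd-basis 0≤v 0≤e 0≤h M≈))
          where
          regroup : ∀ P S l a b → P * (l * a) + S * (a + l * b) ≈ (P * l + S) * a + (S * l) * b
          regroup = solve 5 (λ P S l a b → P :* (l :* a) :+ S :* (a :+ l :* b) := (P :* l :+ S) :* a :+ (S :* l) :* b) refl
          regroup′ : ∀ P S l a b → (P * l + S) * a + (S * l) * b ≈ P * (l * a) + S * (a + l * b)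
          regroup′ P S l a b = sym (regroup P S l a b)
          ev-L¹ : ∀ x → ev (L ^ₚ 1) x ≈ 1# + x
          ev-L¹ x = trans (ev-^ L 1 x) (trans (*-identityʳ _) (ev-1+x x))
          ev′-L¹ : ∀ x → ev′ (L ^ₚ 1) x ≈ 1#
          ev′-L¹ x = trans (ev′-^ L 0 x) (trans (*-congˡ (*-congˡ (ev′-L x)))
            (solve 0 ((con (+ 1) :+ con (+ 0)) :* (con (+ 1) :* con (+ 1)) := con (+ 1)) refl))
          value : ∀ x → ev p x ≈ (1# + x) * sum (λ k → ev (term k) x)
          value x = trans (ev-cong p (gammaExpansion 1 N g) x p≈) (trans (ev-* (L ^ₚ 1) (sumₚ term) x)
            (*-cong (ev-L¹ x) (ev-sum term x)))
          value′ : ∀ x → ev′ p x ≈ sum (λ k → ev (term k) x) + (1# + x) * sum (λ k → ev′ (term k) x)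
          value′ x = trans (ev′-cong p (gammaExpansion 1 N g) x p≈) (trans (ev′-* (L ^ₚ 1) (sumₚ term) x)
            (+-cong (trans (*-cong (ev′-L¹ x) (ev-sum term x)) (*-identityˡ _)) (*-cong (ev-L¹ x) (ev′-sum term x))))

-- Symmetric polynomials through their values on the positive axis

module SymmetricPolynomials {c ℓ₁ ℓ₂} (ℝ : CompleteOrderedField c ℓ₁ ℓ₂) where
  open OrderedFieldProperties ℝ
  open RealAndComplex ℝ using (Poly; coeff; _+ₚ_; _*ₚ_; _≈ₚ_)
  open Evaluation.Along commutativeRing commutativeRing id id refl refl (λ _ _ → refl) (λ _ _ → refl)
  open HomogeneousForm commutativeRing
  open Exp semiring using (_^_)
  open Solver using (solve; _:+_; _:*_; _:-_; :-_; _:=_; con)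
  open GammaCone ℝ using (s)

  abstract
    bounded-on-unit : ∀ p → ∃[ M ] 0# ≤ M × (∀ x → x * x ≤ 1# → ev p x * ev p x ≤ M)
    bounded-on-unit []      = 0# , ≤-refl , λ x _ → inj₂ (zeroˡ 0#)
    bounded-on-unit (a ∷ p) = let
      M , 0≤M , bound = bounded-on-unit p
      in 2# * (a * a) + 2# * M , inj₁ 0<2 0≤* 0≤sq a 0≤+ inj₁ 0<2 0≤* 0≤M , λ x xx≤1 →
        ≤-by (0≤sq (a + - (x * ev p x)) 0≤+ inj₁ 0<2 0≤* (≤⇒0≤- xx≤1 0≤* 0≤sq (ev p x)) 0≤+ inj₁ 0<2 0≤* ≤⇒0≤- (bound x xx≤1))
          (solve 4 (λ a x q M → (a :+ x :* q) :* (a :+ x :* q) :+ ((a :- x :* q) :* (a :- x :* q) :+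
            con (+ 2) :* ((con (+ 1) :- x :* x) :* (q :* q)) :+ con (+ 2) :* (M :- q :* q)) :=
            con (+ 2) :* (a :* a) :+ con (+ 2) :* M) refl a x (ev p x) M)

    -- From a + t p(t) = 0 follows a² = t² p(t)² ≤ t M for 0 < t ≤ 1, hence a = 0; then x can be
    -- cancelled. Only positive x are used, since symmetry speaks only of points that have an
    -- inverse.
    vanishing : ∀ p → (∀ x → 0# < x → ev p x ≈ 0#) → ∀ k → coeff p k ≈ 0#
    vanishing []      _   k = refl
    vanishing (a ∷ p) p≈0 = λ { zero → a≈0 ; (suc k) → vanishing p q≈0 k }
      where
      tiny : ∀ {M} → 0# ≤ M → (∀ x → x * x ≤ 1# → ev p x * ev p x ≤ M) → ¬ 0# < a * a
      tiny {M} 0≤M bound 0<aa = go (small-multiple 0≤M 0<aa)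
        where
        go : ¬ (∃[ t ] 0# < t × t ≤ 1# × t * M < a * a)
        go (t , 0<t , t≤1 , tM<aa) = ≤⇒≯ (≤-respˡ aa≈ (≤-by
            (inj₁ 0<t 0≤* (≤⇒0≤- t≤1 0≤* 0≤sq (ev p t)) 0≤+ inj₁ 0<t 0≤* ≤⇒0≤- (bound t tt≤1))
            (solve 3 (λ t q M → t :* t :* (q :* q) :+ (t :* ((con (+ 1) :- t) :* (q :* q)) :+ t :* (M :- q :* q)) := t :* M)
              refl t (ev p t) M))) tM<aa
          where
          tt≤1 : t * t ≤ 1#
          tt≤1 = ≤-by (≤⇒0≤- t≤1 0≤* (0≤1 0≤+ inj₁ 0<t)) (solve 1 (λ t → t :* t :+ (con (+ 1) :- t) :* (con (+ 1) :+ t) := con (+ 1)) refl t)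
          a≈ : a ≈ - (t * ev p t)
          a≈ = trans (solve 2 (λ a y → a := a :+ y :- y) refl a (t * ev p t)) (trans (+-congʳ (p≈0 t 0<t)) (+-identityˡ _))
          aa≈ : t * t * (ev p t * ev p t) ≈ a * a
          aa≈ = trans (solve 2 (λ t q → t :* t :* (q :* q) := :- (t :* q) :* :- (t :* q)) refl t (ev p t)) (sym (*-cong a≈ a≈))

      a≈0 : a ≈ 0#
      a≈0 = ≈-stable λ a≉0 → tiny (proj₁ (proj₂ (bounded-on-unit p))) (proj₂ (proj₂ (bounded-on-unit p))) (0<sq a≉0)

      q≈0 : ∀ x → 0# < x → ev p x ≈ 0#
      q≈0 x 0<x = *-≉0 (trans (trans (sym (+-identityˡ _)) (+-congʳ (sym a≈0))) (p≈0 x 0<x)) (0<⇒≉0 0<x)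

    coeff-+ : ∀ p q k → coeff (p +ₚ q) k ≈ coeff p k + coeff q k
    coeff-+ []      q       k       = sym (+-identityˡ _)
    coeff-+ (a ∷ p) []      k       = sym (+-identityʳ _)
    coeff-+ (a ∷ p) (b ∷ q) zero    = refl
    coeff-+ (a ∷ p) (b ∷ q) (suc k) = coeff-+ p q k

    coeff-scale : ∀ a p k → coeff (map (a *_) p) k ≈ a * coeff p k
    coeff-scale a []      k       = sym (zeroʳ a)
    coeff-scale a (b ∷ p) zero    = refl
    coeff-scale a (b ∷ p) (suc k) = coeff-scale a p k

    ≈ₚ-from-values : ∀ p q → (∀ x → 0# < x → ev p x ≈ ev q x) → p ≈ₚ q
    ≈ₚ-from-values p q eq k = trans (solve 2 (λ a b → a := (a :+ :- con (+ 1) :* b) :+ b) refl (coeff p k) (coeff q k))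
      (trans (+-congʳ (trans (sym (trans (coeff-+ p (map (- 1# *_) q) k) (+-congˡ (coeff-scale (- 1#) q k))))
        (vanishing (p +ₚ map (- 1# *_) q) (λ x 0<x → trans (ev-+ p (map (- 1# *_) q) x)
          (trans (+-cong (eq x 0<x) (ev-scale (- 1#) q x)) (solve 1 (λ a → a :+ :- con (+ 1) :* a := con (+ 0)) refl (ev q x)))) k)))
        (+-identityˡ _))

    coeff-0 : ∀ p → ev p 0# ≈ coeff p 0
    coeff-0 []      = refl
    coeff-0 (a ∷ p) = trans (+-congˡ (zeroˡ _)) (+-identityʳ a)

    take-≈ₚ : ∀ n p → (∀ k → n ℕ.≤ k → coeff p k ≈ 0#) → take n p ≈ₚ p
    take-≈ₚ zero    p       e k       = sym (e k ℕ.z≤n)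
    take-≈ₚ (suc n) []      e k       = refl
    take-≈ₚ (suc n) (a ∷ p) e zero    = refl
    take-≈ₚ (suc n) (a ∷ p) e (suc k) = take-≈ₚ n p (λ k n≤k → e (suc k) (ℕ.s≤s n≤k)) k

    coeff-beyond : ∀ p k → length p ℕ.≤ k → coeff p k ≈ 0#
    coeff-beyond []      k       _         = refl
    coeff-beyond (a ∷ p) (suc k) (ℕ.s≤s l) = coeff-beyond p k l

    length-take : ∀ n (p : Poly) → length (take n p) ℕ.≤ n
    length-take n p = ℕ.≤-trans (ℕ.≤-reflexive (List.length-take n p)) (ℕ.m⊓n≤m n (length p))

    length-+ : ∀ p q {n} → length p ℕ.≤ n → length q ℕ.≤ n → length (p +ₚ q) ℕ.≤ n
    length-+ []      q       _         m         = m
    length-+ (a ∷ p) []      l         _         = l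
    length-+ (a ∷ p) (b ∷ q) (ℕ.s≤s l) (ℕ.s≤s m) = ℕ.s≤s (length-+ p q l m)

    length-* : ∀ p q {m n} → length p ℕ.≤ m → length q ℕ.≤ suc n → length (p *ₚ q) ℕ.≤ m ℕ.+ n
    length-* []      q         _         _ = ℕ.z≤n
    length-* (a ∷ p) q {n = n} (ℕ.s≤s {n = m} l) k = length-+ (map (a *_) q) _
      (ℕ.≤-trans (ℕ.≤-reflexive (List.length-map (a *_) q)) (ℕ.≤-trans k (ℕ.s≤s (ℕ.m≤n+m n m))))
      (ℕ.s≤s (length-* p q l k))

  SymmetricValues : ℕ → Poly → Set _
  SymmetricValues d f = ∀ x y → x * y ≈ 1# → ev f x ≈ x ^ d * ev f y

  tail : Poly → Poly
  tail []      = []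
  tail (a ∷ p) = p

  -- The coefficients of x^d f(1/x). Reading by `coeff` pads f with zeros, so the result has length
  -- d + 1 for every list.
  reverse : ℕ → Poly → Poly
  reverse zero    f = coeff f 0 ∷ []
  reverse (suc d) f = reverse d (tail f) ∷ʳ coeff f 0

  abstract
    length-reverse : ∀ d f → length (reverse d f) ≡ suc d
    length-reverse zero    f = ≡.refl
    length-reverse (suc d) f = ≡.trans (List.length-++ (reverse d (tail f)))
      (≡.trans (ℕ.+-comm _ 1) (≡.cong suc (length-reverse d (tail f))))

    coeff-tail : ∀ f k → coeff (tail f) k ≡ coeff f (suc k)
    coeff-tail []      k = ≡.refl
    coeff-tail (a ∷ f) k = ≡.refl

    coeff-reverse : ∀ d f → coeff (reverse d f) 0 ≡ coeff f d
    coeff-reverse zero    f = ≡.refl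
    coeff-reverse (suc d) f = ≡.trans (first d (tail f) (coeff f 0)) (≡.trans (coeff-reverse d (tail f)) (coeff-tail f d))
      where
      first-∷ʳ : ∀ p a b → coeff ((p ∷ʳ a) ∷ʳ b) 0 ≡ coeff (p ∷ʳ a) 0
      first-∷ʳ []      a b = ≡.refl
      first-∷ʳ (_ ∷ _) a b = ≡.refl
      first : ∀ d f b → coeff (reverse d f ∷ʳ b) 0 ≡ coeff (reverse d f) 0
      first zero    f b = ≡.refl
      first (suc d) f b = first-∷ʳ (reverse d (tail f)) (coeff f 0) b

    ev-reverse : ∀ d f x y → x * y ≈ 1# → length f ℕ.≤ suc d → ev (reverse d f) x ≈ x ^ d * ev f y
    ev-reverse zero [] x y _ _ = solve 1 (λ x → con (+ 0) :+ x :* con (+ 0) := con (+ 1) :* con (+ 0)) refl x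
    ev-reverse zero (a ∷ []) x y _ _ =
      solve 3 (λ a x y → a :+ x :* con (+ 0) := con (+ 1) :* (a :+ y :* con (+ 0))) refl a x y
    ev-reverse zero (a ∷ b ∷ f) x y _ (ℕ.s≤s ())
    ev-reverse (suc d) f x y xy≈1 l = trans (ev-∷ʳ (reverse d (tail f)) (coeff f 0) x)
      (trans (+-cong (ev-reverse d (tail f) x y xy≈1 (length-tail f l)) (*-congʳ (reflexive (≡.cong (x ^_) (length-reverse d (tail f))))))
        (last f))
      where
      length-tail : ∀ f → length f ℕ.≤ suc (suc d) → length (tail f) ℕ.≤ suc d
      length-tail []      _         = ℕ.z≤n
      length-tail (a ∷ f) (ℕ.s≤s l) = l
      last : ∀ f → x ^ d * ev (tail f) y + x ^ suc d * coeff f 0 ≈ x ^ suc d * ev f y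
      last []      = solve 2 (λ x z → z :* con (+ 0) :+ x :* z :* con (+ 0) := x :* z :* con (+ 0)) refl x (x ^ d)
      last (a ∷ f) = trans (+-congʳ (trans (solve 2 (λ z f → z :* f := z :* f :* con (+ 1)) refl (x ^ d) (ev f y)) (*-congˡ (sym xy≈1))))
        (solve 5 (λ x y z f a → z :* f :* (x :* y) :+ x :* z :* a := x :* z :* (a :+ y :* f)) refl x y (x ^ d) (ev f y) a)

    -- Symmetry says that f and its reversal agree at positive points, hence coefficientwise; the
    -- constant terms are then compared.
    extreme-coefficients : ∀ d f → length f ℕ.≤ suc d → SymmetricValues d f → coeff f d ≈ coeff f 0
    extreme-coefficients d f l symm = trans (reflexive (≡.sym (coeff-reverse d f)))
      (≈ₚ-from-values (reverse d f) f (λ x 0<x → by-inverse x (positive-inverse 0<x)) 0)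
      where
      by-inverse : ∀ x → ∃[ y ] 0# < y × x * y ≈ 1# → ev (reverse d f) x ≈ ev f x
      by-inverse x (y , _ , xy≈1) = trans (ev-reverse d f x y xy≈1 l) (sym (symm x y xy≈1))

  -- 2 N + ν, in the form that matches the recursion of form
  degree : ℕ → Fin 2 → ℕ
  degree zero    ν = toℕ ν
  degree (suc N) ν = suc (suc (degree N ν))

  gammaValue : ∀ N → Fin 2 → (Fin (suc N) → Carrier) → Carrier → Carrier
  gammaValue N ν g x = (1# + x) ^ toℕ ν * form N g x (s x)

  abstract
    degree-≡ : ∀ N ν → degree N ν ≡ 2 ℕ.* N ℕ.+ toℕ ν
    degree-≡ zero    ν = ≡.refl
    degree-≡ (suc N) ν = ≡.cong suc (≡.trans (≡.cong suc (degree-≡ N ν)) (≡.cong (ℕ._+ toℕ ν) (≡.sym (ℕ.+-suc N (N ℕ.+ 0)))))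

    -- Each of 1 + x, x and 1 + x² equals x^k times its own value at 1/x, with k = 1, 2, 2. All
    -- terms of the expansion thus have the same weight.
    gammaValue-symmetric : ∀ N ν g x y → x * y ≈ 1# → gammaValue N ν g x ≈ x ^ degree N ν * gammaValue N ν g y
    gammaValue-symmetric N ν g x y xy≈1 = trans (*-cong (linear ν) (homogeneous N g))
        (trans (solve 4 (λ a b c d → (a :* b) :* (c :* d) := (c :* a) :* (b :* d)) refl
          (x ^ toℕ ν) ((1# + y) ^ toℕ ν) (xx N) (form N g y (s y))) (*-congʳ (exponent N)))
      where
      -- `xx N` is x^(2N), built in steps of two to match `degree`.
      xx : ℕ → Carrier
      xx zero    = 1#
      xx (suc N) = x * (x * xx N)

      exponent : ∀ N → xx N * x ^ toℕ ν ≈ x ^ degree N ν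
      exponent zero    = *-identityˡ _
      exponent (suc N) = trans (solve 3 (λ x a b → x :* (x :* a) :* b := x :* (x :* (a :* b))) refl x (xx N) (x ^ toℕ ν))
        (*-congˡ (*-congˡ (exponent N)))

      linear : ∀ (ν : Fin 2) → (1# + x) ^ toℕ ν ≈ x ^ toℕ ν * (1# + y) ^ toℕ ν
      linear zero       = sym (*-identityˡ 1#)
      linear (suc zero) = trans (*-congʳ (+-congʳ (sym xy≈1)))
        (solve 2 (λ x y → (x :* y :+ x) :* con (+ 1) := x :* con (+ 1) :* ((con (+ 1) :+ y) :* con (+ 1))) refl x y)

      s≈ : s x ≈ x * x * s y
      s≈ = trans (solve 1 (λ x → con (+ 1) :+ x :* x := con (+ 1) :* con (+ 1) :+ x :* x) refl x)
        (trans (+-congʳ (sym (*-cong xy≈1 xy≈1)))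
          (solve 2 (λ x y → x :* y :* (x :* y) :+ x :* x := x :* x :* (con (+ 1) :+ y :* y)) refl x y))

      power-s : ∀ n → s x ^ n ≈ xx n * s y ^ n
      power-s zero    = sym (*-identityˡ 1#)
      power-s (suc n) = trans (*-cong s≈ (power-s n))
        (solve 4 (λ x a b c → x :* x :* a :* (b :* c) := x :* (x :* b) :* (a :* c)) refl x (s y) (xx n) (s y ^ n))

      homogeneous : ∀ N g → form N g x (s x) ≈ xx N * form N g y (s y)
      homogeneous zero    g = sym (*-identityˡ _)
      homogeneous (suc N) g = trans (+-cong (*-congˡ (power-s (suc N)))
          (trans (*-congˡ (homogeneous N (g ∘ suc))) (trans (sym (*-identityʳ _)) (*-congˡ (sym xy≈1)))))
        (solve 6 (λ x y g a b f → g :* (x :* (x :* a) :* b) :+ x :* (a :* f) :* (x :* y) :=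
          x :* (x :* a) :* (g :* b :+ y :* f)) refl x y (g zero) (xx N) (s y ^ suc N) (form N (g ∘ suc) y (s y)))

-- Every symmetric polynomial has a γ-expansion

module GammaExpansionExists {c ℓ₁ ℓ₂} (ℝ : CompleteOrderedField c ℓ₁ ℓ₂) where
  open OrderedFieldProperties ℝ
  open RealAndComplex ℝ using (Poly; coeff; _+ₚ_; _*ₚ_; _≈ₚ_)
  open Evaluation.Along commutativeRing commutativeRing id id refl refl (λ _ _ → refl) (λ _ _ → refl)
  open HomogeneousForm commutativeRing
  open Exp semiring using (_^_; ^-congˡ)
  open Solver using (solve; _:+_; _:*_; _:-_; :-_; _:=_; con)
  open GammaValue ℝ commutativeRing id id refl refl (λ _ _ → refl) (λ _ _ → refl)
  open GammaCone ℝ using (s)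
  open SymmetricPolynomials ℝ

  -- The basis element (1 + x)^ν (1 + x²)^N for k = 0, built so that the length of its list is under
  -- control.
  leading : ℕ → Fin 2 → Poly
  leading zero    zero       = 1# ∷ []
  leading zero    (suc zero) = 1# ∷ 1# ∷ []
  leading (suc N) ν          = (1# ∷ 0# ∷ 1# ∷ []) *ₚ leading N ν

  abstract
    length-leading : ∀ N ν → length (leading N ν) ℕ.≤ suc (degree N ν)
    length-leading zero    zero       = ℕ.≤-refl
    length-leading zero    (suc zero) = ℕ.≤-refl
    length-leading (suc N) ν          = length-* (1# ∷ 0# ∷ 1# ∷ []) (leading N ν) ℕ.≤-refl (length-leading N ν)

    ev-leading : ∀ N ν x → ev (leading N ν) x ≈ (1# + x) ^ toℕ ν * s x ^ N
    ev-leading zero    zero       x = trans (ev-one x) (sym (*-identityˡ 1#))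
    ev-leading zero    (suc zero) x = trans (ev-1+x x) (solve 1 (λ y → y := y :* con (+ 1) :* con (+ 1)) refl (1# + x))
    ev-leading (suc N) ν          x = trans (ev-* (1# ∷ 0# ∷ 1# ∷ []) (leading N ν) x)
      (trans (*-cong (ev-1+x² x) (ev-leading N ν x))
        (solve 3 (λ s l y → s :* (l :* y) := l :* (s :* y)) refl (s x) ((1# + x) ^ toℕ ν) (s x ^ N)))

    leading-symmetric : ∀ N ν → SymmetricValues (degree N ν) (leading N ν)
    leading-symmetric N ν x y xy≈1 = trans (as-gamma x) (trans (gammaValue-symmetric N ν (unit N 0) x y xy≈1) (*-congˡ (sym (as-gamma y))))
      where
      as-gamma : ∀ x → ev (leading N ν) x ≈ gammaValue N ν (unit N 0) x
      as-gamma x = trans (ev-leading N ν x) (*-congˡ (trans (sym (*-identityˡ _)) (sym (form-unit 0 N x (s x)))))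

    1^ : ∀ n → 1# ^ n ≈ 1#
    1^ zero    = refl
    1^ (suc n) = trans (*-identityˡ _) (1^ n)

    s0≈1 : s 0# ≈ 1#
    s0≈1 = solve 0 (con (+ 1) :+ con (+ 0) :* con (+ 0) := con (+ 1)) refl

    gammaValue-0 : ∀ N ν g → gammaValue N ν g 0# ≈ g zero
    gammaValue-0 N ν g = trans (*-cong (trans (^-congˡ (toℕ ν) (+-identityʳ 1#)) (1^ (toℕ ν))) (form-at-0 N g)) (*-identityˡ _)
      where
      form-at-0 : ∀ N g → form N g 0# (s 0#) ≈ g zero
      form-at-0 zero    g = refl
      form-at-0 (suc N) g = trans (+-cong (*-congˡ (trans (^-congˡ (suc N) s0≈1) (1^ (suc N)))) (zeroˡ _))
        (solve 1 (λ g → g :* con (+ 1) :+ con (+ 0) := g) refl (g zero))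

    leading-0 : ∀ N ν → ev (leading N ν) 0# ≈ 1#
    leading-0 N ν = trans (ev-leading N ν 0#) (trans (*-cong
      (trans (^-congˡ (toℕ ν) (+-identityʳ 1#)) (1^ (toℕ ν))) (trans (^-congˡ N s0≈1) (1^ N))) (*-identityˡ 1#))

    ev-tail : ∀ f x → coeff f 0 ≈ 0# → ev f x ≈ x * ev (tail f) x
    ev-tail []      x _   = sym (zeroʳ x)
    ev-tail (a ∷ f) x a≈0 = trans (+-congʳ a≈0) (+-identityˡ _)

    SymmetricValues-≈ : ∀ {d f f′} → (∀ x → ev f x ≈ ev f′ x) → SymmetricValues d f → SymmetricValues d f′
    SymmetricValues-≈ e symm x y xy≈1 = trans (sym (e x)) (trans (symm x y xy≈1) (*-congˡ (e y)))

    SymmetricValues-tail : ∀ d f → coeff f 0 ≈ 0# → SymmetricValues (suc (suc d)) f → SymmetricValues d (tail f)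
    SymmetricValues-tail d f f₀≈0 symm x y xy≈1 = begin
      ev (tail f) x                        ≈⟨ trans (sym (*-identityˡ _)) (*-congʳ (sym xy≈1)) ⟩
      x * y * ev (tail f) x                ≈⟨ solve 3 (λ x y f → x :* y :* f := y :* (x :* f)) refl x y (ev (tail f) x) ⟩
      y * (x * ev (tail f) x)              ≈⟨ *-congˡ (sym (ev-tail f x f₀≈0)) ⟩
      y * ev f x                           ≈⟨ *-congˡ (symm x y xy≈1) ⟩
      y * (x ^ suc (suc d) * ev f y)       ≈⟨ *-congˡ (*-congˡ (ev-tail f y f₀≈0)) ⟩
      y * (x * (x * x ^ d) * (y * ev (tail f) y))
        ≈⟨ solve 4 (λ x y z f → y :* (x :* (x :* z) :* (y :* f)) := x :* y :* (x :* y) :* (z :* f)) refl x y (x ^ d) (ev (tail f) y) ⟩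
      x * y * (x * y) * (x ^ d * ev (tail f) y)  ≈⟨ *-congʳ (*-cong xy≈1 xy≈1) ⟩
      1# * 1# * (x ^ d * ev (tail f) y)    ≈⟨ trans (*-congʳ (*-identityˡ 1#)) (*-identityˡ _) ⟩
      x ^ d * ev (tail f) y                ∎
      where open import Relation.Binary.Reasoning.Setoid setoid

    -- Subtracting f(0) times `leading` removes the constant term and, by symmetry, the top one.
    -- Dividing by x then leaves a symmetric polynomial of degree two less, which supplies the
    -- remaining coefficients.
    expansion : ∀ N ν f → length f ℕ.≤ suc (degree N ν) → SymmetricValues (degree N ν) f →
                ∃[ g ] (∀ x → ev f x ≈ gammaValue N ν g x)
    expansion zero zero f l symm = (λ _ → coeff f 0) , λ x → constant f l x
      where
      constant : ∀ f → length f ℕ.≤ 1 → ∀ x → ev f x ≈ 1# * coeff f 0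
      constant []           _            x = sym (zeroʳ 1#)
      constant (a ∷ [])     _            x = solve 2 (λ a x → a :+ x :* con (+ 0) := con (+ 1) :* a) refl a x
      constant (a ∷ b ∷ f) (ℕ.s≤s ()) x
    expansion zero (suc zero) f l symm = (λ _ → coeff f 0) , λ x → trans (affine f l x)
        (trans (+-congˡ (*-congˡ (extreme-coefficients 1 f l symm)))
          (solve 2 (λ a x → a :+ x :* a := (con (+ 1) :+ x) :* con (+ 1) :* a) refl (coeff f 0) x))
      where
      affine : ∀ f → length f ℕ.≤ 2 → ∀ x → ev f x ≈ coeff f 0 + x * coeff f 1
      affine []               _ x = solve 1 (λ x → con (+ 0) := con (+ 0) :+ x :* con (+ 0)) refl x
      affine (a ∷ [])         _ x = refl
      affine (a ∷ b ∷ [])     _ x = solve 3 (λ a b x → a :+ x :* (b :+ x :* con (+ 0)) := a :+ x :* b) refl a b x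
      affine (a ∷ b ∷ _ ∷ f) (ℕ.s≤s (ℕ.s≤s ())) x
    expansion (suc N) ν f l symm = go (expansion N ν h (length-take _ (tail f₂)) h-symmetric)
      where
      d : ℕ
      d = degree N ν
      b f₂ h : Poly
      b  = leading (suc N) ν
      f₂ = f +ₚ map ((- coeff f 0) *_) b
      -- The list `tail f₂` may be one entry too long. That entry is the top coefficient of `f₂`,
      -- which vanishes along with the constant one.
      h  = take (suc d) (tail f₂)

      ev-f₂ : ∀ x → ev f₂ x ≈ ev f x + - coeff f 0 * ev b x
      ev-f₂ x = trans (ev-+ f (map ((- coeff f 0) *_) b) x) (+-congˡ (ev-scale (- coeff f 0) b x))

      f₂-symmetric : SymmetricValues (suc (suc d)) f₂
      f₂-symmetric x y xy≈1 = trans (ev-f₂ x) (trans (+-cong (symm x y xy≈1) (*-congˡ (leading-symmetric (suc N) ν x y xy≈1)))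
        (trans (solve 4 (λ z f a b → z :* f :+ a :* (z :* b) := z :* (f :+ a :* b)) refl (x ^ suc (suc d)) (ev f y) (- coeff f 0) (ev b y))
          (*-congˡ (sym (ev-f₂ y)))))

      f₂-0 : coeff f₂ 0 ≈ 0#
      f₂-0 = trans (sym (coeff-0 f₂)) (trans (ev-f₂ 0#) (trans (+-cong (coeff-0 f) (*-congˡ (leading-0 (suc N) ν)))
        (solve 1 (λ a → a :+ :- a :* con (+ 1) := con (+ 0)) refl (coeff f 0))))

      length-f₂ : length f₂ ℕ.≤ suc (suc (suc d))
      length-f₂ = length-+ f _ l (ℕ.≤-trans (ℕ.≤-reflexive (List.length-map _ b)) (length-leading (suc N) ν))

      h≈ : h ≈ₚ tail f₂
      h≈ = take-≈ₚ (suc d) (tail f₂) λ k d<k → trans (reflexive (coeff-tail f₂ k)) (beyond k d<k)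
        where
        beyond : ∀ k → suc d ℕ.≤ k → coeff f₂ (suc k) ≈ 0#
        beyond k d<k with ℕ.m≤n⇒m<n∨m≡n d<k
        ... | inj₁ d+1<k   = coeff-beyond f₂ (suc k) (ℕ.≤-trans length-f₂ (ℕ.s≤s d+1<k))
        ... | inj₂ ≡.refl = trans (extreme-coefficients (suc (suc d)) f₂ length-f₂ f₂-symmetric) f₂-0

      h-symmetric : SymmetricValues d h
      h-symmetric = SymmetricValues-≈ {d} {tail f₂} {h} (λ x → sym (ev-cong h (tail f₂) x h≈)) (SymmetricValues-tail d f₂ f₂-0 f₂-symmetric)

      go : ∃[ g ] (∀ x → ev h x ≈ gammaValue N ν g x) → ∃[ g ] (∀ x → ev f x ≈ gammaValue (suc N) ν g x)
      go (g , h-eq) = (λ { zero → coeff f 0 ; (suc k) → g k }) , λ x → begin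
        ev f x
          ≈⟨ solve 3 (λ f a b → f := a :* b :+ (f :+ :- a :* b)) refl (ev f x) (coeff f 0) (ev b x) ⟩
        coeff f 0 * ev b x + (ev f x + - coeff f 0 * ev b x)
          ≈⟨ +-cong (*-congˡ (ev-leading (suc N) ν x)) (trans (sym (ev-f₂ x)) (trans (ev-tail f₂ x f₂-0)
               (*-congˡ (trans (sym (ev-cong h (tail f₂) x h≈)) (h-eq x))))) ⟩
        coeff f 0 * ((1# + x) ^ toℕ ν * s x ^ suc N) + x * gammaValue N ν g x
          ≈⟨ solve 5 (λ a l y x f → a :* (l :* y) :+ x :* (l :* f) := l :* (a :* y :+ x :* f)) refl
               (coeff f 0) ((1# + x) ^ toℕ ν) (s x ^ suc N) x (form N g x (s x)) ⟩
        (1# + x) ^ toℕ ν * (coeff f 0 * s x ^ suc N + x * form N g x (s x)) ∎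
        where open import Relation.Binary.Reasoning.Setoid setoid

-- Real stable polynomials and the γ-positivity of the initial polynomial

module RealStablePolynomials {c ℓ₁ ℓ₂} (ℝ : CompleteOrderedField c ℓ₁ ℓ₂) where
  open OrderedFieldProperties ℝ
  open ComplexNumbers ℝ
  open RealAndComplex ℝ using (gammaExpansion; Poly; coeff; _≈ₚ_; scaleFrom; derivative; IsSymmetric)
  open Solver using (solve; _:+_; _:*_; _:-_; :-_; _:=_; con)
  private
    module C = ℂ-Ring
    module S = ℂ-Solver
    module Cx = ComplexPolynomials ℝ
    module FTA = FundamentalTheoremOfAlgebra ℝ
    module Lg = Laguerre ℝ
    module Hc = HomogeneousForm ℂ-commutativeRing
  module Rl = Evaluation.Along commutativeRing commutativeRing id id refl refl (λ _ _ → refl) (λ _ _ → refl)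
  module Rc = Evaluation.Along commutativeRing ℂ-commutativeRing ι (λ e → e , refl) C.refl C.refl ι-+ ι-*
  module Γr = GammaValue ℝ commutativeRing id id refl refl (λ _ _ → refl) (λ _ _ → refl)
  module Γc = GammaValue ℝ ℂ-commutativeRing ι (λ e → e , refl) C.refl C.refl ι-+ ι-*
  open Exp C.semiring using () renaming (_^_ to _^ᶜ_)
  open GammaCone ℝ using (InCone; cone)
  open SymmetricPolynomials ℝ
  open GammaExpansionExists ℝ

  Stableᴿ : Poly → Set _
  Stableᴿ p = ∀ z → 0# < re z → ¬ Rc.ev p z ≈ᶜ 0ᶜ

  abstract
    ev-map-ι : ∀ p z → Cx.ev (map ι p) z ≡ Rc.ev p z
    ev-map-ι []      z = ≡.refl
    ev-map-ι (a ∷ p) z = ≡.cong (λ v → ι a +ᶜ z *ᶜ v) (ev-map-ι p z)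

    ev′-map-ι : ∀ p z → Cx.ev′ (map ι p) z ≡ Rc.ev′ p z
    ev′-map-ι []      z = ≡.refl
    ev′-map-ι (a ∷ p) z = ≡.cong₂ (λ u v → u +ᶜ z *ᶜ v) (ev-map-ι p z) (ev′-map-ι p z)

    ι-affine : ∀ a x {z b} → z ≈ᶜ ι b → ι a +ᶜ ι x *ᶜ z ≈ᶜ ι (a + x * b)
    ι-affine a x {b = b} z≈ = C.trans (C.+-congˡ {x = ι a} (C.trans (C.*-congˡ {x = ι x} z≈) (C.sym (ι-* x b)))) (C.sym (ι-+ a (x * b)))

    ev-real : ∀ p x → Rc.ev p (ι x) ≈ᶜ ι (Rl.ev p x)
    ev-real []      x = C.refl
    ev-real (a ∷ p) x = ι-affine a x (ev-real p x)

    ev′-real : ∀ p x → Rc.ev′ p (ι x) ≈ᶜ ι (Rl.ev′ p x)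
    ev′-real []      x = C.refl
    ev′-real (a ∷ p) x = C.trans (C.+-congʳ (ev-real p x)) (ι-affine (Rl.ev p x) x (ev′-real p x))

    map-lead : ∀ {d p} → HasLead (λ a → ¬ a ≈ 0#) d p → Cx.Leadᶜ d (map ι p)
    map-lead [ a≉0 ]     = [ (λ e → a≉0 (proj₁ e)) ]
    map-lead (a ∷ lead)  = ι a ∷ map-lead lead

    map-stable : ∀ {p} → Stableᴿ p → Lg.Stable (map ι p)
    map-stable {p} stable z 0<x e = stable z 0<x (C.trans (C.reflexive (≡.sym (ev-map-ι p z))) e)

    laguerreᴿ : ∀ {d p} → HasLead (λ a → ¬ a ≈ 0#) d p → Stableᴿ p → ∀ z → 0# < re z →
      re z * normSq (Rc.ev′ p z) ≤ nat d * (Rc.ev′ p z ∙ Rc.ev p z)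
    laguerreᴿ {d} {p} lead stable z 0<x = ≡.subst₂ (λ u v → re z * normSq u ≤ nat d * (u ∙ v)) (ev′-map-ι p z) (ev-map-ι p z)
      (Lg.laguerre d (map-lead lead) (map-stable {p} stable) z 0<x)

    gauss-lucasᴿ : ∀ {d p} → HasLead (λ a → ¬ a ≈ 0#) (suc d) p → Stableᴿ p → ∀ z → 0# < re z →
      0# < Rc.ev′ p z ∙ Rc.ev p z
    gauss-lucasᴿ {d} {p} lead stable z 0<x = ≡.subst₂ (λ u v → 0# < u ∙ v) (ev′-map-ι p z) (ev-map-ι p z)
      (Lg.gauss-lucas d (map-lead lead) (map-stable {p} stable) z 0<x)

    positive⇒nonzero : ∀ {d p} → HasLead (0# <_) d p → HasLead (λ a → ¬ a ≈ 0#) d p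
    positive⇒nonzero [ 0<a ]    = [ 0<⇒≉0 0<a ]
    positive⇒nonzero (a ∷ lead) = a ∷ positive⇒nonzero lead

    scaleFrom-lead : ∀ {d p} k → HasLead (0# <_) d p → HasLead (0# <_) d (scaleFrom (suc k) p)
    scaleFrom-lead k [ 0<a ]    = [ <-respʳ (sym (·≈* (suc k) _)) (0<nat k 0<* 0<a) ]
    scaleFrom-lead k (a ∷ lead) = _ ∷ scaleFrom-lead (suc k) lead

    scaleFrom-nonneg : ∀ k p → All (0# ≤_) (scaleFrom (suc k) p) → All (0# ≤_) p
    scaleFrom-nonneg k []      _        = []
    scaleFrom-nonneg k (a ∷ p) (h ∷ hs) =
      *-cancel-0≤ (0<nat k) (≤-respʳ (·≈* (suc k) a) h) ∷ scaleFrom-nonneg (suc k) p hs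

    ev-nonneg : ∀ {p} → All (0# ≤_) p → ∀ {x} → 0# ≤ x → 0# ≤ Rl.ev p x
    ev-nonneg []       0≤x = ≤-refl
    ev-nonneg (h ∷ hs) 0≤x = h 0≤+ 0≤x 0≤* ev-nonneg hs 0≤x

    ev′-nonneg : ∀ {p} → All (0# ≤_) p → ∀ a {x} → 0# ≤ x → 0# ≤ Rl.ev′ (a ∷ p) x
    ev′-nonneg []               a 0≤x = ≤-refl 0≤+ 0≤x 0≤* ≤-refl
    ev′-nonneg {b ∷ p} (h ∷ hs) a 0≤x = ev-nonneg (h ∷ hs) 0≤x 0≤+ 0≤x 0≤* ev′-nonneg hs b 0≤x

    ev-monotone : ∀ {p} → All (0# ≤_) p → ∀ {x y} → 0# ≤ x → x ≤ y → Rl.ev p x ≤ Rl.ev p y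
    ev-monotone []       0≤x x≤y = ≤-refl
    ev-monotone (h ∷ hs) 0≤x x≤y = +-mono-≤ ≤-refl (*-mono-≤ 0≤x x≤y (ev-nonneg hs 0≤x) (ev-monotone hs 0≤x x≤y))

    -- If a were negative, then a + t p(t) ≤ a + t p(1) < 0 for small t ≤ 1, since p is monotone on
    -- the nonnegative axis.
    constant-nonneg : ∀ {a p} → All (0# ≤_) p → (∀ x → 0# < x → 0# < Rl.ev (a ∷ p) x) → 0# ≤ a
    constant-nonneg {a} {p} hs positive = ≮⇒≥ λ a<0 → go (small-multiple (ev-nonneg hs 0≤1) (0<neg a<0))
      where
      go : ¬ (∃[ t ] 0# < t × t ≤ 1# × t * Rl.ev p 1# < - a)
      go (t , 0<t , t≤1 , small) = ≤⇒≯ (≤-by (inj₁ (<⇒0<- small) 0≤+ inj₁ 0<t 0≤* ≤⇒0≤- (ev-monotone hs (inj₁ 0<t) t≤1))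
        (solve 4 (λ a t u v → a :+ t :* u :+ (:- a :- t :* v :+ t :* (v :- u)) := con (+ 0)) refl a t (Rl.ev p t) (Rl.ev p 1#)))
        (positive t 0<t)

    derivative-stable : ∀ {d p} → HasLead (λ a → ¬ a ≈ 0#) (suc d) p → Stableᴿ p → Stableᴿ (derivative p)
    derivative-stable {p = p} lead stable z 0<x e = 0<⇒≉0 (gauss-lucasᴿ lead stable z 0<x)
      (trans (∙-cong (C.trans (C.sym (Rc.ev-derivative p z)) e) (C.refl {x = Rc.ev p z}))
        (solve 2 (λ a b → con (+ 0) :* a :+ con (+ 0) :* b := con (+ 0)) refl (re (Rc.ev p z)) (im (Rc.ev p z))))

    -- By induction p′ has nonnegative coefficients, so p p′ > 0 gives p > 0 on
    -- the positive axis and p(0) ≥ 0.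
    stable⇒nonneg : ∀ d {p} → HasLead (0# <_) d p → Stableᴿ p → All (0# ≤_) p
    stable⇒nonneg zero [ 0<a ] _ = inj₁ 0<a ∷ []
    stable⇒nonneg (suc d) {a ∷ p} lead@(_ ∷ lead-p) stable = constant-nonneg hs positive ∷ hs
      where
      hs : All (0# ≤_) p
      hs = scaleFrom-nonneg 0 p (stable⇒nonneg d (scaleFrom-lead 0 lead-p) (derivative-stable (positive⇒nonzero lead) stable))

      positive : ∀ x → 0# < x → 0# < Rl.ev (a ∷ p) x
      positive x 0<x = *-cancel-0< (ev′-nonneg hs a (inj₁ 0<x)) (<-respʳ
        (trans (∙-cong (ev′-real (a ∷ p) x) (ev-real (a ∷ p) x))
          (solve 2 (λ a b → a :* b :+ con (+ 0) :* con (+ 0) := a :* b) refl (Rl.ev′ (a ∷ p) x) (Rl.ev (a ∷ p) x)))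
        (gauss-lucasᴿ (positive⇒nonzero lead) stable (ι x) 0<x))

  -- The coefficients of Σ g_k u^{N-k}, constant term first.
  descending : ∀ N → (Fin (suc N) → Carrier) → Poly
  descending zero    g = g zero ∷ []
  descending (suc N) g = descending N (g ∘ suc) ∷ʳ g zero

  abstract
    length-descending : ∀ N g → length (descending N g) ≡ suc N
    length-descending zero    g = ≡.refl
    length-descending (suc N) g = ≡.trans (List.length-++ (descending N (g ∘ suc)))
      (≡.trans (ℕ.+-comm _ 1) (≡.cong suc (length-descending N (g ∘ suc))))

    descending-lead : ∀ N g → 0# < g zero → HasLead (0# <_) N (descending N g)
    descending-lead zero    g 0<g = [ 0<g ]
    descending-lead (suc N) g 0<g = snoc (descending N (g ∘ suc)) (length-descending N (g ∘ suc))
      where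
      snoc : ∀ {n} p → length p ≡ n → HasLead (0# <_) n (p ∷ʳ g zero)
      snoc []      ≡.refl = [ 0<g ]
      snoc (a ∷ p) ≡.refl = a ∷ snoc p ≡.refl

    descending-nonneg : ∀ N g → All (0# ≤_) (descending N g) → ∀ k → 0# ≤ g k
    descending-nonneg zero    g (h ∷ []) zero    = h
    descending-nonneg (suc N) g hs       zero    = proj₂ (All.∷ʳ⁻ hs)
    descending-nonneg (suc N) g hs       (suc k) = descending-nonneg N (g ∘ suc) (proj₁ (All.∷ʳ⁻ hs)) k

    -- Used with 1 + z² = z u: the γ-expansion at z becomes (1 + z)^ν z^N G(u), where G is
    -- `descending N g`.
    form-descending : ∀ N g z u → Hc.form N (ι ∘ g) z (z *ᶜ u) ≈ᶜ z ^ᶜ N *ᶜ Rc.ev (descending N g) u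
    form-descending zero    g z u = S.solve 2 (λ a u → a S.:= S.con (+ 1) S.:* (a S.:+ u S.:* S.con (+ 0))) C.refl (ι (g zero)) u
    form-descending (suc N) g z u = C.trans (C.+-cong
        (C.*-congˡ {x = ι (g zero)} (^-distrib-* z u (suc N))) (C.*-congˡ {x = z} (form-descending N (g ∘ suc) z u)))
      (C.trans (S.solve 5 (λ a zn un z f → a S.:* (zn S.:* un) S.:+ z S.:* f S.:= z S.:* f S.:+ zn S.:* (un S.:* a)) C.refl
          (ι (g zero)) (z ^ᶜ suc N) (u ^ᶜ suc N) z (z ^ᶜ N *ᶜ Rc.ev (descending N (g ∘ suc)) u))
        (C.trans (S.solve 5 (λ z zn f un a → z S.:* (zn S.:* f) S.:+ z S.:* zn S.:* (un S.:* a) S.:= z S.:* zn S.:* (f S.:+ un S.:* a)) C.refl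
          z (z ^ᶜ N) (Rc.ev (descending N (g ∘ suc)) u) (u ^ᶜ suc N) (ι (g zero)))
          (C.*-congˡ {x = z ^ᶜ suc N} (C.sym (C.trans (Rc.ev-∷ʳ (descending N (g ∘ suc)) (g zero) u)
            (C.+-congˡ {x = Rc.ev (descending N (g ∘ suc)) u} (C.*-congʳ {x = ι (g zero)}
              (C.reflexive (≡.cong (u ^ᶜ_) (length-descending N (g ∘ suc)))))))))))
      where open CommutativeExp C.commutativeSemiring using (^-distrib-*)

    -- u = z + 1/z
    joukowski : ∀ u → 0# < re u → ¬ ¬ (∃[ z ] 0# < re z × 1ᶜ +ᶜ z *ᶜ z ≈ᶜ z *ᶜ u)
    joukowski u 0<u none = FTA.fundamental-theorem-of-algebra {d = 1} {1ᶜ ∷ -ᶜ u ∷ 1ᶜ ∷ []} (_ ∷ _ ∷ [ 0≉1ᶜ ])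
      λ (z , root) → none (z , right z (inverse-pair z root) , C.trans (C.+-congʳ (C.sym (inverse-pair z root)))
        (S.solve 2 (λ z u → z S.:* (u S.:- z) S.:+ z S.:* z S.:= z S.:* u) C.refl z u))
      where
      inverse-pair : ∀ z → Cx.ev (1ᶜ ∷ -ᶜ u ∷ 1ᶜ ∷ []) z ≈ᶜ 0ᶜ → z *ᶜ (u +ᶜ -ᶜ z) ≈ᶜ 1ᶜ
      inverse-pair z root = C.trans (S.solve 2 (λ z u → z S.:* (u S.:- z) S.:=
          S.con (+ 1) S.:+ S.:- (S.con (+ 1) S.:+ z S.:* (S.:- u S.:+ z S.:* (S.con (+ 1) S.:+ z S.:* S.con (+ 0))))) C.refl z u)
        (C.trans (C.+-congˡ {x = 1ᶜ} (C.-‿cong root)) (S.solve 0 (S.con (+ 1) S.:+ S.:- S.con (+ 0) S.:= S.con (+ 1)) C.refl))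

      -- From z w = 1 follows |z|² Re w = Re z. If Re z ≤ 0, then Re w = Re u - Re z > 0, and this
      -- identity would make Re z positive.
      right : ∀ z → z *ᶜ (u +ᶜ -ᶜ z) ≈ᶜ 1ᶜ → 0# < re z
      right z zw≈1 = ≰⇒> λ z≤0 → ≤⇒≯ z≤0 (<-respʳ w-re (0<normSq z≉0 0<* (0<u 0<+≤ 0≤neg z≤0)))
        where
        w : ℂ
        w = u +ᶜ -ᶜ z
        z≉0 : ¬ z ≈ᶜ 0ᶜ
        z≉0 z≈0 = 0≉1ᶜ (C.trans (C.sym zw≈1) (C.trans (C.*-congʳ {x = w} z≈0) (C.zeroˡ w)))
        w-re : normSq z * re w ≈ re z
        w-re = trans (solve 4 (λ a b x y → (a :* a :+ b :* b) :* x := a :* (a :* x :- b :* y) :+ b :* (a :* y :+ b :* x)) refl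
            (re z) (im z) (re w) (im w))
          (trans (+-cong (*-congˡ (proj₁ zw≈1)) (*-congˡ (proj₂ zw≈1)))
            (solve 2 (λ a b → a :* con (+ 1) :+ b :* con (+ 0) := a) refl (re z) (im z)))

    parity : ∀ d → ∃[ N ] ∃[ ν ] d ≡ degree N ν
    parity zero          = 0 , zero , ≡.refl
    parity (suc zero)    = 0 , suc zero , ≡.refl
    parity (suc (suc d)) = let N , ν , e = parity d in suc N , ν , ≡.cong (λ n → suc (suc n)) e

    ≈ₚ-gammaExpansion : ∀ p N ν g → (∀ x → Rl.ev p x ≈ gammaValue N ν g x) → p ≈ₚ gammaExpansion (toℕ ν) N g
    ≈ₚ-gammaExpansion p N ν g eq = ≈ₚ-from-values p (gammaExpansion (toℕ ν) N g)
      λ x _ → trans (eq x) (sym (Γr.ev-gammaExpansion (toℕ ν) N g x))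

    stable-expansion-nonneg : ∀ p N ν g → (∀ x → Rl.ev p x ≈ gammaValue N ν g x) → 0# < coeff p 0 → Stableᴿ p →
      ∀ k → 0# ≤ g k
    stable-expansion-nonneg p N ν g eq 0<p₀ stable = descending-nonneg N g (stable⇒nonneg N (descending-lead N g 0<g₀) stable-G)
      where
      -- g_0 is the value p(0) and at the same time the leading coefficient of `descending N g`.
      0<g₀ : 0# < g zero
      0<g₀ = <-respʳ (trans (sym (coeff-0 p)) (trans (eq 0#) (gammaValue-0 N ν g))) 0<p₀

      stable-G : Stableᴿ (descending N g)
      stable-G u 0<u G≈0 = joukowski u 0<u λ (z , 0<z , zu) → stable z 0<z (C.trans
        (Rc.ev-cong p (gammaExpansion (toℕ ν) N g) z (≈ₚ-gammaExpansion p N ν g eq)) (C.trans (Γc.ev-gammaExpansion (toℕ ν) N g z)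
          (C.trans (C.*-congˡ {x = (1ᶜ +ᶜ z) ^ᶜ toℕ ν} (C.trans (Hc.form-cong N (ι ∘ g) C.refl zu)
            (C.trans (form-descending N g z u) (C.trans (C.*-congˡ {x = z ^ᶜ N} G≈0) (C.zeroʳ (z ^ᶜ N))))))
            (C.zeroʳ ((1ᶜ +ᶜ z) ^ᶜ toℕ ν)))))

    symmetric-stable⇒cone : ∀ {p d} → IsSymmetric p d → 0# < coeff p d → Stableᴿ p →
      ∃[ N ] ∃[ ν ] d ≡ degree N ν × InCone N (toℕ ν) (Rl.ev p)
    symmetric-stable⇒cone {p} {d} ((_ , beyond) , symm) 0<lead stable = go (parity d)
      where
      f : Poly
      f = take (suc d) p
      f≈ : f ≈ₚ p
      f≈ = take-≈ₚ (suc d) p beyond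
      ev-f : ∀ x → Rl.ev f x ≈ Rl.ev p x
      ev-f x = Rl.ev-cong f p x f≈
      f-symmetric : SymmetricValues d f
      f-symmetric = SymmetricValues-≈ {d} {p} {f} (λ x → sym (ev-f x)) symm
      -- Symmetry carries the positive leading coefficient over to the constant term.
      0<p₀ : 0# < coeff p 0
      0<p₀ = <-respʳ (trans (sym (f≈ d)) (trans (extreme-coefficients d f (length-take (suc d) p) f-symmetric) (f≈ 0))) 0<lead

      go : ∃[ N ] ∃[ ν ] d ≡ degree N ν → ∃[ N ] ∃[ ν ] d ≡ degree N ν × InCone N (toℕ ν) (Rl.ev p)
      go (N , ν , ≡.refl) = N , ν , ≡.refl , in-cone (expansion N ν f (length-take (suc d) p) f-symmetric)
        where
        in-cone : ∃[ g ] (∀ x → Rl.ev f x ≈ gammaValue N ν g x) → InCone N (toℕ ν) (Rl.ev p)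
        in-cone (g , eq) = cone g (stable-expansion-nonneg p N ν g eq′ 0<p₀ stable) eq′
          where
          eq′ : ∀ x → Rl.ev p x ≈ gammaValue N ν g x
          eq′ x = trans (sym (ev-f x)) (eq x)

-- One step of the recurrence for polynomials

module Preservation {c ℓ₁ ℓ₂} (ℝ : CompleteOrderedField c ℓ₁ ℓ₂) where
  open OrderedFieldProperties ℝ
  open ComplexNumbers ℝ
  open RealAndComplex ℝ using
    ( Poly; coeff; _≈ₚ_; _+ₚ_; _*ₚ_; derivative; HasDegree; IsSymmetric; SemiGammaPositive
    ; HurwitzStable; complexify; module ℂ[x])
  open Solver using (solve; _:+_; _:*_; _:-_; :-_; _:=_; con)
  open Exp semiring using (_^_)
  open GammaCone ℝ using (InCone; cone; P; S)
  open GammaRecurrence ℝ using (even-step; odd-step)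
  open SymmetricPolynomials ℝ
  open GammaExpansionExists ℝ
  open RealStablePolynomials ℝ
  open RecurrenceStability ℝ
  private module C = ℂ-Ring

  abstract
    trim : ∀ d p → ¬ coeff p d ≈ 0# → HasLead (λ a → ¬ a ≈ 0#) d (take (suc d) p)
    trim d       []      p≉0 = ⊥-elim (p≉0 refl)
    trim zero    (a ∷ p) a≉0 = [ a≉0 ]
    trim (suc d) (a ∷ p) p≉0 = a ∷ trim d p p≉0

    degree-suc : ∀ N → degree N (suc zero) ≡ suc (degree N zero)
    degree-suc zero    = ≡.refl
    degree-suc (suc N) = ≡.cong (λ n → suc (suc n)) (degree-suc N)

    coeff-complexify : ∀ p k → ℂ[x].coeff (complexify p) k ≡ ι (coeff p k)
    coeff-complexify []      k       = ≡.refl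
    coeff-complexify (a ∷ p) zero    = ≡.refl
    coeff-complexify (a ∷ p) (suc k) = coeff-complexify p k

    hurwitz⇒stable : ∀ {p d} → HasDegree p d → HurwitzStable (complexify p) → Stableᴿ p
    hurwitz⇒stable {p} {d} (p≉0 , _) (inj₁ p≈0) = ⊥-elim (p≉0 (proj₁ (C.trans (C.reflexive (≡.sym (coeff-complexify p d))) (p≈0 d))))
    hurwitz⇒stable {p} deg (inj₂ stable) z 0<x e = stable z 0<x (C.trans (C.reflexive (ev-map-ι p z)) e)

    stable⇒hurwitz : ∀ {p} → Stableᴿ p → HurwitzStable (complexify p)
    stable⇒hurwitz {p} stable = inj₂ λ z 0<x e → stable z 0<x (C.trans (C.reflexive (≡.sym (ev-map-ι p z))) e)

    -- Symmetry is given for the initial polynomial alone; for the others it is inherited from the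
    -- expansion itself.
    cone⇒semi-γ-positive : ∀ {p d N ν} → HasDegree p d → d ≡ degree N ν → InCone N (toℕ ν) (Rl.ev p) → SemiGammaPositive p
    cone⇒semi-γ-positive {p} {N = N} {ν} deg ≡.refl (cone g 0≤g eq) = N , ν
      , (≡.subst (HasDegree p) (degree-≡ N ν) deg , λ x y xy≈1 → trans (eq x) (trans (gammaValue-symmetric N ν g x y xy≈1)
          (*-cong (reflexive (≡.cong (x ^_) (degree-≡ N ν))) (sym (eq y)))))
      , g , ≈ₚ-gammaExpansion p N ν g eq , 0≤g

  module _ (p p₁ : Poly) (m : ℕ) (β μ ν : Carrier)
    (deg : HasDegree p m) (deg₁ : HasDegree p₁ (suc m))
    (recurrence : p₁ ≈ₚ ((β + m · ν) ∷ β ∷ (- (m · μ)) ∷ []) *ₚ p +ₚ ((- μ) ∷ (- ν) ∷ ν ∷ μ ∷ []) *ₚ derivative p)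
    (0≤ν : 0# ≤ ν) (μ+ν≤0 : μ + ν ≤ 0#) (0≤2β+ : 0# ≤ 2 · β + m · (μ + ν)) where
    private
      M e h : Carrier
      M = nat m
      e = ½ * - (μ + ν)
      h = ½ * (2 · β + m · (μ + ν))

      given-P given-S coeffs-P coeffs-S : Poly
      given-P  = (β + m · ν) ∷ β ∷ (- (m · μ)) ∷ []
      given-S  = (- μ) ∷ (- ν) ∷ ν ∷ μ ∷ []
      coeffs-P = (h + M * e + M * ν) ∷ (h + M * e) ∷ (M * (2# * e + ν)) ∷ []
      coeffs-S = (2# * e + ν) ∷ (- ν) ∷ ν ∷ (- (2# * e + ν)) ∷ []

    abstract
      0≤e : 0# ≤ e
      0≤e = inj₁ 0<½ 0≤* 0≤neg μ+ν≤0

      0≤h : 0# ≤ h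
      0≤h = inj₁ 0<½ 0≤* 0≤2β+

      β≈ : β ≈ h + M * e
      β≈ = trans (sym (½+½ β)) (trans (solve 5 (λ w b m u v → w :* b :+ w :* b :=
          w :* (b :+ (b :+ con (+ 0)) :+ m :* (u :+ v)) :+ m :* (w :* :- (u :+ v))) refl ½ β M μ ν)
        (+-congʳ (*-congˡ (+-congˡ (sym (·≈* m (μ + ν)))))))

      -μ≈ : - μ ≈ 2# * e + ν
      -μ≈ = trans (solve 2 (λ u v → :- u := :- (u :+ v) :+ v) refl μ ν)
        (+-congʳ (trans (sym (*-identityˡ _)) (trans (*-congʳ (sym 2*½≈1)) (*-assoc 2# ½ (- (μ + ν))))))

      μ≈ : μ ≈ - (2# * e + ν)
      μ≈ = trans (solve 1 (λ u → u := :- :- u) refl μ) (-‿cong -μ≈)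

      P-list : given-P ≈ₚ coeffs-P
      P-list zero                = +-cong β≈ (·≈* m ν)
      P-list (suc zero)          = β≈
      P-list (suc (suc zero))    = trans (-‿cong (·≈* m μ))
        (trans (solve 2 (λ m u → :- (m :* u) := m :* :- u) refl M μ) (*-congˡ -μ≈))
      P-list (suc (suc (suc k))) = refl

      S-list : given-S ≈ₚ coeffs-S
      S-list zero                      = -μ≈
      S-list (suc zero)                = refl
      S-list (suc (suc zero))          = refl
      S-list (suc (suc (suc zero)))    = μ≈
      S-list (suc (suc (suc (suc k)))) = refl

      value : ∀ x → Rl.ev p₁ x ≈ P M ν e h x * Rl.ev p x + S M ν e h x * Rl.ev′ p x
      value x = trans (Rl.ev-cong p₁ (given-P *ₚ p +ₚ given-S *ₚ derivative p) x recurrence) (trans (Rl.ev-+ (given-P *ₚ p) (given-S *ₚ derivative p) x) (+-cong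
        (trans (Rl.ev-* given-P p x) (*-congʳ (Rl.ev-cong given-P coeffs-P x P-list)))
        (trans (Rl.ev-* given-S (derivative p) x) (*-cong (Rl.ev-cong given-S coeffs-S x S-list) (Rl.ev-derivative p x)))))

      valueᶜ : ∀ z → Rc.ev p₁ z ≈ᶜ P-value M ν e h z *ᶜ Rc.ev p z +ᶜ S-value M ν e h z *ᶜ Rc.ev′ p z
      valueᶜ z = C.trans (Rc.ev-cong p₁ (given-P *ₚ p +ₚ given-S *ₚ derivative p) z recurrence) (C.trans (Rc.ev-+ (given-P *ₚ p) (given-S *ₚ derivative p) z) (C.+-cong
        (C.trans (Rc.ev-* given-P p z) (C.*-congʳ {x = Rc.ev p z} (Rc.ev-cong given-P coeffs-P z P-list)))
        (C.trans (Rc.ev-* given-S (derivative p) z) (C.*-cong (Rc.ev-cong given-S coeffs-S z S-list) (Rc.ev-derivative p z)))))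

      trimmed : take (suc m) p ≈ₚ p
      trimmed = take-≈ₚ (suc m) p (proj₂ deg)

      -- Otherwise both P and S p′ vanish, hence p₁ = 0, which has no degree. This excludes the only
      -- degenerate case of `energy-positive`.
      parameters-not-all-0 : ¬ (M * ν ≈ 0# × M * e ≈ 0# × h ≈ 0#)
      parameters-not-all-0 (Mν≈0 , Me≈0 , h≈0) = proj₁ deg₁ (≈ₚ-from-values p₁ [] (λ x _ → trans (value x)
          (trans (+-cong (trans (*-congʳ (P≈0 x)) (zeroˡ _)) (S-term≈0 m ≡.refl x)) (+-identityʳ 0#))) (suc m))
        where
        P≈0 : ∀ x → P M ν e h x ≈ 0#
        P≈0 x = trans (solve 5 (λ M v e h x → h :+ M :* e :+ M :* v :+ x :* (h :+ M :* e :+ x :* (M :* (con (+ 2) :* e :+ v) :+ x :* con (+ 0))) :=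
            h :* (con (+ 1) :+ x) :+ (M :* e) :* (con (+ 1) :+ x :+ con (+ 2) :* x :* x) :+ (M :* v) :* (con (+ 1) :+ x :* x)) refl M ν e h x)
          (trans (+-cong (+-cong (*-congʳ h≈0) (*-congʳ Me≈0)) (*-congʳ Mν≈0))
            (solve 1 (λ x → con (+ 0) :* (con (+ 1) :+ x) :+ con (+ 0) :* (con (+ 1) :+ x :+ con (+ 2) :* x :* x) :+
              con (+ 0) :* (con (+ 1) :+ x :* x) := con (+ 0)) refl x))

        constant′ : ∀ {q} → HasLead (λ a → ¬ a ≈ 0#) 0 q → ∀ x → Rl.ev′ q x ≈ 0#
        constant′ [ _ ] x = solve 1 (λ x → con (+ 0) :+ x :* con (+ 0) := con (+ 0)) refl x

        -- For m = 0 the products M ν and M e carry no information, but then p is constant. For m >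
        -- 0 they force ν = e = 0 and with it S = 0.
        S-term≈0 : ∀ k → m ≡ k → ∀ x → S M ν e h x * Rl.ev′ p x ≈ 0#
        S-term≈0 zero    ≡.refl x = trans (*-congˡ (trans (sym (Rl.ev′-cong (take 1 p) p x trimmed)) (constant′ (trim 0 p (proj₁ deg)) x))) (zeroʳ _)
        S-term≈0 (suc k) ≡.refl x = trans (*-congʳ (trans
            (solve 3 (λ v e x → con (+ 2) :* e :+ v :+ x :* (:- v :+ x :* (v :+ x :* (:- (con (+ 2) :* e :+ v) :+ x :* con (+ 0)))) :=
              e :* (con (+ 2) :- con (+ 2) :* x :* x :* x) :+ v :* (con (+ 1) :- x :+ x :* x :- x :* x :* x)) refl ν e x)
            (trans (+-cong (*-congʳ (*-≉0 Me≈0 (0<⇒≉0 (0<nat k)))) (*-congʳ (*-≉0 Mν≈0 (0<⇒≉0 (0<nat k)))))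
              (solve 1 (λ x → con (+ 0) :* (con (+ 2) :- con (+ 2) :* x :* x :* x) :+
                con (+ 0) :* (con (+ 1) :- x :+ x :* x :- x :* x :* x) := con (+ 0)) refl x)))) (zeroˡ _)

      stable-step : Stableᴿ p → Stableᴿ p₁
      stable-step stable z 0<x p₁≈0 = combination-≉0 (P-value M ν e h z) (S-value M ν e h z) (Rc.ev p z) (Rc.ev′ p z)
        (stable z 0<x)
        (≤-respˡ (*-congˡ (normSq-cong ev′≈)) (≤-respʳ (*-congˡ (∙-cong ev′≈ (ev≈ z))) (laguerreᴿ (trim m p (proj₁ deg)) stable-trimmed z 0<x)))
        (energy-positive z (0≤nat m) 0≤ν 0≤e 0≤h 0<x parameters-not-all-0)
        (C.trans (C.sym (valueᶜ z)) p₁≈0)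
        where
        ev≈ : ∀ z → Rc.ev (take (suc m) p) z ≈ᶜ Rc.ev p z
        ev≈ z = Rc.ev-cong (take (suc m) p) p z trimmed
        ev′≈ : Rc.ev′ (take (suc m) p) z ≈ᶜ Rc.ev′ p z
        ev′≈ = Rc.ev′-cong (take (suc m) p) p z trimmed
        stable-trimmed : Stableᴿ (take (suc m) p)
        stable-trimmed z 0<x e = stable z 0<x (C.trans (C.sym (ev≈ z)) e)

      -- Raising the degree by one alternates the factor 1 + x: degree 2 N gains it with N kept, and
      -- degree 2 N + 1 trades it for N + 1.
      cone-step : ∃[ N ] ∃[ ε ] m ≡ degree N ε × InCone N (toℕ ε) (Rl.ev p) →
                  ∃[ N ] ∃[ ε ] suc m ≡ degree N ε × InCone N (toℕ ε) (Rl.ev p₁)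
      cone-step (N , zero , m≡ , cone g 0≤g eq) = N , suc zero , ≡.trans (≡.cong suc m≡) (≡.sym (degree-suc N))
        , even-step N g 0≤g 0≤ν 0≤e 0≤h p p₁ value (reflexive (≡.cong nat (≡.trans m≡ (degree-≡ N zero))))
            (≈ₚ-gammaExpansion p N zero g eq)
      cone-step (N , suc zero , m≡ , cone g 0≤g eq) = suc N , zero , ≡.cong suc (≡.trans m≡ (degree-suc N))
        , odd-step N g 0≤g 0≤ν 0≤e 0≤h p p₁ value (reflexive (≡.cong nat (≡.trans m≡ (degree-≡ N (suc zero)))))
            (≈ₚ-gammaExpansion p N (suc zero) g eq)

theorem4p6 : ∀ {c ℓ₁ ℓ₂} (ℝ : CompleteOrderedField c ℓ₁ ℓ₂) →
    let open CompleteOrderedField ℝ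
        open RealAndComplex ℝ
    in
    (T : ℕ → Poly) (m : ℕ → ℕ) (β μ ν : ℕ → Carrier) →
    (∀ n → HasDegree (T n) (m n)) →
    (∀ n → m (suc n) ≡ suc (m n)) →
    (∀ n → T (suc n) ≈ₚ
      ((β n + m n · ν n) ∷ β n ∷ (- (m n · μ n)) ∷ []) *ₚ T n
      +ₚ ((- μ n) ∷ (- ν n) ∷ ν n ∷ μ n ∷ []) *ₚ derivative (T n)) →
    (∀ n → μ n ≤ 0#) →
    (∀ n → 0# ≤ ν n) →
    IsSymmetric (T 0) (m 0) →
    0# < coeff (T 0) (m 0) →
    HurwitzStable (complexify (T 0)) →
    (∀ n → μ n + ν n ≤ 0#) →
    (∀ n → 0# ≤ 2 · β n + m n · (μ n + ν n)) →
    ∀ n → HurwitzStable (complexify (T n)) × SemiGammaPositive (T n)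
theorem4p6 ℝ T m β μ ν deg m-suc recurrence _ 0≤ν symm 0<lead hurwitz μ+ν≤0 0≤2β+ n =
  stable⇒hurwitz {T n} (stable n) , let N , ε , m≡ , in-cone = cones n in cone⇒semi-γ-positive {T n} (deg n) m≡ in-cone
  where
  open Preservation ℝ
  open RealStablePolynomials ℝ
  open RealAndComplex ℝ using (HasDegree)
  open GammaCone ℝ using (InCone)
  open SymmetricPolynomials ℝ using (degree)

  deg₁ : ∀ n → HasDegree (T (suc n)) (suc (m n))
  deg₁ n = ≡.subst (HasDegree (T (suc n))) (m-suc n) (deg (suc n))

  stable : ∀ n → Stableᴿ (T n)
  stable zero    = hurwitz⇒stable {T 0} (deg 0) hurwitz
  stable (suc n) = stable-step (T n) (T (suc n)) (m n) (β n) (μ n) (ν n) (deg n) (deg₁ n) (recurrence n) (0≤ν n) (μ+ν≤0 n) (0≤2β+ n) (stable n)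

  cones : ∀ n → ∃[ N ] ∃[ ε ] m n ≡ degree N ε × InCone N (toℕ ε) (Rl.ev (T n))
  cones zero    = symmetric-stable⇒cone {p = T 0} symm 0<lead (stable 0)
  cones (suc n) = let
    N , ε , m≡ , in-cone = cone-step (T n) (T (suc n)) (m n) (β n) (μ n) (ν n) (deg n) (deg₁ n) (recurrence n) (0≤ν n) (μ+ν≤0 n) (0≤2β+ n) (cones n)
    in N , ε , ≡.trans (m-suc n) m≡ , in-cone
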